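{- For integers $n \ge 0$ and $i \in \{0,1,2,3\}$, let $a_i(n)$ denote the number of partitions $\lambda$ of $n$ whose dimension $f^\lambda$ satisfies $f^\lambda \equiv i \pmod 4$, and let $a(n) = a_1(n) + a_3(n)$ be the number of partitions of $n$ with odd dimension (with $a(0)=1$, $a_2(0)=0$, the empty partition having dimension $1$). Let $n = 2^R + m$ with integers $R \ge 1$ and $0 \le m < 2^R$. Then \[a_2(n) = \begin{cases} 2^R\cdot a_2(m) + \binom{2^{R-1}}{2}\cdot a(m), & \text{ if }m < 2^{R-1},\\[4pt] 2^R\cdot a_2(m) + \left(\binom{2^{R-1}}{3} + 2^{R-1}\right) \cdot \dfrac{a(m)}{2^{R-1}}, & \text{ if } 2^{R-1} \leq m < 2^R. \end{cases}\]
   Context: A partition of $n$ is a weakly decreasing sequence of positive integers summing to $n$. The dimension $f^\lambda$ of a partition $\lambda$ is the number of standard Young tableaux of shape $\lambda$, i.e. fillings of the Ferrers diagram of $\lambda$ with $1,\dots,n$, each used once, increasing strictly along rows and down columns. -}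

module Defs where

open import Data.Bool using (Bool; true; false; _∧_; if_then_else_)
open import Data.Nat using (ℕ; zero; suc; _+_; _%_; _≡ᵇ_; _<ᵇ_; _≤ᵇ_)
open import Data.List using (List; []; _∷_; map; concat; concatMap; upTo; zipWith)
open import Data.Nat.ListAction using (sum)
open import Data.Bool.ListAction using (all)

countB : {A : Set} → (A → Bool) → List A → ℕ
countB p []       = 0
countB p (x ∷ xs) = if p x then suc (countB p xs) else countB p xs

oneTo : ℕ → List ℕ
oneTo n = map suc (upTo n)

listsOfLength : ℕ → List ℕ → List (List ℕ)
listsOfLength zero    xs = [] ∷ []
listsOfLength (suc k) xs = concatMap (λ x → map (x ∷_) (listsOfLength k xs)) xs

weaklyDecr : List ℕ → Bool
weaklyDecr []           = true
weaklyDecr (x ∷ [])     = true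
weaklyDecr (x ∷ y ∷ xs) = (y ≤ᵇ x) ∧ weaklyDecr (y ∷ xs)

strictlyIncr : List ℕ → Bool
strictlyIncr []           = true
strictlyIncr (x ∷ [])     = true
strictlyIncr (x ∷ y ∷ xs) = (x <ᵇ y) ∧ strictlyIncr (y ∷ xs)

isPartitionOf : ℕ → List ℕ → Bool
isPartitionOf n λ' = all (λ x → 1 ≤ᵇ x) λ' ∧ weaklyDecr λ' ∧ (sum λ' ≡ᵇ n)

-- all partitions of n (each partition has at most n parts, each part ≤ n);
-- candidates are all lists of length ≤ n with entries in 1..n, filtered
Partitions : ℕ → List (List ℕ)
Partitions n =
  concatMap (λ k → concatMap (λ l → if isPartitionOf n l then l ∷ [] else [])
                             (listsOfLength k (oneTo n)))
            (upTo (suc n))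

-- A filling of the Ferrers diagram of λ is a list of rows, row i having
-- length λ_i; all fillings with entries in 1..n:
fillings : ℕ → List ℕ → List (List (List ℕ))
fillings n []        = [] ∷ []
fillings n (l ∷ λ')  = concatMap (λ r → map (r ∷_) (fillings n λ')) (listsOfLength l (oneTo n))

colsIncr : List (List ℕ) → Bool
colsIncr []             = true
colsIncr (r ∷ [])       = true
colsIncr (r ∷ s ∷ rows) = and' (zipWith _<ᵇ_ r s) ∧ colsIncr (s ∷ rows)
  where
  and' : List Bool → Bool
  and' = all (λ b → b)

isSYT : ℕ → List (List ℕ) → Bool
isSYT n T = all strictlyIncr T ∧ colsIncr T
          ∧ all (λ k → countB (λ x → x ≡ᵇ k) (concat T) ≡ᵇ 1) (oneTo n)

dim : List ℕ → ℕ
dim λ' = countB (isSYT (sum λ')) (fillings (sum λ') λ')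

aMod4 : ℕ → ℕ → ℕ
aMod4 i n = countB (λ λ' → (dim λ' % 4) ≡ᵇ i) (Partitions n)

aOdd : ℕ → ℕ
aOdd n = aMod4 1 n + aMod4 3 n

{-# OPTIONS --safe #-}
module Submission where

-- By the hook length formula, the 2-adic valuation of f^λ is v₂(n!) minus the valuations of the hooks.
-- Encoding λ by its boundary word and taking every second letter gives the 2-quotient (μ, ν) and the 2-core of λ;
-- the even hooks of λ are the doubled hooks of μ and ν, so with m = |μ| + |ν| + ⌊|core|/2⌋
--   v₂(f^λ) = ⌊|core|/2⌋ + v₂(m! / (|μ|! |ν|!)) + v₂(f^μ) + v₂(f^ν).
-- Hence only cores of size 0, 1 and 3 contribute to valuations 0 and 1, and the numbers of partitions of 2m and 2m+1
-- with these valuations are convolutions over |μ| + |ν| controlled by the binary carries. Following the top binary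
-- digit of m through the convolutions turns them into the stated recursion, by induction on R.

open import Defs
import Algebra.Properties.CommutativeSemigroup as CommutativeSemigroup
open import Data.Bool using (Bool; true; false; T; T?; _∧_; if_then_else_)
open import Data.Bool.ListAction using (all)
open import Data.Bool.Properties using (T-∧; T-≡)
open import Data.Empty using (⊥-elim)
open import Data.Integer as ℤ using (ℤ; +_; 0ℤ; 1ℤ)
import Data.Integer.Properties as ℤ
open import Data.Integer.Tactic.RingSolver using (solve-∀)
open import Data.List using (List; []; _∷_; _++_; _∷ʳ_; map; concat; concatMap; length; filter; take; replicate; zipWith; cartesianProductWith; upTo)
open import Data.List.Membership.Propositional
open import Data.List.Membership.Propositional.Properties
open import Data.List.Membership.Propositional.Properties.WithK using (unique∧set⇒bag)
open import Data.List.Properties hiding (sum-++)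
open import Data.List.Relation.Binary.BagAndSetEquality using (∼bag⇒↭)
open import Data.List.Relation.Binary.Permutation.Propositional.Properties using (↭-length)
open import Data.List.Relation.Unary.All as All using (All; []; _∷_)
import Data.List.Relation.Unary.All.Properties as All
open import Data.List.Relation.Unary.AllPairs using (AllPairs; []; _∷_)
import Data.List.Relation.Unary.AllPairs.Properties as AllPairs
open import Data.List.Relation.Unary.Any using (here; there)
open import Data.List.Relation.Unary.Linked as Linked using (Linked; []; [-]; _∷_)
open import Data.List.Relation.Unary.Linked.Properties using (Linked⇒AllPairs; AllPairs⇒Linked)
open import Data.List.Relation.Unary.Unique.Propositional using (Unique)
import Data.List.Relation.Unary.Unique.Propositional.Properties as Unique
open import Data.Nat
open import Data.Nat.Combinatorics using (_C_; nC1≡n; nCk+nC[k+1]≡[n+1]C[k+1]; k![n∸k]!∣n!)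
open import Data.Nat.Divisibility using (divides)
open import Data.Nat.DivMod using ([m+kn]%n≡m%n)
open import Data.Nat.Induction using (<-wellFounded)
open import Data.Nat.ListAction using (sum; product)
open import Data.Nat.ListAction.Properties using (sum-++)
open import Data.Nat.Properties
open import Data.Nat.Tactic.RingSolver using () renaming (solve-∀ to solveℕ)
open import Data.Product using (_×_; _,_; proj₁; proj₂; ∃)
open import Data.Sum using (_⊎_; inj₁; inj₂)
open import Function using (_∘_; id; mk⇔; Equivalence)
open import Induction.WellFounded using (Acc; acc)
open import Relation.Binary.PropositionalEquality
open import Relation.Nullary

open Equivalence using (to; from)
open ≡-Reasoning
open CommutativeSemigroup +-commutativeSemigroup using () renaming (x∙yz≈y∙xz to +-exchange)
open CommutativeSemigroup *-commutativeSemigroup using () renaming (x∙yz≈y∙xz to *-exchange)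

-- A Vandermonde identity

-- The dimension is given only as a count of fillings, so the hook length formula is derived from
-- the branching rule: deleting the box of the largest entry gives a recursion for f^λ, and n! times
-- the Vandermonde product of the beta numbers over their factorials satisfies the same recursion,
-- by a polynomial identity about lowering one variable. All counting is done over words with fixed
-- numbers of trues and falses. In a large enough box every partition of n has exactly one word, and
-- separating the letters at even and odd places re-indexes a sum over words as a sum over pairs of
-- words; the core then shows as the difference between their numbers of trues. The recursion closes
-- because 2^R + m and m lose the same last digit under halving. The coefficient C(2^(R-1), 2) grows
-- by a square at each step, from pairs (|μ|, |ν|) whose two equal digits create the top digit by
-- one carry. The other coefficient is carried along as the integer (C(q, 3) + q)/q with q =
-- 2^(R-1).

diffs : ℤ → List ℤ → ℤ
diffs y []       = 1ℤ
diffs y (x ∷ xs) = (y ℤ.- x) ℤ.* diffs y xs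

vandermonde : List ℤ → ℤ
vandermonde []       = 1ℤ
vandermonde (x ∷ xs) = diffs x xs ℤ.* vandermonde xs

-- Lowering xs y ys zs: ys is xs without the entry y, zs is xs with that entry lowered by one.
data Lowering : List ℤ → ℤ → List ℤ → List ℤ → Set where
  here  : ∀ {x xs} → Lowering (x ∷ xs) x xs (x ℤ.- 1ℤ ∷ xs)
  there : ∀ {x xs y ys zs} → Lowering xs y ys zs → Lowering (x ∷ xs) y (x ∷ ys) (x ∷ zs)

ΣLowering : (ℤ → List ℤ → List ℤ → ℤ) → List ℤ → ℤ
ΣLowering f []       = 0ℤ
ΣLowering f (x ∷ xs) = f x xs (x ℤ.- 1ℤ ∷ xs) ℤ.+ ΣLowering (λ y ys zs → f y (x ∷ ys) (x ∷ zs)) xs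

-- The relation between the summands is asked for only along actual lowerings, since it will come
-- from `diffs-omit` and `diffs-lower`.
ΣLowering-linear : ∀ {f g h} a b xs →
  (∀ {y ys zs} → Lowering xs y ys zs → f y ys zs ≡ a ℤ.* g y ys zs ℤ.+ b ℤ.* h y ys zs) →
  ΣLowering f xs ≡ a ℤ.* ΣLowering g xs ℤ.+ b ℤ.* ΣLowering h xs
ΣLowering-linear a b [] eq = ring a b
  where
  ring : ∀ a b → 0ℤ ≡ a ℤ.* 0ℤ ℤ.+ b ℤ.* 0ℤ
  ring = solve-∀
ΣLowering-linear a b (x ∷ xs) eq =
  trans (cong₂ ℤ._+_ (eq here) (ΣLowering-linear a b xs (λ l → eq (there l)))) (ring a b _ _ _ _)
  where
  ring : ∀ a b p q r s → (a ℤ.* p ℤ.+ b ℤ.* q) ℤ.+ (a ℤ.* r ℤ.+ b ℤ.* s) ≡ a ℤ.* (p ℤ.+ r) ℤ.+ b ℤ.* (q ℤ.+ s)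
  ring = solve-∀

diffs-omit : ∀ {xs y ys zs} t → Lowering xs y ys zs → diffs t xs ≡ (t ℤ.- y) ℤ.* diffs t ys
diffs-omit t here = refl
diffs-omit t (there {x} {y = y} {ys} l) = trans (cong ((t ℤ.- x) ℤ.*_) (diffs-omit t l)) (ring (t ℤ.- x) (t ℤ.- y) (diffs t ys))
  where
  ring : ∀ a b c → a ℤ.* (b ℤ.* c) ≡ b ℤ.* (a ℤ.* c)
  ring = solve-∀

diffs-lower : ∀ {xs y ys zs} t → Lowering xs y ys zs → diffs t zs ≡ diffs t xs ℤ.+ diffs t ys
diffs-lower t (here {x} {xs}) = ring t x (diffs t xs)
  where
  ring : ∀ t x d → (t ℤ.- (x ℤ.- 1ℤ)) ℤ.* d ≡ (t ℤ.- x) ℤ.* d ℤ.+ d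
  ring = solve-∀
diffs-lower t (there {x} {xs} {ys = ys} l) =
  trans (cong ((t ℤ.- x) ℤ.*_) (diffs-lower t l)) (ℤ.*-distribˡ-+ (t ℤ.- x) (diffs t xs) (diffs t ys))

-- Partial fractions of the degree-zero function diffs (y - 1) xs / diffs y xs, with denominators cleared.
partial-fractions : ∀ y xs →
  diffs (y ℤ.- 1ℤ) xs ℤ.* vandermonde xs ℤ.+ ΣLowering (λ _ ys zs → diffs y ys ℤ.* vandermonde zs) xs
    ≡ diffs y xs ℤ.* vandermonde xs
partial-fractions y [] = refl
partial-fractions y (z ∷ xs) = begin
  by1 ℤ.* (bz ℤ.* v) ℤ.+ (b y ℤ.* (b (z ℤ.- 1ℤ) ℤ.* v) ℤ.+ Σ′)
    ≡⟨ cong (λ s → by1 ℤ.* (bz ℤ.* v) ℤ.+ (b y ℤ.* (b (z ℤ.- 1ℤ) ℤ.* v) ℤ.+ s)) (ΣLowering-linear (bz ℤ.* (y ℤ.- z ℤ.- 1ℤ)) (b y) xs term) ⟩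
  by1 ℤ.* (bz ℤ.* v) ℤ.+ (b y ℤ.* (b (z ℤ.- 1ℤ) ℤ.* v) ℤ.+ (bz ℤ.* (y ℤ.- z ℤ.- 1ℤ) ℤ.* S y ℤ.+ b y ℤ.* S z))
    ≡⟨ ring₁ y z (b (y ℤ.- 1ℤ)) bz v (b y) (b (z ℤ.- 1ℤ)) (S y) (S z) ⟩
  bz ℤ.* (y ℤ.- z ℤ.- 1ℤ) ℤ.* (b (y ℤ.- 1ℤ) ℤ.* v ℤ.+ S y) ℤ.+ b y ℤ.* (b (z ℤ.- 1ℤ) ℤ.* v ℤ.+ S z)
    ≡⟨ cong₂ (λ p q → bz ℤ.* (y ℤ.- z ℤ.- 1ℤ) ℤ.* p ℤ.+ b y ℤ.* q) (partial-fractions y xs) (partial-fractions z xs) ⟩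
  bz ℤ.* (y ℤ.- z ℤ.- 1ℤ) ℤ.* (b y ℤ.* v) ℤ.+ b y ℤ.* (b z ℤ.* v)
    ≡⟨ ring₂ y z bz (b y) v ⟩
  (y ℤ.- z) ℤ.* b y ℤ.* (bz ℤ.* v) ∎
  where
  b : ℤ → ℤ
  b t = diffs t xs
  bz = b z
  by1 = (y ℤ.- 1ℤ ℤ.- z) ℤ.* b (y ℤ.- 1ℤ)
  v = vandermonde xs
  S : ℤ → ℤ
  S t = ΣLowering (λ _ ys zs → diffs t ys ℤ.* vandermonde zs) xs
  Σ′ = ΣLowering (λ _ ys zs → diffs y (z ∷ ys) ℤ.* vandermonde (z ∷ zs)) xs
  ring₁ : ∀ y z c bz v by d p q →
    (y ℤ.- 1ℤ ℤ.- z) ℤ.* c ℤ.* (bz ℤ.* v) ℤ.+ (by ℤ.* (d ℤ.* v) ℤ.+ (bz ℤ.* (y ℤ.- z ℤ.- 1ℤ) ℤ.* p ℤ.+ by ℤ.* q))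
      ≡ bz ℤ.* (y ℤ.- z ℤ.- 1ℤ) ℤ.* (c ℤ.* v ℤ.+ p) ℤ.+ by ℤ.* (d ℤ.* v ℤ.+ q)
  ring₁ = solve-∀
  ring₂ : ∀ y z bz by v →
    bz ℤ.* (y ℤ.- z ℤ.- 1ℤ) ℤ.* (by ℤ.* v) ℤ.+ by ℤ.* (bz ℤ.* v) ≡ (y ℤ.- z) ℤ.* by ℤ.* (bz ℤ.* v)
  ring₂ = solve-∀
  ring₃ : ∀ y z x p q v →
    (y ℤ.- z) ℤ.* p ℤ.* (((z ℤ.- x) ℤ.* q ℤ.+ q) ℤ.* v)
      ≡ (z ℤ.- x) ℤ.* q ℤ.* (y ℤ.- z ℤ.- 1ℤ) ℤ.* (p ℤ.* v) ℤ.+ (y ℤ.- x) ℤ.* p ℤ.* (q ℤ.* v)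
  ring₃ = solve-∀
  -- The identity (y - z)(z - x + 1) = (z - x)(y - z - 1) + (y - x) splits the summand into one for
  -- `y` and one for `z`; hence the induction hypothesis is used at both points.
  term : ∀ {x ys zs} → Lowering xs x ys zs →
    diffs y (z ∷ ys) ℤ.* vandermonde (z ∷ zs)
      ≡ bz ℤ.* (y ℤ.- z ℤ.- 1ℤ) ℤ.* (diffs y ys ℤ.* vandermonde zs) ℤ.+ b y ℤ.* (diffs z ys ℤ.* vandermonde zs)
  term {x} {ys} {zs} l = begin
    (y ℤ.- z) ℤ.* diffs y ys ℤ.* (diffs z zs ℤ.* vandermonde zs)
      ≡⟨ cong (λ d → (y ℤ.- z) ℤ.* diffs y ys ℤ.* (d ℤ.* vandermonde zs)) (trans (diffs-lower z l) (cong (ℤ._+ diffs z ys) (diffs-omit z l))) ⟩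
    (y ℤ.- z) ℤ.* diffs y ys ℤ.* (((z ℤ.- x) ℤ.* diffs z ys ℤ.+ diffs z ys) ℤ.* vandermonde zs)
      ≡⟨ ring₃ y z x (diffs y ys) (diffs z ys) (vandermonde zs) ⟩
    (z ℤ.- x) ℤ.* diffs z ys ℤ.* (y ℤ.- z ℤ.- 1ℤ) ℤ.* (diffs y ys ℤ.* vandermonde zs) ℤ.+ (y ℤ.- x) ℤ.* diffs y ys ℤ.* (diffs z ys ℤ.* vandermonde zs)
      ≡⟨ cong₂ (λ p q → p ℤ.* (y ℤ.- z ℤ.- 1ℤ) ℤ.* (diffs y ys ℤ.* vandermonde zs) ℤ.+ q ℤ.* (diffs z ys ℤ.* vandermonde zs)) (diffs-omit z l) (diffs-omit y l) ⟨
    bz ℤ.* (y ℤ.- z ℤ.- 1ℤ) ℤ.* (diffs y ys ℤ.* vandermonde zs) ℤ.+ b y ℤ.* (diffs z ys ℤ.* vandermonde zs) ∎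

len : List ℤ → ℤ
len xs = + length xs

-- Lowering a tail entry adds `diffs x ys` to the factor `diffs x xs`. These corrections and the
-- term of the lowered head form the left side of `partial-fractions` at the head `x`.
Σvandermonde : ∀ xs → ΣLowering (λ _ _ zs → vandermonde zs) xs ≡ len xs ℤ.* vandermonde xs
Σvandermonde []       = refl
Σvandermonde (x ∷ xs) = begin
  diffs (x ℤ.- 1ℤ) xs ℤ.* v ℤ.+ ΣLowering (λ _ _ zs → diffs x zs ℤ.* vandermonde zs) xs
    ≡⟨ cong (λ s → diffs (x ℤ.- 1ℤ) xs ℤ.* v ℤ.+ s) (ΣLowering-linear (diffs x xs) 1ℤ xs term) ⟩
  diffs (x ℤ.- 1ℤ) xs ℤ.* v ℤ.+ (diffs x xs ℤ.* ΣLowering (λ _ _ zs → vandermonde zs) xs ℤ.+ 1ℤ ℤ.* S)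
    ≡⟨ ring₁ (diffs (x ℤ.- 1ℤ) xs ℤ.* v) _ S ⟩
  (diffs (x ℤ.- 1ℤ) xs ℤ.* v ℤ.+ S) ℤ.+ diffs x xs ℤ.* ΣLowering (λ _ _ zs → vandermonde zs) xs
    ≡⟨ cong₂ (λ p q → p ℤ.+ diffs x xs ℤ.* q) (partial-fractions x xs) (Σvandermonde xs) ⟩
  diffs x xs ℤ.* v ℤ.+ diffs x xs ℤ.* (len xs ℤ.* v)
    ≡⟨ ring₂ (diffs x xs) v (len xs) ⟩
  (1ℤ ℤ.+ len xs) ℤ.* (diffs x xs ℤ.* v) ∎
  where
  v = vandermonde xs
  S = ΣLowering (λ _ ys zs → diffs x ys ℤ.* vandermonde zs) xs
  ring₀ : ∀ a b v → (a ℤ.+ b) ℤ.* v ≡ a ℤ.* v ℤ.+ 1ℤ ℤ.* (b ℤ.* v)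
  ring₀ = solve-∀
  term : ∀ {y ys zs} → Lowering xs y ys zs →
    diffs x zs ℤ.* vandermonde zs ≡ diffs x xs ℤ.* vandermonde zs ℤ.+ 1ℤ ℤ.* (diffs x ys ℤ.* vandermonde zs)
  term {ys = ys} {zs} l = trans (cong (ℤ._* vandermonde zs) (diffs-lower x l)) (ring₀ (diffs x xs) (diffs x ys) (vandermonde zs))
  ring₁ : ∀ a b c → a ℤ.+ (b ℤ.+ 1ℤ ℤ.* c) ≡ (a ℤ.+ c) ℤ.+ b
  ring₁ = solve-∀
  ring₂ : ∀ a b c → a ℤ.* b ℤ.+ a ℤ.* (c ℤ.* b) ≡ (1ℤ ℤ.+ c) ℤ.* (a ℤ.* b)
  ring₂ = solve-∀

-- Taking off the number of later entries undoes the shift built into `beta`: for the beta numbers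
-- of a partition this is its size, by `excess-beta`.
excess : List ℤ → ℤ
excess []       = 0ℤ
excess (x ∷ xs) = x ℤ.- len xs ℤ.+ excess xs

-- This will be the branching rule for n! ∏(bᵢ - bⱼ) / ∏ bᵢ! with denominators cleared: lowering the
-- beta number `y` divides the product of factorials by `y`, whence the weight.
Σweighted-vandermonde : ∀ xs → ΣLowering (λ y _ zs → y ℤ.* vandermonde zs) xs ≡ excess xs ℤ.* vandermonde xs
Σweighted-vandermonde []       = refl
Σweighted-vandermonde (x ∷ xs) = begin
  x ℤ.* (bx1 ℤ.* v) ℤ.+ ΣLowering (λ y _ zs → y ℤ.* (diffs x zs ℤ.* vandermonde zs)) xs
    ≡⟨ cong (λ s → x ℤ.* (bx1 ℤ.* v) ℤ.+ s) (ΣLowering-linear {h = λ _ ys zs → x ℤ.* (diffs x ys ℤ.* vandermonde zs) ℤ.+ ℤ.- b ℤ.* vandermonde zs} b 1ℤ xs term) ⟩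
  x ℤ.* (bx1 ℤ.* v) ℤ.+ (b ℤ.* G ℤ.+ 1ℤ ℤ.* ΣLowering (λ _ ys zs → x ℤ.* (diffs x ys ℤ.* vandermonde zs) ℤ.+ ℤ.- b ℤ.* vandermonde zs) xs)
    ≡⟨ cong (λ s → x ℤ.* (bx1 ℤ.* v) ℤ.+ (b ℤ.* G ℤ.+ 1ℤ ℤ.* s)) (ΣLowering-linear x (ℤ.- b) xs (λ _ → refl)) ⟩
  x ℤ.* (bx1 ℤ.* v) ℤ.+ (b ℤ.* G ℤ.+ 1ℤ ℤ.* (x ℤ.* S ℤ.+ ℤ.- b ℤ.* L))
    ≡⟨ ring₁ x bx1 v b G S L ⟩
  x ℤ.* (bx1 ℤ.* v ℤ.+ S) ℤ.+ b ℤ.* G ℤ.- b ℤ.* L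
    ≡⟨ cong₂ (λ p q → x ℤ.* p ℤ.+ b ℤ.* q ℤ.- b ℤ.* L) (partial-fractions x xs) (Σweighted-vandermonde xs) ⟩
  x ℤ.* (b ℤ.* v) ℤ.+ b ℤ.* (excess xs ℤ.* v) ℤ.- b ℤ.* L
    ≡⟨ cong (λ s → x ℤ.* (b ℤ.* v) ℤ.+ b ℤ.* (excess xs ℤ.* v) ℤ.- b ℤ.* s) (Σvandermonde xs) ⟩
  x ℤ.* (b ℤ.* v) ℤ.+ b ℤ.* (excess xs ℤ.* v) ℤ.- b ℤ.* (len xs ℤ.* v)
    ≡⟨ ring₂ x b v (excess xs) (len xs) ⟩
  (x ℤ.- len xs ℤ.+ excess xs) ℤ.* (b ℤ.* v) ∎
  where
  b = diffs x xs
  bx1 = diffs (x ℤ.- 1ℤ) xs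
  v = vandermonde xs
  G = ΣLowering (λ y _ zs → y ℤ.* vandermonde zs) xs
  S = ΣLowering (λ _ ys zs → diffs x ys ℤ.* vandermonde zs) xs
  L = ΣLowering (λ _ _ zs → vandermonde zs) xs
  ring₀ : ∀ x y p v →
    y ℤ.* (((x ℤ.- y) ℤ.* p ℤ.+ p) ℤ.* v)
      ≡ (x ℤ.- y) ℤ.* p ℤ.* (y ℤ.* v) ℤ.+ 1ℤ ℤ.* (x ℤ.* (p ℤ.* v) ℤ.+ ℤ.- ((x ℤ.- y) ℤ.* p) ℤ.* v)
  ring₀ = solve-∀
  -- Writing y = x - (x - y) in the correction `y * diffs x ys` leaves, besides the induction
  -- hypothesis, only the sums of `partial-fractions` and `Σvandermonde`.
  term : ∀ {y ys zs} → Lowering xs y ys zs →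
    y ℤ.* (diffs x zs ℤ.* vandermonde zs)
      ≡ b ℤ.* (y ℤ.* vandermonde zs) ℤ.+ 1ℤ ℤ.* (x ℤ.* (diffs x ys ℤ.* vandermonde zs) ℤ.+ ℤ.- b ℤ.* vandermonde zs)
  term {y} {ys} {zs} l rewrite diffs-lower x l | diffs-omit x l = ring₀ x y (diffs x ys) (vandermonde zs)
  ring₁ : ∀ x c v b G S L →
    x ℤ.* (c ℤ.* v) ℤ.+ (b ℤ.* G ℤ.+ 1ℤ ℤ.* (x ℤ.* S ℤ.+ ℤ.- b ℤ.* L)) ≡ x ℤ.* (c ℤ.* v ℤ.+ S) ℤ.+ b ℤ.* G ℤ.- b ℤ.* L
  ring₁ = solve-∀
  ring₂ : ∀ x b v e l → x ℤ.* (b ℤ.* v) ℤ.+ b ℤ.* (e ℤ.* v) ℤ.- b ℤ.* (l ℤ.* v) ≡ (x ℤ.- l ℤ.+ e) ℤ.* (b ℤ.* v)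
  ring₂ = solve-∀

-- The branching rule for standard Young tableaux

private variable A B : Set

countB≡length-filter : (p : A → Bool) (xs : List A) → countB p xs ≡ length (filter (T? ∘ p) xs)
countB≡length-filter p []       = refl
countB≡length-filter p (x ∷ xs) with p x
... | true  = cong suc (countB≡length-filter p xs)
... | false = countB≡length-filter p xs

map-unique : {f : A → B} {xs : List A} → (∀ {x y} → x ∈ xs → y ∈ xs → f x ≡ f y → x ≡ y) →
             Unique xs → Unique (map f xs)
map-unique inj []       = []
map-unique inj (x∉ ∷ u) =
  All.map⁺ (All.tabulate (λ y∈ eq → All.lookup x∉ y∈ (inj (here refl) (there y∈) eq)))
  ∷ map-unique (λ x∈ y∈ → inj (there x∈) (there y∈)) u

length-bijection : {xs : List A} {ys : List B} (f : A → B) → Unique xs → Unique ys →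
  (∀ {x} → x ∈ xs → f x ∈ ys) →
  (∀ {x y} → x ∈ xs → y ∈ xs → f x ≡ f y → x ≡ y) →
  (∀ {y} → y ∈ ys → ∃ λ x → x ∈ xs × y ≡ f x) →
  length xs ≡ length ys
length-bijection {xs = xs} {ys} f ux uy into inj onto = trans (sym (length-map f xs))
  (↭-length (∼bag⇒↭ (unique∧set⇒bag (map-unique inj ux) uy (mk⇔ ⇒ ⇐))))
  where
  ⇒ : ∀ {z} → z ∈ map f xs → z ∈ ys
  ⇒ z∈ with ∈-map⁻ f z∈
  ... | _ , x∈ , refl = into x∈
  ⇐ : ∀ {z} → z ∈ ys → z ∈ map f xs
  ⇐ z∈ with onto z∈
  ... | _ , x∈ , refl = ∈-map⁺ f x∈

-- The blocks are disjoint because `key` recovers from an element the block that it lies in.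
concatMap-unique : {f : A → List B} {xs : List A} (key : B → A → Set) →
  (∀ {x y z} → key z x → key z y → x ≡ y) →
  Unique xs → (∀ {x} → x ∈ xs → Unique (f x)) → (∀ {x z} → x ∈ xs → z ∈ f x → key z x) →
  Unique (concatMap f xs)
concatMap-unique key fun []       uf k = []
concatMap-unique {f = f} {x ∷ xs} key fun (x∉ ∷ u) uf k =
  Unique.++⁺ (uf (here refl)) (concatMap-unique key fun u (uf ∘ there) (k ∘ there)) disjoint
  where
  disjoint : ∀ {z} → ¬ (z ∈ f x × z ∈ concatMap f xs)
  disjoint (z∈x , z∈xs) with find (∈-concatMap⁻ f {xs = xs} z∈xs)
  ... | y , y∈ , z∈y = All.lookup x∉ y∈ (fun (k (here refl) z∈x) (k (there y∈) z∈y))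

concatMap-map≡cartesianProductWith : {C : Set} (f : A → B → C) (xs : List A) (ys : List B) →
  concatMap (λ x → map (f x) ys) xs ≡ cartesianProductWith f xs ys
concatMap-map≡cartesianProductWith f []       ys = refl
concatMap-map≡cartesianProductWith f (x ∷ xs) ys = cong (map (f x) ys ++_) (concatMap-map≡cartesianProductWith f xs ys)

oneTo-unique : ∀ n → Unique (oneTo n)
oneTo-unique n = Unique.map⁺ suc-injective (Unique.upTo⁺ n)

InRange : ℕ → ℕ → Set
InRange n x = 1 ≤ x × x ≤ n

∈-oneTo⁺ : ∀ {n x} → InRange n x → x ∈ oneTo n
∈-oneTo⁺ {x = suc x} (_ , x≤n) = ∈-map⁺ suc (∈-upTo⁺ x≤n)

∈-oneTo⁻ : ∀ {n x} → x ∈ oneTo n → InRange n x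
∈-oneTo⁻ x∈ with ∈-map⁻ suc x∈
... | _ , y∈ , refl = s≤s z≤n , ∈-upTo⁻ y∈

listsOfLength-suc : ∀ k xs → listsOfLength (suc k) xs ≡ cartesianProductWith _∷_ xs (listsOfLength k xs)
listsOfLength-suc k xs = concatMap-map≡cartesianProductWith _∷_ xs (listsOfLength k xs)

listsOfLength-unique : ∀ k {xs} → Unique xs → Unique (listsOfLength k xs)
listsOfLength-unique zero    u = [] ∷ []
listsOfLength-unique (suc k) {xs} u
  rewrite listsOfLength-suc k xs =
  Unique.cartesianProductWith⁺ _∷_ ∷-injective u (listsOfLength-unique k u)

∈-listsOfLength⁺ : ∀ {ys xs} → All (_∈ xs) ys → ys ∈ listsOfLength (length ys) xs
∈-listsOfLength⁺ []         = here refl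
∈-listsOfLength⁺ {y ∷ ys} {xs} (y∈ ∷ ys∈)
  rewrite listsOfLength-suc (length ys) xs =
  ∈-cartesianProductWith⁺ _∷_ y∈ (∈-listsOfLength⁺ ys∈)

∈-listsOfLength⁻ : ∀ k {ys xs} → ys ∈ listsOfLength k xs → length ys ≡ k × All (_∈ xs) ys
∈-listsOfLength⁻ zero    (here refl) = refl , []
∈-listsOfLength⁻ (suc k) {xs = xs} ys∈
  rewrite listsOfLength-suc k xs
  with ∈-cartesianProductWith⁻ _∷_ xs _ ys∈
... | y , ys , y∈ , ys∈′ , refl with ∈-listsOfLength⁻ k ys∈′
...   | eq , all∈ = cong suc eq , y∈ ∷ all∈

Tableau : Set
Tableau = List (List ℕ)

fillings-∷ : ∀ n l ls → fillings n (l ∷ ls) ≡ cartesianProductWith _∷_ (listsOfLength l (oneTo n)) (fillings n ls)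
fillings-∷ n l ls = concatMap-map≡cartesianProductWith _∷_ (listsOfLength l (oneTo n)) (fillings n ls)

fillings-unique : ∀ n ls → Unique (fillings n ls)
fillings-unique n []       = [] ∷ []
fillings-unique n (l ∷ ls)
  rewrite fillings-∷ n l ls =
  Unique.cartesianProductWith⁺ _∷_ ∷-injective (listsOfLength-unique l (oneTo-unique n)) (fillings-unique n ls)

∈-fillings⁺ : ∀ {n t} → All (All (InRange n)) t → t ∈ fillings n (map length t)
∈-fillings⁺ []                = here refl
∈-fillings⁺ {n} {r ∷ t} (r∈ ∷ t∈)
  rewrite fillings-∷ n (length r) (map length t) =
  ∈-cartesianProductWith⁺ _∷_ (∈-listsOfLength⁺ (All.map ∈-oneTo⁺ r∈)) (∈-fillings⁺ t∈)

∈-fillings⁻ : ∀ {n} ls {t} → t ∈ fillings n ls → map length t ≡ ls × All (All (InRange n)) t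
∈-fillings⁻ []       (here refl) = refl , []
∈-fillings⁻ {n} (l ∷ ls) t∈
  rewrite fillings-∷ n l ls
  with ∈-cartesianProductWith⁻ _∷_ (listsOfLength l (oneTo n)) _ t∈
... | r , t , r∈ , t∈′ , refl with ∈-listsOfLength⁻ l r∈ | ∈-fillings⁻ ls t∈′
...   | refl , all∈ | refl , t-ok = refl , All.map ∈-oneTo⁻ all∈ ∷ t-ok

-- Either row may end first, because `zipWith` truncates to the shorter one; that the lower row is
-- not longer is a matter of the shape.
data _<ᶜ_ : List ℕ → List ℕ → Set where
  []ˡ : ∀ {s} → [] <ᶜ s
  []ʳ : ∀ {r} → r <ᶜ []
  _∷_ : ∀ {a b r s} → a < b → r <ᶜ s → (a ∷ r) <ᶜ (b ∷ s)

record Standard (n : ℕ) (t : Tableau) : Set where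
  field
    entries : All (All (InRange n)) t
    rows    : All (AllPairs _<_) t
    columns : Linked _<ᶜ_ t
    once    : ∀ k → InRange n k → countB (_≡ᵇ k) (concat t) ≡ 1
open Standard

T-all⁻ : {p : A → Bool} (xs : List A) → T (all p xs) → All (T ∘ p) xs
T-all⁻ []       _ = []
T-all⁻ (x ∷ xs) t = let a , b = to T-∧ t in a ∷ T-all⁻ xs b

T-all⁺ : {p : A → Bool} {xs : List A} → All (T ∘ p) xs → T (all p xs)
T-all⁺ []       = _
T-all⁺ (a ∷ as) = from T-∧ (a , T-all⁺ as)

strictlyIncr⁻ : ∀ r → T (strictlyIncr r) → Linked _<_ r
strictlyIncr⁻ []          _ = []
strictlyIncr⁻ (x ∷ [])    _ = [-]
strictlyIncr⁻ (x ∷ y ∷ r) t = let a , b = to T-∧ t in <ᵇ⇒< x y a ∷ strictlyIncr⁻ (y ∷ r) b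

strictlyIncr⁺ : ∀ {r} → Linked _<_ r → T (strictlyIncr r)
strictlyIncr⁺ []      = _
strictlyIncr⁺ [-]     = _
strictlyIncr⁺ (a ∷ l) = from T-∧ (<⇒<ᵇ a , strictlyIncr⁺ l)

<ᶜ⁻ : ∀ r s → T (all id (zipWith _<ᵇ_ r s)) → r <ᶜ s
<ᶜ⁻ []      s       _ = []ˡ
<ᶜ⁻ (a ∷ r) []      _ = []ʳ
<ᶜ⁻ (a ∷ r) (b ∷ s) t = let p , q = to T-∧ t in <ᵇ⇒< a b p ∷ <ᶜ⁻ r s q

<ᶜ⁺ : ∀ {r s} → r <ᶜ s → T (all id (zipWith _<ᵇ_ r s))
<ᶜ⁺ []ˡ         = _
<ᶜ⁺ {[]} []ʳ    = _
<ᶜ⁺ {_ ∷ _} []ʳ = _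
<ᶜ⁺ (a ∷ l)     = from T-∧ (<⇒<ᵇ a , <ᶜ⁺ l)

colsIncr⁻ : ∀ t → T (colsIncr t) → Linked _<ᶜ_ t
colsIncr⁻ []          _ = []
colsIncr⁻ (r ∷ [])    _ = [-]
colsIncr⁻ (r ∷ s ∷ t) p = let a , b = to T-∧ p in <ᶜ⁻ r s a ∷ colsIncr⁻ (s ∷ t) b

colsIncr⁺ : ∀ {t} → Linked _<ᶜ_ t → T (colsIncr t)
colsIncr⁺ []      = _
colsIncr⁺ [-]     = _
colsIncr⁺ (a ∷ l) = from T-∧ (<ᶜ⁺ a , colsIncr⁺ l)

isSYT⁻ : ∀ {n t} → All (All (InRange n)) t → T (isSYT n t) → Standard n t
isSYT⁻ {n} {t} e p = let a , bc = to T-∧ p ; b , c = to T-∧ bc in record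
  { entries = e
  ; rows    = All.map (λ {r} → Linked⇒AllPairs <-trans ∘ strictlyIncr⁻ r) (T-all⁻ t a)
  ; columns = colsIncr⁻ t b
  ; once    = λ k k∈ → ≡ᵇ⇒≡ _ _ (All.lookup (T-all⁻ (oneTo n) c) (∈-oneTo⁺ k∈))
  }

isSYT⁺ : ∀ {n t} → Standard n t → T (isSYT n t)
isSYT⁺ s = from T-∧ (T-all⁺ (All.map (strictlyIncr⁺ ∘ AllPairs⇒Linked) (rows s)) ,
           from T-∧ (colsIncr⁺ (columns s) ,
           T-all⁺ (All.tabulate (λ k∈ → ≡⇒≡ᵇ _ _ (once s _ (∈-oneTo⁻ k∈))))))

SYT : ℕ → List ℕ → List Tableau
SYT n ls = filter (T? ∘ isSYT n) (fillings n ls)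

SYT-unique : ∀ n ls → Unique (SYT n ls)
SYT-unique n ls = Unique.filter⁺ (T? ∘ isSYT n) (fillings-unique n ls)

∈-SYT⁺ : ∀ {n t} → Standard n t → t ∈ SYT n (map length t)
∈-SYT⁺ {n} s = ∈-filter⁺ (T? ∘ isSYT n) (∈-fillings⁺ (entries s)) (isSYT⁺ s)

∈-SYT⁻ : ∀ {n ls t} → t ∈ SYT n ls → map length t ≡ ls × Standard n t
∈-SYT⁻ {n} {ls} t∈ with ∈-filter⁻ (T? ∘ isSYT n) {xs = fillings n ls} t∈
... | t∈f , p with ∈-fillings⁻ ls t∈f
...   | eq , e = eq , isSYT⁻ e p

first : List ℕ → ℕ
first []      = 0
first (l ∷ _) = l

-- Row lengths may be zero, so that removing a box never shortens the list; row i loses its last box.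
data RemoveBox : ℕ → List ℕ → List ℕ → Set where
  here  : ∀ {l ls} → first ls ≤ l → RemoveBox 0 (suc l ∷ ls) (l ∷ ls)
  there : ∀ {i l ls ms} → RemoveBox i ls ms → RemoveBox (suc i) (l ∷ ls) (l ∷ ms)

shift : ℕ → ℕ × List ℕ → ℕ × List ℕ
shift l (i , ms) = suc i , l ∷ ms

removeFirst : ℕ → List ℕ → List (ℕ × List ℕ)
removeFirst zero    ls = []
removeFirst (suc l) ls = if first ls ≤ᵇ l then (0 , l ∷ ls) ∷ [] else []

removals : List ℕ → List (ℕ × List ℕ)
removals []       = []
removals (l ∷ ls) = removeFirst l ls ++ map (shift l) (removals ls)

∈-removals⁺ : ∀ {i ls ms} → RemoveBox i ls ms → (i , ms) ∈ removals ls
∈-removals⁺ (here {l} {ls} f≤l) with first ls ≤ᵇ l | ≤⇒≤ᵇ f≤l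
... | true | _ = here refl
∈-removals⁺ {ls = l ∷ ls} (there r) = ∈-++⁺ʳ (removeFirst l ls) (∈-map⁺ (shift l) (∈-removals⁺ r))

∈-removeFirst⁻ : ∀ {p} l ls → p ∈ removeFirst l ls → RemoveBox (proj₁ p) (l ∷ ls) (proj₂ p)
∈-removeFirst⁻ (suc l) ls p∈ with first ls ≤ᵇ l in eq
∈-removeFirst⁻ (suc l) ls (here refl) | true = here (≤ᵇ⇒≤ _ _ (from T-≡ eq))

∈-removals⁻ : ∀ {p} ls → p ∈ removals ls → RemoveBox (proj₁ p) ls (proj₂ p)
∈-removals⁻ (l ∷ ls) p∈ with ∈-++⁻ (removeFirst l ls) p∈
... | inj₁ q = ∈-removeFirst⁻ l ls q
... | inj₂ q with ∈-map⁻ (shift l) q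
...   | _ , q∈ , refl = there (∈-removals⁻ ls q∈)

RemoveBox-functional : ∀ {i ls ms ms′} → RemoveBox i ls ms → RemoveBox i ls ms′ → ms ≡ ms′
RemoveBox-functional (here _)  (here _)   = refl
RemoveBox-functional (there r) (there r′) = cong (_ ∷_) (RemoveBox-functional r r′)

removeFirst-unique : ∀ l ls → Unique (removeFirst l ls)
removeFirst-unique zero    ls = []
removeFirst-unique (suc l) ls with first ls ≤ᵇ l
... | true  = [] ∷ []
... | false = []

removeFirst-index : ∀ {p} l ls → p ∈ removeFirst l ls → proj₁ p ≡ 0
removeFirst-index (suc l) ls p∈ with first ls ≤ᵇ l
removeFirst-index (suc l) ls (here refl) | true = refl

removals-unique : ∀ ls → Unique (removals ls)
removals-unique []       = []
removals-unique (l ∷ ls) =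
  Unique.++⁺ (removeFirst-unique l ls) (Unique.map⁺ (λ { refl → refl }) (removals-unique ls)) disjoint
  where
  disjoint : ∀ {z} → ¬ (z ∈ removeFirst l ls × z ∈ map (shift l) (removals ls))
  disjoint (p , q) with ∈-map⁻ (shift l) q
  ... | _ , _ , refl with () ← removeFirst-index l ls p

RemoveBox-sum : ∀ {i ls ms} → RemoveBox i ls ms → sum ls ≡ suc (sum ms)
RemoveBox-sum (here _)              = refl
RemoveBox-sum (there {l = l} r) = trans (cong (λ k → l + k) (RemoveBox-sum r)) (+-suc l _)

RemoveBox-length : ∀ {i ls ms} → RemoveBox i ls ms → length ls ≡ length ms
RemoveBox-length (here _)  = refl
RemoveBox-length (there r) = cong suc (RemoveBox-length r)

addEntry : ℕ → ℕ → Tableau → Tableau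
addEntry x i       []      = []
addEntry x zero    (r ∷ t) = (r ∷ʳ x) ∷ t
addEntry x (suc i) (r ∷ t) = r ∷ addEntry x i t

module _ {n : ℕ} where
  private x = suc n

  weaken : ∀ {k} → InRange n k → InRange x k
  weaken (p , q) = p , m≤n⇒m≤1+n q

  addEntry-shape : ∀ {i ls ms} t → RemoveBox i ls ms → map length t ≡ ms → map length (addEntry x i t) ≡ ls
  addEntry-shape (r ∷ t) (here _)  refl = cong (_∷ _) (trans (length-++ r) (+-comm _ 1))
  addEntry-shape (r ∷ t) (there p) refl = cong (length r ∷_) (addEntry-shape t p refl)

  addEntry-entries : ∀ i {t} → All (All (InRange n)) t → All (All (InRange x)) (addEntry x i t)
  addEntry-entries i       []      = []
  addEntry-entries zero    (e ∷ es) = All.∷ʳ⁺ (All.map weaken e) (s≤s z≤n , ≤-refl) ∷ All.map (All.map weaken) es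
  addEntry-entries (suc i) (e ∷ es) = All.map weaken e ∷ addEntry-entries i es

  addEntry-rows : ∀ i {t} → All (All (InRange n)) t → All (AllPairs _<_) t → All (AllPairs _<_) (addEntry x i t)
  addEntry-rows i       []       []       = []
  addEntry-rows zero    (e ∷ es) (p ∷ ps) = AllPairs.++⁺ p ([] ∷ []) (All.map (λ (_ , q) → s≤s q ∷ []) e) ∷ ps
  addEntry-rows (suc i) (e ∷ es) (p ∷ ps) = p ∷ addEntry-rows i es ps

  -- The length bound places the new entry past the end of the row below, so no new comparison
  -- arises.
  <ᶜ-∷ʳˡ : ∀ {r s} → r <ᶜ s → length s ≤ length r → (r ∷ʳ x) <ᶜ s
  <ᶜ-∷ʳˡ {s = []} []ˡ l       = []ʳ
  <ᶜ-∷ʳˡ []ʳ       l       = []ʳ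
  <ᶜ-∷ʳˡ (a ∷ c)   (s≤s l) = a ∷ <ᶜ-∷ʳˡ c l

  <ᶜ-∷ʳʳ : ∀ {r s} → All (InRange n) r → r <ᶜ s → r <ᶜ (s ∷ʳ x)
  <ᶜ-∷ʳʳ _                   []ˡ     = []ˡ
  <ᶜ-∷ʳʳ []                  []ʳ     = []ˡ
  <ᶜ-∷ʳʳ ((_ , a) ∷ _)       []ʳ     = s≤s a ∷ []ʳ
  <ᶜ-∷ʳʳ (_ ∷ e)             (a ∷ c) = a ∷ <ᶜ-∷ʳʳ e c

  addEntry-columns : ∀ {i ls ms} t → RemoveBox i ls ms → map length t ≡ ms → All (All (InRange n)) t →
    Linked _<ᶜ_ t → Linked _<ᶜ_ (addEntry x i t)
  addEntry-columns (r ∷ [])    (here _)         refl e l       = [-]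
  addEntry-columns (r ∷ s ∷ t) (here f≤)        refl e (c ∷ l) = <ᶜ-∷ʳˡ c f≤ ∷ l
  addEntry-columns (r ∷ s ∷ t) (there (here p)) refl (e ∷ es) (c ∷ l) = <ᶜ-∷ʳʳ e c ∷ addEntry-columns (s ∷ t) (here p) refl es l
  addEntry-columns (r ∷ s ∷ t) (there (there p)) refl (e ∷ es) (c ∷ l) = c ∷ addEntry-columns (s ∷ t) (there p) refl es l

countB-++ : (p : A → Bool) (xs ys : List A) → countB p (xs ++ ys) ≡ countB p xs + countB p ys
countB-++ p []       ys = refl
countB-++ p (x ∷ xs) ys with p x
... | true  = cong suc (countB-++ p xs ys)
... | false = countB-++ p xs ys

countB-absent : ∀ {k xs} → All (_≢ k) xs → countB (_≡ᵇ k) xs ≡ 0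
countB-absent []                    = refl
countB-absent {k} {x ∷ xs} (x≢ ∷ a) with x ≡ᵇ k | ≡ᵇ⇒≡ x k
... | true  | eq = ⊥-elim (x≢ (eq _))
... | false | _  = countB-absent a

countB-present : ∀ {k} xs → 1 ≤ countB (_≡ᵇ k) xs → k ∈ xs
countB-present {k} (x ∷ xs) c with x ≡ᵇ k | ≡ᵇ⇒≡ x k
... | true  | eq = here (sym (eq _))
... | false | _  = there (countB-present xs c)

addEntry-count : ∀ {x i ls ms} (p : ℕ → Bool) t → RemoveBox i ls ms → map length t ≡ ms →
  countB p (concat (addEntry x i t)) ≡ countB p (x ∷ []) + countB p (concat t)
addEntry-count {x} p (r ∷ t) (here _) refl
  rewrite countB-++ p (r ∷ʳ x) (concat t) | countB-++ p r (concat t) | countB-++ p r (x ∷ [])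
        | +-comm (countB p r) (countB p (x ∷ [])) = +-assoc (countB p (x ∷ [])) _ _
addEntry-count {x} {suc i} p (r ∷ t) (there b) refl
  rewrite countB-++ p r (concat (addEntry x i t)) | countB-++ p r (concat t) | addEntry-count {x} p t b refl
  = +-exchange (countB p r) (countB p (x ∷ [])) _

countB-singleton : ∀ x → countB (_≡ᵇ x) (x ∷ []) ≡ 1
countB-singleton x with x ≡ᵇ x | ≡⇒≡ᵇ x x refl
... | true | _ = refl

addEntry-standard : ∀ {n i ls ms t} → RemoveBox i ls ms → map length t ≡ ms →
  Standard n t → Standard (suc n) (addEntry (suc n) i t)
addEntry-standard {n} {i} {t = t} b sh s = record
  { entries = addEntry-entries i (entries s)
  ; rows    = addEntry-rows i (entries s) (rows s)
  ; columns = addEntry-columns t b sh (entries s) (columns s)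
  ; once    = once′
  }
  where
  once′ : ∀ k → InRange (suc n) k → countB (_≡ᵇ k) (concat (addEntry (suc n) i t)) ≡ 1
  once′ k k∈ rewrite addEntry-count {suc n} (_≡ᵇ k) t b sh with k ≟ suc n
  ... | yes refl = cong₂ _+_ (countB-singleton (suc n))
          (countB-absent (All.map (λ { (_ , q) refl → 1+n≰n q }) (All.concat⁺ (entries s))))
  ... | no k≢ = cong₂ _+_ (countB-absent {k} {suc n ∷ []} ((k≢ ∘ sym) ∷ []))
          (once s k (proj₁ k∈ , ≤-pred (≤∧≢⇒< (proj₂ k∈) k≢)))

max-last : ∀ {x r} → AllPairs _<_ r → All (_≤ x) r → x ∈ r → ∃ λ r′ → r ≡ r′ ∷ʳ x
max-last {r = y ∷ []}    p        m (here refl) = [] , refl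
max-last {r = y ∷ z ∷ r} ((y<z ∷ _) ∷ _) (_ ∷ z≤ ∷ _) (here refl) = ⊥-elim (<⇒≱ y<z z≤)
max-last {r = y ∷ r}     (_ ∷ p) (_ ∷ m) (there x∈) with max-last p m x∈
... | r′ , refl = y ∷ r′ , refl

-- A maximal entry can have nothing below it, so the next row ends earlier and the box of `x` is a
-- corner.
<ᶜ-length : ∀ {x} r s → (r ∷ʳ x) <ᶜ s → All (_≤ x) s → length s ≤ length r
<ᶜ-length r       []      c       m         = z≤n
<ᶜ-length []      (b ∷ s) (a ∷ c) (b≤ ∷ m) = ⊥-elim (<⇒≱ a b≤)
<ᶜ-length (a ∷ r) (b ∷ s) (_ ∷ c) (_ ∷ m)  = s≤s (<ᶜ-length r s c m)

<ᶜ-initˡ : ∀ {x} r {s} → (r ∷ʳ x) <ᶜ s → r <ᶜ s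
<ᶜ-initˡ []      c       = []ˡ
<ᶜ-initˡ (_ ∷ r) []ʳ     = []ʳ
<ᶜ-initˡ (_ ∷ r) (a ∷ c) = a ∷ <ᶜ-initˡ r c

<ᶜ-initʳ : ∀ {x} s {r} → r <ᶜ (s ∷ʳ x) → r <ᶜ s
<ᶜ-initʳ []      c       = []ʳ
<ᶜ-initʳ (_ ∷ s) []ˡ     = []ˡ
<ᶜ-initʳ (_ ∷ s) (a ∷ c) = a ∷ <ᶜ-initʳ s c

record Extension (x : ℕ) (t : Tableau) : Set where
  field
    index   : ℕ
    base    : Tableau
    extends : t ≡ addEntry x index base
    removal : RemoveBox index (map length t) (map length base)
    rows⁻    : All (AllPairs _<_) base
    columns⁻ : Linked _<ᶜ_ base
    -- The row above the first one stays in order with it: the inductive step for the columns.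
    compatible : ∀ {r} → r <ᶜ concat (take 1 t) → r <ᶜ concat (take 1 base)

extension : ∀ {x} t → All (All (_≤ x)) t → All (AllPairs _<_) t → Linked _<ᶜ_ t → x ∈ concat t → Extension x t
extension (r ∷ t) (m ∷ ms) (p ∷ ps) l x∈ with ∈-++⁻ r x∈
... | inj₁ x∈r with max-last p m x∈r
...   | r′ , refl = record
        { index = 0 ; base = r′ ∷ t ; extends = refl
        ; removal = subst (λ k → RemoveBox 0 (k ∷ map length t) (length r′ ∷ map length t))
                      (sym (trans (length-++ r′) (+-comm _ 1))) (here (first≤ t ms l))
        ; rows⁻ = AllPairs-init r′ p ∷ ps
        ; columns⁻ = columns-init t l
        ; compatible = λ {s} c → subst (s <ᶜ_) (sym (++-identityʳ r′)) (<ᶜ-initʳ r′ (subst (s <ᶜ_) (++-identityʳ (r′ ∷ʳ _)) c))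
        }
  where
  AllPairs-init : ∀ {x} r → AllPairs _<_ (r ∷ʳ x) → AllPairs _<_ r
  AllPairs-init []      _       = []
  AllPairs-init (y ∷ r) (a ∷ p) = proj₁ (All.∷ʳ⁻ a) ∷ AllPairs-init r p
  first≤ : ∀ {x r′} t → All (All (_≤ x)) t → Linked _<ᶜ_ ((r′ ∷ʳ x) ∷ t) → first (map length t) ≤ length r′
  first≤ []      _       _       = z≤n
  first≤ (s ∷ t) (m ∷ _) (c ∷ _) = <ᶜ-length _ s c m
  columns-init : ∀ {x r′} t → Linked _<ᶜ_ ((r′ ∷ʳ x) ∷ t) → Linked _<ᶜ_ (r′ ∷ t)
  columns-init []      l       = [-]
  columns-init (s ∷ t) (c ∷ l) = <ᶜ-initˡ _ c ∷ l
extension (r ∷ t) (m ∷ ms) (p ∷ ps) l x∈ | inj₂ x∈t with extension t ms ps (Linked.tail l) x∈t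
... | e = record
        { index = suc index ; base = r ∷ base ; extends = cong (r ∷_) extends
        ; removal = there removal
        ; rows⁻ = p ∷ rows⁻
        ; columns⁻ = link t base l compatible columns⁻
        ; compatible = id
        }
  where
  open Extension e
  link : ∀ t t′ → Linked _<ᶜ_ (r ∷ t) → (∀ {r} → r <ᶜ concat (take 1 t) → r <ᶜ concat (take 1 t′)) →
         Linked _<ᶜ_ t′ → Linked _<ᶜ_ (r ∷ t′)
  link t       []       l       c l′ = [-]
  link []      (s ∷ t′) l       c l′ = subst (r <ᶜ_) (++-identityʳ s) (c []ʳ) ∷ l′
  link (s ∷ t) (s′ ∷ t′) (a ∷ l) c l′ =
    subst (r <ᶜ_) (++-identityʳ s′) (c (subst (r <ᶜ_) (sym (++-identityʳ s)) a)) ∷ l′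

-- The added box already accounts for the single occurrence of `suc n` in `t`, so `suc n` is absent
-- from `base`, whose entries are therefore at most `n`.
extension-standard : ∀ {n t} → Standard (suc n) t → (e : Extension (suc n) t) → Standard n (Extension.base e)
extension-standard {n} {t} s e = record
  { entries = All.concat⁻ (All.tabulate (λ {k} k∈ → inRange k k∈))
  ; rows    = rows⁻
  ; columns = columns⁻
  ; once    = λ k k∈ → trans (sym (cong (_+ countB (_≡ᵇ k) (concat base))
                (countB-absent {k} {suc n ∷ []} ((λ eq → 1+n≰n (subst (_≤ n) (sym eq) (proj₂ k∈))) ∷ []))))
                (trans (sym (count k)) (once s k (proj₁ k∈ , m≤n⇒m≤1+n (proj₂ k∈))))
  }
  where
  open Extension e
  count : ∀ k → countB (_≡ᵇ k) (concat t) ≡ countB (_≡ᵇ k) (suc n ∷ []) + countB (_≡ᵇ k) (concat base)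
  count k = trans (cong (countB (_≡ᵇ k) ∘ concat) extends) (addEntry-count (_≡ᵇ k) base removal refl)
  absent : countB (_≡ᵇ suc n) (concat base) ≡ 0
  absent = suc-injective (trans (trans (sym (cong (_+ countB (_≡ᵇ suc n) (concat base)) (countB-singleton (suc n))))
             (sym (count (suc n)))) (once s (suc n) (s≤s z≤n , ≤-refl)))
  countB-∈ : ∀ {k xs} → k ∈ xs → countB (_≡ᵇ k) xs ≢ 0
  countB-∈ {k} {x ∷ xs} (here refl) eq with x ≡ᵇ x | ≡⇒≡ᵇ x x refl
  countB-∈ {k} {x ∷ xs} (here refl) () | true | _
  countB-∈ {k} {x ∷ xs} (there k∈)  eq with x ≡ᵇ k
  countB-∈ {k} {x ∷ xs} (there k∈)  () | true
  countB-∈ {k} {x ∷ xs} (there k∈)  eq | false = countB-∈ k∈ eq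
  entry : ∀ {x i k ls} t → RemoveBox i ls (map length t) → k ∈ concat t → k ∈ concat (addEntry x i t)
  entry (r ∷ t) (here _) k∈ with ∈-++⁻ r k∈
  ... | inj₁ q = ∈-++⁺ˡ (∈-++⁺ˡ q)
  ... | inj₂ q = ∈-++⁺ʳ (r ∷ʳ _) q
  entry (r ∷ t) (there b) k∈ with ∈-++⁻ r k∈
  ... | inj₁ q = ∈-++⁺ˡ q
  ... | inj₂ q = ∈-++⁺ʳ r (entry t b q)
  inRange : ∀ k → k ∈ concat base → InRange n k
  inRange k k∈ with All.lookup (All.concat⁺ (entries s)) (subst (λ t → k ∈ concat t) (sym extends) (entry base removal k∈))
  ... | p , q = p , ≤-pred (≤∧≢⇒< q (λ { refl → countB-∈ k∈ absent }))

addEntry-injective : ∀ x i {t u} → addEntry x i t ≡ addEntry x i u → t ≡ u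
addEntry-injective x i       {[]}    {[]}    eq = refl
addEntry-injective x zero    {[]}    {r ∷ u} ()
addEntry-injective x (suc i) {[]}    {r ∷ u} ()
addEntry-injective x zero    {r ∷ t} {[]}    ()
addEntry-injective x (suc i) {r ∷ t} {[]}    ()
addEntry-injective x zero    {r ∷ t} {s ∷ u} eq with ∷-injective eq
... | p , q = cong₂ _∷_ (∷ʳ-injectiveˡ r s p) q
addEntry-injective x (suc i) {r ∷ t} {s ∷ u} eq with ∷-injective eq
... | p , q = cong₂ _∷_ p (addEntry-injective x i q)

addEntry-index : ∀ {x i j ls ms ns} t u → RemoveBox i ls ms → RemoveBox j ls ns → map length t ≡ ms → map length u ≡ ns →
  All (All (_≢ x)) t → All (All (_≢ x)) u → addEntry x i t ≡ addEntry x j u → i ≡ j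
addEntry-index t       u       (here _)  (here _)  _ _ _ _ _ = refl
addEntry-index (r ∷ t) (s ∷ u) (here _)  (there b) _ _ _ (a ∷ _) eq with ∷-injective eq
... | refl , _ = ⊥-elim (All.lookup a (∈-++⁺ʳ r (here refl)) refl)
addEntry-index (r ∷ t) (s ∷ u) (there b) (here _)  _ _ (a ∷ _) _ eq with ∷-injective eq
... | refl , _ = ⊥-elim (All.lookup a (∈-++⁺ʳ s (here refl)) refl)
addEntry-index (r ∷ t) (s ∷ u) (there b) (there c) p q (_ ∷ e) (_ ∷ f) eq =
  cong suc (addEntry-index t u b c (∷-injectiveʳ p) (∷-injectiveʳ q) e f (∷-injectiveʳ eq))

length-concatMap-map : {C : Set} (f : A → List B) (g : A → B → C) (xs : List A) →
  length (concatMap (λ x → map (g x) (f x)) xs) ≡ sum (map (length ∘ f) xs)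
length-concatMap-map f g []       = refl
length-concatMap-map f g (x ∷ xs) = trans (length-++ (map (g x) (f x)))
  (cong₂ _+_ (length-map (g x) (f x)) (length-concatMap-map f g xs))

-- The box of `suc n` is a corner, and deleting it is a bijection from the tableaux of shape `ls`
-- onto the disjoint union, over the removable corners, of the tableaux of the smaller shapes.
SYT-branching : ∀ n ls → length (SYT (suc n) ls) ≡ sum (map (λ p → length (SYT n (proj₂ p))) (removals ls))
SYT-branching n ls = trans (length-bijection id (SYT-unique (suc n) ls) blocks-unique into (λ _ _ → id) (λ t∈ → _ , onto t∈ , refl))
  (length-concatMap-map (λ p → SYT n (proj₂ p)) extend (removals ls))
  where
  extend : ℕ × List ℕ → Tableau → Tableau
  extend (i , _) = addEntry (suc n) i
  block : ℕ × List ℕ → List Tableau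
  block p = map (extend p) (SYT n (proj₂ p))
  blocks : List Tableau
  blocks = concatMap block (removals ls)
  into : ∀ {t} → t ∈ SYT (suc n) ls → t ∈ blocks
  into {t} t∈ with ∈-SYT⁻ {ls = ls} t∈
  ... | refl , s with extension t (All.map (All.map proj₂) (entries s)) (rows s) (columns s)
                       (countB-present (concat t) (≤-reflexive (sym (once s (suc n) (s≤s z≤n , ≤-refl)))))
  ...   | e = ∈-concatMap⁺ block (lose (∈-removals⁺ removal)
                (subst (_∈ block (index , map length base)) (sym extends) (∈-map⁺ (addEntry (suc n) index) (∈-SYT⁺ (extension-standard s e)))))
    where open Extension e
  onto : ∀ {t} → t ∈ blocks → t ∈ SYT (suc n) ls
  onto t∈ with find (∈-concatMap⁻ block {xs = removals ls} t∈)
  ... | (i , ms) , p∈ , t∈′ with ∈-map⁻ (addEntry (suc n) i) t∈′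
  ...   | u , u∈ , refl with ∈-SYT⁻ {ls = ms} u∈ | ∈-removals⁻ ls p∈
  ...     | sh , s | b = subst (λ ls → addEntry (suc n) i u ∈ SYT (suc n) ls) (addEntry-shape {n} u b sh) (∈-SYT⁺ (addEntry-standard b sh s))
  -- The row that holds `suc n` determines the removal, which keeps the blocks disjoint.
  Key : Tableau → ℕ × List ℕ → Set
  Key t (i , ms) = RemoveBox i ls ms × ∃ λ u → map length u ≡ ms × All (All (_≢ suc n)) u × t ≡ addEntry (suc n) i u
  key-functional : ∀ {p q t} → Key t p → Key t q → p ≡ q
  key-functional (b , u , sh , a , eq) (b′ , u′ , sh′ , a′ , eq′)
    with addEntry-index u u′ b b′ sh sh′ a a′ (trans (sym eq) eq′)
  ... | refl = cong (_ ,_) (RemoveBox-functional b b′)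
  blocks-unique : Unique blocks
  blocks-unique = concatMap-unique Key key-functional (removals-unique ls)
    (λ {p} _ → Unique.map⁺ (addEntry-injective (suc n) (proj₁ p)) (SYT-unique n (proj₂ p)))
    λ {p} p∈ t∈ → key p p∈ t∈
    where
    key : ∀ p {t} → p ∈ removals ls → t ∈ block p → Key t p
    key (i , ms) p∈ t∈ with ∈-map⁻ (addEntry (suc n) i) t∈
    ... | u , u∈ , eq with ∈-SYT⁻ {ls = ms} u∈
    ...   | sh , s = ∈-removals⁻ ls p∈ , u , sh , All.map (All.map (λ { (_ , q) refl → 1+n≰n q })) (entries s) , eq

dim≡length-SYT : ∀ ls → dim ls ≡ length (SYT (sum ls) ls)
dim≡length-SYT ls = countB≡length-filter (isSYT (sum ls)) (fillings (sum ls) ls)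

sum-map-cong-∈ : {f g : A → ℕ} (xs : List A) → (∀ {x} → x ∈ xs → f x ≡ g x) → sum (map f xs) ≡ sum (map g xs)
sum-map-cong-∈ []       eq = refl
sum-map-cong-∈ (x ∷ xs) eq = cong₂ _+_ (eq (here refl)) (sum-map-cong-∈ xs (eq ∘ there))

dim-branching : ∀ {n} ls → sum ls ≡ suc n → dim ls ≡ sum (map (dim ∘ proj₂) (removals ls))
dim-branching {n} ls eq = trans (dim≡length-SYT ls) (trans (cong (λ k → length (SYT k ls)) eq)
  (trans (SYT-branching n ls) (sum-map-cong-∈ (removals ls) block)))
  where
  block : ∀ {p} → p ∈ removals ls → length (SYT n (proj₂ p)) ≡ dim (proj₂ p)
  block {i , ms} p∈ = trans
    (cong (λ k → length (SYT k ms)) (suc-injective (trans (sym eq) (RemoveBox-sum (∈-removals⁻ ls p∈)))))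
    (sym (dim≡length-SYT ms))

sum-zeros : ∀ k → sum (replicate k 0) ≡ 0
sum-zeros zero    = refl
sum-zeros (suc k) = sum-zeros k
fillings-zeros : ∀ k → fillings 0 (replicate k 0) ≡ replicate k [] ∷ []
fillings-zeros zero    = refl
fillings-zeros (suc k) rewrite fillings-zeros k = refl
rows-zeros : ∀ k → all strictlyIncr (replicate k []) ≡ true
rows-zeros zero    = refl
rows-zeros (suc k) = rows-zeros k
columns-zeros : ∀ k → colsIncr (replicate k []) ≡ true
columns-zeros zero          = refl
columns-zeros (suc zero)    = refl
columns-zeros (suc (suc k)) = columns-zeros (suc k)
isSYT-zeros : ∀ k → isSYT 0 (replicate k []) ≡ true
isSYT-zeros k rewrite rows-zeros k | columns-zeros k = refl

dim-zeros : ∀ k → dim (replicate k 0) ≡ 1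
dim-zeros k rewrite sum-zeros k | fillings-zeros k | isSYT-zeros k = refl

-- The hook length formula

data Desc : List ℕ → Set where
  []  : Desc []
  _∷_ : ∀ {l ls} → first ls ≤ l → Desc ls → Desc (l ∷ ls)

RemoveBox-first : ∀ {i ls ms} → RemoveBox i ls ms → first ms ≤ first ls
RemoveBox-first (here _)  = n≤1+n _
RemoveBox-first (there _) = ≤-refl

RemoveBox-Desc : ∀ {i ls ms} → RemoveBox i ls ms → Desc ls → Desc ms
RemoveBox-Desc (here f≤) (_ ∷ d) = f≤ ∷ d
RemoveBox-Desc (there r) (f≤ ∷ d) = ≤-trans (RemoveBox-first r) f≤ ∷ RemoveBox-Desc r d

-- The strictly decreasing sequence λᵢ + k - i attached to the partition λ₁ ≥ … ≥ λₖ.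
beta : List ℕ → List ℕ
beta []       = []
beta (l ∷ ls) = l + length ls ∷ beta ls

betaℤ : List ℕ → List ℤ
betaℤ ls = map +_ (beta ls)

factorials : List ℕ → ℕ
factorials ls = product (map _! ls)

data Decrement : List ℕ → ℕ → List ℕ → Set where
  here  : ∀ {x xs} → Decrement (suc x ∷ xs) (suc x) (x ∷ xs)
  there : ∀ {x xs y ys} → Decrement xs y ys → Decrement (x ∷ xs) y (x ∷ ys)

factorials-Decrement : ∀ {xs y ys} → Decrement xs y ys → factorials xs ≡ y * factorials ys
factorials-Decrement (here {x} {xs}) = *-assoc (suc x) (x !) (factorials xs)
factorials-Decrement (there {x} {y = y} {ys} d) = trans (cong (x ! *_) (factorials-Decrement d)) (*-exchange (x !) y (factorials ys))

removeFirst-cases : ∀ l ls → first ls ≤ l →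
  (removeFirst l ls ≡ [] × first ls ≡ l) ⊎
  (∃ λ k → l ≡ suc k × removeFirst l ls ≡ (0 , k ∷ ls) ∷ [] × first ls ≤ k)
removeFirst-cases zero    ls f≤ = inj₁ (refl , n≤0⇒n≡0 f≤)
removeFirst-cases (suc l) ls f≤ with first ls ≤ᵇ l in eq
... | true  = inj₂ (l , refl , refl , ≤ᵇ⇒≤ _ _ (subst T (sym eq) _))
... | false = inj₁ (refl , ≤-antisym f≤ (≰⇒> (λ f≤l → subst T eq (≤⇒≤ᵇ f≤l))))

-- The lowerings of beta numbers that come from no box: the lowered entry was 0, or it now collides
-- with the next one and the Vandermonde product vanishes.
Degenerate : ℤ → List ℤ → Set
Degenerate y zs = y ≡ 0ℤ ⊎ vandermonde zs ≡ 0ℤ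

degenerate-first : ∀ ls → Degenerate (+ (first ls + length ls)) (+ (first ls + length ls) ℤ.- 1ℤ ∷ betaℤ ls)
degenerate-first []       = inj₁ refl
degenerate-first (l ∷ ls) = inj₂ (trans (cong (λ a → a ℤ.* ds ℤ.* v) eq) (trans (cong (ℤ._* v) (ℤ.*-zeroˡ ds)) (ℤ.*-zeroˡ v)))
  where
  d = + (l + suc (length ls)) ℤ.- 1ℤ
  ds = diffs d (betaℤ ls)
  v = vandermonde (betaℤ (l ∷ ls))
  eq : d ℤ.- + (l + length ls) ≡ 0ℤ
  eq rewrite +-suc l (length ls) = ℤ.+-inverseʳ (+ (l + length ls))

-- Removing a box from a row lowers its beta number by one, and every lowering that arises from no
-- box is degenerate, so `bad` makes its term zero. `g` and `h` are arbitrary so that the recursion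
-- can absorb the rows already passed.
Σremovals : ∀ {ls} (g : List ℕ → ℕ) (c : ℤ) (h : ℤ → List ℤ → ℤ) → Desc ls →
  (∀ {i ms y} → RemoveBox i ls ms → Decrement (beta ls) y (beta ms) → + g ms ℤ.* c ≡ h (+ y) (betaℤ ms)) →
  (∀ y zs → Degenerate y zs → h y zs ≡ 0ℤ) →
  + sum (map (g ∘ proj₂) (removals ls)) ℤ.* c ≡ ΣLowering (λ y _ zs → h y zs) (betaℤ ls)
Σremovals g c h [] _ _ = ℤ.*-zeroˡ c
Σremovals {l ∷ ls} g c h (f≤ ∷ d) good bad = begin
  + sum (map (g ∘ proj₂) (removeFirst l ls ++ map (shift l) (removals ls))) ℤ.* c
    ≡⟨ cong (λ s → + s ℤ.* c) (trans (cong sum (map-++ (g ∘ proj₂) (removeFirst l ls) _)) (sum-++ (map (g ∘ proj₂) (removeFirst l ls)) _)) ⟩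
  (+ s₁ ℤ.+ + sum (map (g ∘ proj₂) (map (shift l) (removals ls)))) ℤ.* c
    ≡⟨ ℤ.*-distribʳ-+ c (+ s₁) (+ sum (map (g ∘ proj₂) (map (shift l) (removals ls)))) ⟩
  + s₁ ℤ.* c ℤ.+ + sum (map (g ∘ proj₂) (map (shift l) (removals ls))) ℤ.* c
    ≡⟨ cong₂ ℤ._+_ (part₁ (removeFirst-cases l ls f≤)) part₂ ⟩
  h b (b ℤ.- 1ℤ ∷ betaℤ ls) ℤ.+ ΣLowering (λ y _ zs → h y (b ∷ zs)) (betaℤ ls) ∎
  where
  s₁ = sum (map (g ∘ proj₂) (removeFirst l ls))
  b = + (l + length ls)
  part₁ : (removeFirst l ls ≡ [] × first ls ≡ l) ⊎ (∃ λ k → l ≡ suc k × removeFirst l ls ≡ (0 , k ∷ ls) ∷ [] × first ls ≤ k) →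
          + s₁ ℤ.* c ≡ h b (b ℤ.- 1ℤ ∷ betaℤ ls)
  part₁ (inj₁ (eq , refl)) rewrite eq = trans (ℤ.*-zeroˡ c) (sym (bad _ _ (degenerate-first ls)))
  part₁ (inj₂ (k , refl , eq , f≤k)) rewrite eq | +-identityʳ (g (k ∷ ls)) = good (here f≤k) here
  part₂ : + sum (map (g ∘ proj₂) (map (shift l) (removals ls))) ℤ.* c ≡ ΣLowering (λ y _ zs → h y (b ∷ zs)) (betaℤ ls)
  part₂ rewrite sym (map-∘ {g = g ∘ proj₂} {f = shift l} (removals ls)) =
    Σremovals (g ∘ (l ∷_)) c (λ y zs → h y (b ∷ zs)) d
      (λ {i} {ms} {y} r e → trans (good (there r) (subst (λ k → Decrement (l + length ls ∷ beta ls) y (l + k ∷ beta ms)) (RemoveBox-length r) (there e)))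
                  (cong (λ k → h (+ y) (+ (l + k) ∷ betaℤ ms)) (sym (RemoveBox-length r))))
      λ { y zs (inj₁ z) → bad y (b ∷ zs) (inj₁ z)
         ; y zs (inj₂ z) → bad y (b ∷ zs) (inj₂ (trans (cong (diffs b zs ℤ.*_) z) (ℤ.*-zeroʳ (diffs b zs)))) }

length-beta : ∀ ls → length (beta ls) ≡ length ls
length-beta []       = refl
length-beta (l ∷ ls) = cong suc (length-beta ls)

excess-beta : ∀ ls → excess (betaℤ ls) ≡ + sum ls
excess-beta []       = refl
excess-beta (l ∷ ls)
  rewrite excess-beta ls | length-map +_ (beta ls) | length-beta ls = ring (+ l) (+ length ls) (+ sum ls)
  where
  ring : ∀ a b c → a ℤ.+ b ℤ.- b ℤ.+ c ≡ a ℤ.+ c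
  ring = solve-∀

sum≡0⇒zeros : ∀ ls → sum ls ≡ 0 → ls ≡ replicate (length ls) 0
sum≡0⇒zeros []          eq = refl
sum≡0⇒zeros (zero ∷ ls) eq = cong (0 ∷_) (sum≡0⇒zeros ls eq)

suc-cancel : ∀ a t → + (suc a + t) ℤ.- + a ≡ + suc t
suc-cancel a t = trans (cong (λ s → + s ℤ.- + a) (sym (+-suc a t))) (ring (+ a) (+ suc t))
  where
  ring : ∀ a b → a ℤ.+ b ℤ.- a ≡ b
  ring = solve-∀

-- The beta numbers here are k - 1, ..., 0, so the factors are t + 1, ..., k + t; trading one unit
-- of `k` for one of `t` keeps the top value k + t fixed in the induction.
diffs-zeros : ∀ k t → diffs (+ (k + t)) (betaℤ (replicate k 0)) ℤ.* + (t !) ≡ + ((k + t) !)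
diffs-zeros zero    t = ℤ.*-identityˡ (+ (t !))
diffs-zeros (suc k) t rewrite length-replicate k {0} | suc-cancel k t = begin
  + suc t ℤ.* d ℤ.* + (t !)     ≡⟨ ring (+ suc t) d (+ (t !)) ⟩
  d ℤ.* (+ suc t ℤ.* + (t !))   ≡⟨ cong (d ℤ.*_) (ℤ.pos-* (suc t) (t !)) ⟨
  d ℤ.* + (suc t !)             ≡⟨ cong (λ s → diffs (+ s) (betaℤ (replicate k 0)) ℤ.* + (suc t !)) (sym (+-suc k t)) ⟩
  diffs (+ (k + suc t)) (betaℤ (replicate k 0)) ℤ.* + (suc t !) ≡⟨ diffs-zeros k (suc t) ⟩
  + ((k + suc t) !)             ≡⟨ cong (λ s → + (s !)) (+-suc k t) ⟩
  + ((suc k + t) !)             ∎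
  where
  d = diffs (+ (suc k + t)) (betaℤ (replicate k 0))
  ring : ∀ a b c → a ℤ.* b ℤ.* c ≡ b ℤ.* (a ℤ.* c)
  ring = solve-∀

vandermonde-zeros : ∀ k → + factorials (beta (replicate k 0)) ≡ vandermonde (betaℤ (replicate k 0))
vandermonde-zeros zero    = refl
vandermonde-zeros (suc k)
  rewrite length-replicate k {0} = trans (ℤ.pos-* (k !) (factorials (beta (replicate k 0))))
  (cong₂ ℤ._*_ (trans (cong (λ s → + (s !)) (sym (+-identityʳ k))) (trans (sym (diffs-zeros k 0))
     (trans (ℤ.*-identityʳ _) (cong (λ s → diffs (+ s) (betaℤ (replicate k 0))) (+-identityʳ k))))) (vandermonde-zeros k))

-- The determinantal form of the hook length formula, f^λ = n! ∏_{i<j} (bᵢ - bⱼ) / ∏ bᵢ!.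
frobenius : ∀ n {ls} → Desc ls → sum ls ≡ n →
  + dim ls ℤ.* + factorials (beta ls) ≡ + (n !) ℤ.* vandermonde (betaℤ ls)
frobenius zero {ls} d eq rewrite sum≡0⇒zeros ls eq | dim-zeros (length ls) =
  cong (1ℤ ℤ.*_) (vandermonde-zeros (length ls))
frobenius (suc n) {ls} d eq = begin
  + dim ls ℤ.* c
    ≡⟨ cong (λ s → + s ℤ.* c) (dim-branching ls eq) ⟩
  + sum (map (dim ∘ proj₂) (removals ls)) ℤ.* c
    ≡⟨ Σremovals dim c (λ y zs → + (n !) ℤ.* (y ℤ.* vandermonde zs)) d good bad ⟩
  ΣLowering (λ y _ zs → + (n !) ℤ.* (y ℤ.* vandermonde zs)) (betaℤ ls)
    ≡⟨ ΣLowering-linear {h = λ _ _ _ → 0ℤ} (+ (n !)) 0ℤ (betaℤ ls) (λ _ → sym (ℤ.+-identityʳ _)) ⟩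
  + (n !) ℤ.* ΣLowering (λ y _ zs → y ℤ.* vandermonde zs) (betaℤ ls) ℤ.+ 0ℤ ℤ.* ΣLowering (λ _ _ _ → 0ℤ) (betaℤ ls)
    ≡⟨ cong₂ (λ a b → + (n !) ℤ.* a ℤ.+ b) (Σweighted-vandermonde (betaℤ ls)) (ℤ.*-zeroˡ (ΣLowering (λ _ _ _ → 0ℤ) (betaℤ ls))) ⟩
  + (n !) ℤ.* (excess (betaℤ ls) ℤ.* vandermonde (betaℤ ls)) ℤ.+ 0ℤ
    ≡⟨ cong (λ e → + (n !) ℤ.* (e ℤ.* vandermonde (betaℤ ls)) ℤ.+ 0ℤ) (trans (excess-beta ls) (cong +_ eq)) ⟩
  + (n !) ℤ.* (+ suc n ℤ.* vandermonde (betaℤ ls)) ℤ.+ 0ℤ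
    ≡⟨ ring₁ (+ (n !)) (+ suc n) (vandermonde (betaℤ ls)) ⟩
  + suc n ℤ.* + (n !) ℤ.* vandermonde (betaℤ ls)
    ≡⟨ cong (ℤ._* vandermonde (betaℤ ls)) (ℤ.pos-* (suc n) (n !)) ⟨
  + (suc n !) ℤ.* vandermonde (betaℤ ls) ∎
  where
  c = + factorials (beta ls)
  ring₁ : ∀ a b v → a ℤ.* (b ℤ.* v) ℤ.+ 0ℤ ≡ b ℤ.* a ℤ.* v
  ring₁ = solve-∀
  ring₂ : ∀ a b c → a ℤ.* (b ℤ.* c) ≡ b ℤ.* (a ℤ.* c)
  ring₂ = solve-∀
  good : ∀ {i ms y} → RemoveBox i ls ms → Decrement (beta ls) y (beta ms) →
    + dim ms ℤ.* c ≡ + (n !) ℤ.* (+ y ℤ.* vandermonde (betaℤ ms))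
  good {ms = ms} {y} r e = begin
    + dim ms ℤ.* + factorials (beta ls)
      ≡⟨ cong (λ s → + dim ms ℤ.* + s) (factorials-Decrement e) ⟩
    + dim ms ℤ.* + (y * factorials (beta ms))
      ≡⟨ cong (+ dim ms ℤ.*_) (ℤ.pos-* y (factorials (beta ms))) ⟩
    + dim ms ℤ.* (+ y ℤ.* + factorials (beta ms))
      ≡⟨ ring₂ (+ dim ms) (+ y) (+ factorials (beta ms)) ⟩
    + y ℤ.* (+ dim ms ℤ.* + factorials (beta ms))
      ≡⟨ cong (+ y ℤ.*_) (frobenius n (RemoveBox-Desc r d) (suc-injective (trans (sym (RemoveBox-sum r)) eq))) ⟩
    + y ℤ.* (+ (n !) ℤ.* vandermonde (betaℤ ms))
      ≡⟨ ring₂ (+ y) (+ (n !)) (vandermonde (betaℤ ms)) ⟩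
    + (n !) ℤ.* (+ y ℤ.* vandermonde (betaℤ ms)) ∎
  bad : ∀ y zs → Degenerate y zs → + (n !) ℤ.* (y ℤ.* vandermonde zs) ≡ 0ℤ
  bad _ zs (inj₁ refl) = trans (cong (+ (n !) ℤ.*_) (ℤ.*-zeroˡ (vandermonde zs))) (ℤ.*-zeroʳ (+ (n !)))
  bad y zs (inj₂ z) rewrite z | ℤ.*-zeroʳ y = ℤ.*-zeroʳ (+ (n !))

-- The boundary of a Ferrers diagram: every true is a row, whose length is the number of later falses.
Word : Set
Word = List Bool

zeros : Word → ℕ
zeros []          = 0
zeros (true  ∷ w) = zeros w
zeros (false ∷ w) = suc (zeros w)

ones : Word → ℕ
ones []          = 0
ones (true  ∷ w) = suc (ones w)
ones (false ∷ w) = ones w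

parts : Word → List ℕ
parts []          = []
parts (true  ∷ w) = zeros w ∷ parts w
parts (false ∷ w) = parts w

size : Word → ℕ
size w = sum (parts w)

-- The hooks of the diagram are the pairs of a true before a false, and the hook length is their distance.
armHooks : ℕ → Word → ℕ
armHooks d []          = 1
armHooks d (true  ∷ w) = armHooks (suc d) w
armHooks d (false ∷ w) = d * armHooks (suc d) w

hooks : Word → ℕ
hooks []          = 1
hooks (true  ∷ w) = armHooks 1 w * hooks w
hooks (false ∷ w) = hooks w

ones+zeros : ∀ w → ones w + zeros w ≡ length w
ones+zeros []          = refl
ones+zeros (true  ∷ w) = cong suc (ones+zeros w)
ones+zeros (false ∷ w) = trans (+-suc _ _) (cong suc (ones+zeros w))

length-parts : ∀ w → length (parts w) ≡ ones w
length-parts []          = refl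
length-parts (true  ∷ w) = cong suc (length-parts w)
length-parts (false ∷ w) = length-parts w

zeros+parts : ∀ w → zeros w + length (parts w) ≡ length w
zeros+parts w = trans (cong (λ k → zeros w + k) (length-parts w)) (trans (+-comm (zeros w) (ones w)) (ones+zeros w))

first-parts : ∀ w → first (parts w) ≤ zeros w
first-parts []          = z≤n
first-parts (true  ∷ w) = ≤-refl
first-parts (false ∷ w) = m≤n⇒m≤1+n (first-parts w)

parts-Desc : ∀ w → Desc (parts w)
parts-Desc []          = []
parts-Desc (true  ∷ w) = first-parts w ∷ parts-Desc w
parts-Desc (false ∷ w) = parts-Desc w

-- A letter at distance e from the chosen row contributes the factor e exactly once: a `true` as a
-- difference of beta numbers, a `false` as a hook length. Together they exhaust t + 1, ..., length
-- w + t.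
diffs-armHooks : ∀ w t → diffs (+ (length w + t)) (betaℤ (parts w)) ℤ.* + armHooks (suc t) w ℤ.* + (t !) ≡ + ((length w + t) !)
diffs-armHooks []          t = ℤ.*-identityˡ (+ (t !))
diffs-armHooks (true ∷ w)  t rewrite zeros+parts w | suc-cancel (length w) t = begin
  + suc t ℤ.* d ℤ.* a ℤ.* + (t !)   ≡⟨ ring (+ suc t) d a (+ (t !)) ⟩
  d ℤ.* a ℤ.* (+ suc t ℤ.* + (t !)) ≡⟨ cong (d ℤ.* a ℤ.*_) (ℤ.pos-* (suc t) (t !)) ⟨
  d ℤ.* a ℤ.* + (suc t !)           ≡⟨ cong (λ s → diffs (+ s) (betaℤ (parts w)) ℤ.* a ℤ.* + (suc t !)) (sym (+-suc (length w) t)) ⟩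
  diffs (+ (length w + suc t)) (betaℤ (parts w)) ℤ.* a ℤ.* + (suc t !) ≡⟨ diffs-armHooks w (suc t) ⟩
  + ((length w + suc t) !)          ≡⟨ cong (λ s → + (s !)) (+-suc (length w) t) ⟩
  + ((suc (length w) + t) !)        ∎
  where
  d = diffs (+ (suc (length w) + t)) (betaℤ (parts w))
  a = + armHooks (suc (suc t)) w
  ring : ∀ a b c e → a ℤ.* b ℤ.* c ℤ.* e ≡ b ℤ.* c ℤ.* (a ℤ.* e)
  ring = solve-∀
diffs-armHooks (false ∷ w) t = begin
  d ℤ.* + (suc t * armHooks (suc (suc t)) w) ℤ.* + (t !) ≡⟨ cong (λ h → d ℤ.* h ℤ.* + (t !)) (ℤ.pos-* (suc t) (armHooks (suc (suc t)) w)) ⟩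
  d ℤ.* (+ suc t ℤ.* a) ℤ.* + (t !) ≡⟨ ring (+ suc t) d a (+ (t !)) ⟩
  d ℤ.* a ℤ.* (+ suc t ℤ.* + (t !)) ≡⟨ cong (d ℤ.* a ℤ.*_) (ℤ.pos-* (suc t) (t !)) ⟨
  d ℤ.* a ℤ.* + (suc t !)           ≡⟨ cong (λ s → diffs (+ s) (betaℤ (parts w)) ℤ.* a ℤ.* + (suc t !)) (sym (+-suc (length w) t)) ⟩
  diffs (+ (length w + suc t)) (betaℤ (parts w)) ℤ.* a ℤ.* + (suc t !) ≡⟨ diffs-armHooks w (suc t) ⟩
  + ((length w + suc t) !)          ≡⟨ cong (λ s → + (s !)) (+-suc (length w) t) ⟩
  + ((suc (length w) + t) !)        ∎
  where
  d = diffs (+ (suc (length w) + t)) (betaℤ (parts w))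
  a = + armHooks (suc (suc t)) w
  ring : ∀ a b c e → b ℤ.* (a ℤ.* c) ℤ.* e ≡ b ℤ.* c ℤ.* (a ℤ.* e)
  ring = solve-∀

vandermonde*hooks : ∀ w → vandermonde (betaℤ (parts w)) ℤ.* + hooks w ≡ + factorials (beta (parts w))
vandermonde*hooks []          = refl
vandermonde*hooks (false ∷ w) = vandermonde*hooks w
vandermonde*hooks (true ∷ w)
  rewrite zeros+parts w = begin
  d ℤ.* v ℤ.* + (armHooks 1 w * hooks w)
    ≡⟨ cong (d ℤ.* v ℤ.*_) (ℤ.pos-* (armHooks 1 w) (hooks w)) ⟩
  d ℤ.* v ℤ.* (+ armHooks 1 w ℤ.* + hooks w)
    ≡⟨ ring d v (+ armHooks 1 w) (+ hooks w) ⟩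
  d ℤ.* + armHooks 1 w ℤ.* 1ℤ ℤ.* (v ℤ.* + hooks w)
    ≡⟨ cong₂ ℤ._*_ (subst (λ k → diffs (+ k) (betaℤ (parts w)) ℤ.* + armHooks 1 w ℤ.* 1ℤ ≡ + (k !)) (+-identityʳ (length w)) (diffs-armHooks w 0))
                   (vandermonde*hooks w) ⟩
  + (length w !) ℤ.* + factorials (beta (parts w))
    ≡⟨ ℤ.pos-* (length w !) (factorials (beta (parts w))) ⟨
  + (length w ! * factorials (beta (parts w))) ∎
  where
  d = diffs (+ length w) (betaℤ (parts w))
  v = vandermonde (betaℤ (parts w))
  ring : ∀ d v a h → d ℤ.* v ℤ.* (a ℤ.* h) ≡ d ℤ.* a ℤ.* 1ℤ ℤ.* (v ℤ.* h)
  ring = solve-∀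

factorials≢0 : ∀ ls → NonZero (factorials ls)
factorials≢0 []       = _
factorials≢0 (l ∷ ls) = m*n≢0 (l !) (factorials ls) {{l !≢0}} {{factorials≢0 ls}}

hook-length-formula : ∀ w → dim (parts w) * hooks w ≡ size w !
hook-length-formula w = *-cancelʳ-≡ _ _ f {{factorials≢0 (beta (parts w))}} (ℤ.+-injective (begin
  + (dim (parts w) * hooks w * f)      ≡⟨ trans (ℤ.pos-* (dim (parts w) * hooks w) f) (cong (ℤ._* + f) (ℤ.pos-* (dim (parts w)) (hooks w))) ⟩
  + dim (parts w) ℤ.* + hooks w ℤ.* + f ≡⟨ ring₁ (+ dim (parts w)) (+ hooks w) (+ f) ⟩
  + dim (parts w) ℤ.* + f ℤ.* + hooks w ≡⟨ cong (ℤ._* + hooks w) (frobenius (size w) (parts-Desc w) refl) ⟩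
  + (size w !) ℤ.* v ℤ.* + hooks w      ≡⟨ ℤ.*-assoc (+ (size w !)) v (+ hooks w) ⟩
  + (size w !) ℤ.* (v ℤ.* + hooks w)    ≡⟨ cong (+ (size w !) ℤ.*_) (vandermonde*hooks w) ⟩
  + (size w !) ℤ.* + f                  ≡⟨ ℤ.pos-* (size w !) f ⟨
  + (size w ! * f)                      ∎))
  where
  f = factorials (beta (parts w))
  v = vandermonde (betaℤ (parts w))
  ring₁ : ∀ a b c → a ℤ.* b ℤ.* c ≡ a ℤ.* c ℤ.* b
  ring₁ = solve-∀

-- 2-adic valuations and 2-quotients

data Parity : ℕ → Set where
  even : ∀ m → Parity (m * 2)
  odd  : ∀ m → Parity (suc (m * 2))

evenOrOdd : ∀ n → Parity n
evenOrOdd zero = even 0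
evenOrOdd (suc n) with evenOrOdd n
... | even m = odd m
... | odd m  = even (suc m)

double≢odd : ∀ a b → a * 2 ≢ suc (b * 2)
double≢odd (suc a) (suc b) eq = double≢odd a b (suc-injective (suc-injective eq))

HasValuation : ℕ → ℕ → Set
HasValuation n k = ∃ λ m → n ≡ 2 ^ k * suc (m * 2)

valuation-exists : ∀ n → Acc _<_ n → 0 < n → ∃ (HasValuation n)
valuation-exists n (acc rs) n>0 with evenOrOdd n
... | odd m  = 0 , m , sym (+-identityʳ _)
... | even (suc m) with valuation-exists (suc m) (rs (s≤s (s≤s (m≤m*n m 2)))) z<s
...   | k , r , eq = suc k , r , (begin
        suc m * 2                      ≡⟨ *-comm (suc m) 2 ⟩
        2 * suc m                      ≡⟨ cong (2 *_) eq ⟩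
        2 * (2 ^ k * suc (r * 2))      ≡⟨ *-assoc 2 (2 ^ k) _ ⟨
        2 ^ suc k * suc (r * 2)        ∎)

valuation-unique : ∀ k l {r s} → 2 ^ k * suc (r * 2) ≡ 2 ^ l * suc (s * 2) → k ≡ l
valuation-unique zero    zero    eq = refl
valuation-unique zero    (suc l) {r} {s} eq =
  ⊥-elim (double≢odd (2 ^ l * suc (s * 2)) r (trans (ring (2 ^ l) (suc (s * 2))) (trans (sym eq) (+-identityʳ _))))
  where
  ring : ∀ a b → a * b * 2 ≡ 2 * a * b
  ring = solveℕ
valuation-unique (suc k) zero    {r} {s} eq =
  ⊥-elim (double≢odd (2 ^ k * suc (r * 2)) s (trans (ring (2 ^ k) (suc (r * 2))) (trans eq (+-identityʳ _))))
  where
  ring : ∀ a b → a * b * 2 ≡ 2 * a * b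
  ring = solveℕ
valuation-unique (suc k) (suc l) {r} {s} eq = cong suc (valuation-unique k l {r} {s}
  (*-cancelˡ-≡ _ _ 2 (trans (sym (*-assoc 2 (2 ^ k) _)) (trans eq (*-assoc 2 (2 ^ l) _)))))

abstract
  v₂ : ℕ → ℕ
  v₂ zero    = 0
  v₂ (suc n) = proj₁ (valuation-exists (suc n) (<-wellFounded (suc n)) z<s)

  v₂-hasValuation : ∀ {n} → 0 < n → HasValuation n (v₂ n)
  v₂-hasValuation {suc n} _ = proj₂ (valuation-exists (suc n) (<-wellFounded (suc n)) z<s)

v₂-unique : ∀ {n k} → 0 < n → HasValuation n k → v₂ n ≡ k
v₂-unique n>0 (r , eq) with v₂-hasValuation n>0
... | s , eq′ = valuation-unique _ _ {s} {r} (trans (sym eq′) eq)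

v₂-odd : ∀ m → v₂ (suc (m * 2)) ≡ 0
v₂-odd m = v₂-unique z<s (m , sym (+-identityʳ _))

*-pos : ∀ {a b} → 0 < a → 0 < b → 0 < a * b
*-pos {suc a} {suc b} _ _ = z<s

v₂-* : ∀ {a b} → 0 < a → 0 < b → v₂ (a * b) ≡ v₂ a + v₂ b
v₂-* {a} {b} a>0 b>0 with v₂-hasValuation a>0 | v₂-hasValuation b>0
... | r , eq | s , eq′ = v₂-unique (*-pos a>0 b>0) (r * s * 2 + r + s , (begin
  a * b
    ≡⟨ cong₂ _*_ eq eq′ ⟩
  2 ^ v₂ a * suc (r * 2) * (2 ^ v₂ b * suc (s * 2))
    ≡⟨ ring (2 ^ v₂ a) r (2 ^ v₂ b) s ⟩
  2 ^ v₂ a * 2 ^ v₂ b * suc ((r * s * 2 + r + s) * 2)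
    ≡⟨ cong (_* suc ((r * s * 2 + r + s) * 2)) (^-distribˡ-+-* 2 (v₂ a) (v₂ b)) ⟨
  2 ^ (v₂ a + v₂ b) * suc ((r * s * 2 + r + s) * 2) ∎))
  where
  ring : ∀ a r b s → a * suc (r * 2) * (b * suc (s * 2)) ≡ a * b * suc ((r * s * 2 + r + s) * 2)
  ring = solveℕ

v₂-double : ∀ {a} → 0 < a → v₂ (a * 2) ≡ suc (v₂ a)
v₂-double {a} a>0 = trans (v₂-* a>0 z<s) (trans (cong (λ k → v₂ a + k) (v₂-unique z<s (0 , refl))) (+-comm (v₂ a) 1))

abstract
  v₂! : ℕ → ℕ
  v₂! n = v₂ (n !)

  v₂!-def : ∀ n → v₂! n ≡ v₂ (n !)
  v₂!-def n = refl

v₂!-zero : v₂! 0 ≡ 0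
v₂!-zero = trans (v₂!-def 0) (v₂-odd 0)

v₂!-suc : ∀ n → v₂! (suc n) ≡ v₂ (suc n) + v₂! n
v₂!-suc n = trans (v₂!-def (suc n)) (trans (v₂-* {suc n} z<s (1≤n! n)) (cong (λ k → v₂ (suc n) + k) (sym (v₂!-def n))))

v₂!-odd : ∀ m → v₂! (suc (m * 2)) ≡ v₂! (m * 2)
v₂!-odd m = trans (v₂!-suc (m * 2)) (cong (_+ v₂! (m * 2)) (v₂-odd m))

-- The even factors of (2m)! are the doubles of 1, ..., m, and the odd ones contribute nothing.
v₂!-even : ∀ m → v₂! (m * 2) ≡ m + v₂! m
v₂!-even zero    = refl
v₂!-even (suc m) = begin
  v₂! (suc m * 2)                          ≡⟨ v₂!-suc (suc (m * 2)) ⟩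
  v₂ (suc m * 2) + v₂! (suc (m * 2))       ≡⟨ cong₂ _+_ (v₂-double {suc m} z<s) (trans (v₂!-odd m) (v₂!-even m)) ⟩
  suc (v₂ (suc m)) + (m + v₂! m)           ≡⟨ ring (v₂ (suc m)) m (v₂! m) ⟩
  suc m + (v₂ (suc m) + v₂! m)             ≡⟨ cong (λ k → suc m + k) (v₂!-suc m) ⟨
  suc m + v₂! (suc m)                      ∎
  where
  ring : ∀ a m b → suc a + (m + b) ≡ suc m + (a + b)
  ring = solveℕ

v₂!-mono : ∀ {m n} → m ≤ n → v₂! m ≤ v₂! n
v₂!-mono {m} m≤n with m≤n⇒∃[o]m+o≡n m≤n
... | o , refl = go o
  where
  go : ∀ o → v₂! m ≤ v₂! (m + o)
  go zero    = ≤-reflexive (cong v₂! (sym (+-identityʳ m)))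
  go (suc o) = ≤-trans (go o) (≤-trans (m≤n+m (v₂! (m + o)) (v₂ (suc (m + o))))
    (≤-reflexive (trans (sym (v₂!-suc (m + o))) (cong v₂! (sym (+-suc m o))))))

-- The quotient of (a + b)! by a! b! is an integer.
v₂!-superadditive : ∀ a b → v₂! a + v₂! b ≤ v₂! (a + b)
v₂!-superadditive a b with k![n∸k]!∣n! {a + b} {a} (m≤m+n a b)
... | divides zero eq = ⊥-elim (<⇒≢ (1≤n! (a + b)) (sym eq))
... | divides (suc q) eq rewrite m+n∸m≡n a b = ≤-trans
  (≤-reflexive (trans (cong₂ _+_ (v₂!-def a) (v₂!-def b)) (sym (v₂-* (1≤n! a) (1≤n! b)))))
  (≤-trans (m≤n+m (v₂ (a ! * b !)) (v₂ (suc q)))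
           (≤-reflexive (trans (sym (v₂-* {suc q} z<s (*-pos (1≤n! a) (1≤n! b)))) (trans (cong v₂ (sym eq)) (sym (v₂!-def (a + b)))))))

armValuation : ℕ → Word → ℕ
armValuation d []          = 0
armValuation d (true  ∷ w) = armValuation (suc d) w
armValuation d (false ∷ w) = v₂ d + armValuation (suc d) w

hookValuation : Word → ℕ
hookValuation []          = 0
hookValuation (true  ∷ w) = armValuation 1 w + hookValuation w
hookValuation (false ∷ w) = hookValuation w

armHooks-pos : ∀ d w → 0 < armHooks (suc d) w
armHooks-pos d []          = z<s
armHooks-pos d (true  ∷ w) = armHooks-pos (suc d) w
armHooks-pos d (false ∷ w) = *-pos {suc d} z<s (armHooks-pos (suc d) w)

hooks-pos : ∀ w → 0 < hooks w
hooks-pos []          = z<s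
hooks-pos (true  ∷ w) = *-pos (armHooks-pos 0 w) (hooks-pos w)
hooks-pos (false ∷ w) = hooks-pos w

v₂-armHooks : ∀ d w → v₂ (armHooks (suc d) w) ≡ armValuation (suc d) w
v₂-armHooks d []          = v₂-odd 0
v₂-armHooks d (true  ∷ w) = v₂-armHooks (suc d) w
v₂-armHooks d (false ∷ w) = trans (v₂-* {suc d} z<s (armHooks-pos (suc d) w)) (cong (λ k → v₂ (suc d) + k) (v₂-armHooks (suc d) w))

v₂-hooks : ∀ w → v₂ (hooks w) ≡ hookValuation w
v₂-hooks []          = v₂-odd 0
v₂-hooks (true  ∷ w) = trans (v₂-* (armHooks-pos 0 w) (hooks-pos w)) (cong₂ _+_ (v₂-armHooks 0 w) (v₂-hooks w))
v₂-hooks (false ∷ w) = v₂-hooks w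

dim-pos : ∀ w → 0 < dim (parts w)
dim-pos w with dim (parts w) | hook-length-formula w
... | zero  | eq = ⊥-elim (<⇒≢ (1≤n! (size w)) eq)
... | suc _ | _  = z<s

abstract
  dimValuation : Word → ℕ
  dimValuation w = v₂ (dim (parts w))

  dimValuation-def : ∀ w → dimValuation w ≡ v₂ (dim (parts w))
  dimValuation-def w = refl

dimValuation+hookValuation : ∀ w → dimValuation w + hookValuation w ≡ v₂! (size w)
dimValuation+hookValuation w = trans (cong₂ _+_ (dimValuation-def w) (sym (v₂-hooks w)))
  (trans (sym (v₂-* (dim-pos w) (hooks-pos w))) (trans (cong v₂ (hook-length-formula w)) (sym (v₂!-def (size w)))))

-- Every word of even length arises exactly once from two words of equal length; `u` and `v` are
-- then the boundary words of its 2-quotient.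
interleave : Word → Word → Word
interleave []      v       = []
interleave (a ∷ u) []      = []
interleave (a ∷ u) (b ∷ v) = a ∷ b ∷ interleave u v

-- From an even starting distance the letters of `u` sit at even distances 2e, each `false` adding 1
-- + v₂ e, while those of `v` sit at odd distances and add nothing. In `armValuation-odd` the roles
-- are exchanged.
armValuation-even : ∀ d u v → length u ≡ length v →
  armValuation (suc d * 2) (interleave u v) ≡ zeros u + armValuation (suc d) u
armValuation-even d []          []          eq = refl
armValuation-even d (true ∷ u)  (true ∷ v)  eq = armValuation-even (suc d) u v (suc-injective eq)
armValuation-even d (true ∷ u)  (false ∷ v) eq rewrite v₂-odd (suc d) = armValuation-even (suc d) u v (suc-injective eq)
armValuation-even d (false ∷ u) (true ∷ v)  eq
  rewrite v₂-double {suc d} z<s | armValuation-even (suc d) u v (suc-injective eq) =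
  cong suc (+-exchange (v₂ (suc d)) (zeros u) _)
armValuation-even d (false ∷ u) (false ∷ v) eq
  rewrite v₂-odd (suc d) | v₂-double {suc d} z<s | armValuation-even (suc d) u v (suc-injective eq) =
  cong suc (+-exchange (v₂ (suc d)) (zeros u) _)

armValuation-odd : ∀ d u v → length u ≡ length v →
  armValuation (suc (d * 2)) (interleave u v) ≡ zeros v + armValuation (suc d) v
armValuation-odd d []          []          eq = refl
armValuation-odd d (true ∷ u)  (true ∷ v)  eq = armValuation-odd (suc d) u v (suc-injective eq)
armValuation-odd d (true ∷ u)  (false ∷ v) eq
  rewrite v₂-double {suc d} z<s | armValuation-odd (suc d) u v (suc-injective eq) =
  cong suc (+-exchange (v₂ (suc d)) (zeros v) _)
armValuation-odd d (false ∷ u) (true ∷ v)  eq rewrite v₂-odd d = armValuation-odd (suc d) u v (suc-injective eq)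
armValuation-odd d (false ∷ u) (false ∷ v) eq
  rewrite v₂-odd d | v₂-double {suc d} z<s | armValuation-odd (suc d) u v (suc-injective eq) =
  cong suc (+-exchange (v₂ (suc d)) (zeros v) _)

-- Hooks joining letters of different parity have odd length; the others are doubled hooks of u and v.
hookValuation-interleave : ∀ u v → length u ≡ length v →
  hookValuation (interleave u v) ≡ (size u + hookValuation u) + (size v + hookValuation v)
hookValuation-interleave [] [] eq = refl
hookValuation-interleave (true ∷ u) (true ∷ v) eq = begin
  armValuation 2 (interleave u v) + (armValuation 1 (interleave u v) + hookValuation (interleave u v))
    ≡⟨ cong₂ _+_ (armValuation-even 0 u v eq′) (cong₂ _+_ (armValuation-odd 0 u v eq′) (hookValuation-interleave u v eq′)) ⟩
  zeros u + armValuation 1 u + (zeros v + armValuation 1 v + ((size u + hookValuation u) + (size v + hookValuation v)))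
    ≡⟨ ring (zeros u) (armValuation 1 u) (zeros v) (armValuation 1 v) (size u) (hookValuation u) (size v) (hookValuation v) ⟩
  zeros u + size u + (armValuation 1 u + hookValuation u) + (zeros v + size v + (armValuation 1 v + hookValuation v)) ∎
  where
  eq′ = suc-injective eq
  ring : ∀ a b c d e f g h → a + b + (c + d + ((e + f) + (g + h))) ≡ a + e + (b + f) + (c + g + (d + h))
  ring = solveℕ
hookValuation-interleave (true ∷ u) (false ∷ v) eq = begin
  v₂ 1 + armValuation 2 (interleave u v) + hookValuation (interleave u v)
    ≡⟨ cong₂ _+_ (cong₂ _+_ (v₂-odd 0) (armValuation-even 0 u v eq′)) (hookValuation-interleave u v eq′) ⟩
  zeros u + armValuation 1 u + ((size u + hookValuation u) + (size v + hookValuation v))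
    ≡⟨ ring (zeros u) (armValuation 1 u) (size u) (hookValuation u) (size v) (hookValuation v) ⟩
  zeros u + size u + (armValuation 1 u + hookValuation u) + (size v + hookValuation v) ∎
  where
  eq′ = suc-injective eq
  ring : ∀ a b e f g h → a + b + ((e + f) + (g + h)) ≡ a + e + (b + f) + (g + h)
  ring = solveℕ
hookValuation-interleave (false ∷ u) (true ∷ v) eq = begin
  armValuation 1 (interleave u v) + hookValuation (interleave u v)
    ≡⟨ cong₂ _+_ (armValuation-odd 0 u v eq′) (hookValuation-interleave u v eq′) ⟩
  zeros v + armValuation 1 v + ((size u + hookValuation u) + (size v + hookValuation v))
    ≡⟨ ring (zeros v) (armValuation 1 v) (size u) (hookValuation u) (size v) (hookValuation v) ⟩
  size u + hookValuation u + (zeros v + size v + (armValuation 1 v + hookValuation v)) ∎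
  where
  eq′ = suc-injective eq
  ring : ∀ c d e f g h → c + d + ((e + f) + (g + h)) ≡ e + f + (c + g + (d + h))
  ring = solveℕ
hookValuation-interleave (false ∷ u) (false ∷ v) eq = hookValuation-interleave u v (suc-injective eq)

ones-interleave : ∀ u v → length u ≡ length v → ones (interleave u v) ≡ ones u + ones v
ones-interleave []          []          eq = refl
ones-interleave (true  ∷ u) (true  ∷ v) eq rewrite ones-interleave u v (suc-injective eq) = cong suc (sym (+-suc (ones u) (ones v)))
ones-interleave (true  ∷ u) (false ∷ v) eq rewrite ones-interleave u v (suc-injective eq) = refl
ones-interleave (false ∷ u) (true  ∷ v) eq rewrite ones-interleave u v (suc-injective eq) = sym (+-suc (ones u) (ones v))
ones-interleave (false ∷ u) (false ∷ v) eq = ones-interleave u v (suc-injective eq)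

zeros-interleave : ∀ u v → length u ≡ length v → zeros (interleave u v) ≡ zeros u + zeros v
zeros-interleave []          []          eq = refl
zeros-interleave (false ∷ u) (false ∷ v) eq rewrite zeros-interleave u v (suc-injective eq) = cong suc (sym (+-suc (zeros u) (zeros v)))
zeros-interleave (false ∷ u) (true  ∷ v) eq rewrite zeros-interleave u v (suc-injective eq) = refl
zeros-interleave (true  ∷ u) (false ∷ v) eq rewrite zeros-interleave u v (suc-injective eq) = sym (+-suc (zeros u) (zeros v))
zeros-interleave (true  ∷ u) (true  ∷ v) eq = zeros-interleave u v (suc-injective eq)

-- With k = ones u and l = ones v, twice the size of the 2-core is (k - l)² + (k - l); its negative terms are moved to the left.
size-interleave : ∀ u v → length u ≡ length v →
  2 * size (interleave u v) + 2 * (ones u * ones v) + ones v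
    ≡ 4 * (size u + size v) + ones u * ones u + ones v * ones v + ones u
size-interleave []          []          eq = refl
size-interleave (false ∷ u) (false ∷ v) eq = size-interleave u v (suc-injective eq)
size-interleave (true  ∷ u) (true  ∷ v) eq
  rewrite zeros-interleave u v (suc-injective eq) =
  trans (ring₁ (zeros u) (zeros v) (size (interleave u v)) (ones u) (ones v))
    (trans (cong (_+ (4 * (zeros u + zeros v) + 2 * ones u + 2 * ones v + 3)) (size-interleave u v (suc-injective eq)))
      (ring₂ (zeros u) (zeros v) (size u) (size v) (ones u) (ones v)))
  where
  ring₁ : ∀ a b s k l → 2 * (a + b + (a + b + s)) + 2 * (suc k * suc l) + suc l
    ≡ 2 * s + 2 * (k * l) + l + (4 * (a + b) + 2 * k + 2 * l + 3)
  ring₁ = solveℕ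
  ring₂ : ∀ a b i j k l → 4 * (i + j) + k * k + l * l + k + (4 * (a + b) + 2 * k + 2 * l + 3)
    ≡ 4 * (a + i + (b + j)) + suc k * suc k + suc l * suc l + suc k
  ring₂ = solveℕ
size-interleave (true  ∷ u) (false ∷ v) eq
  rewrite zeros-interleave u v (suc-injective eq) = begin
  2 * (suc (zeros u + zeros v) + s) + 2 * (suc k * l) + l
    ≡⟨ ring₁ (zeros u) (zeros v) s k l ⟩
  2 * s + 2 * (k * l) + l + (2 * zeros u + 2 * (l + zeros v) + 2)
    -- Equal lengths allow `l + zeros v` to be traded for `k + zeros u`, which removes `zeros v`.
    ≡⟨ cong₂ (λ a b → a + (2 * zeros u + 2 * b + 2)) (size-interleave u v eq′) (trans (ones+zeros v) (trans (sym eq′) (sym (ones+zeros u)))) ⟩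
  4 * (size u + size v) + k * k + l * l + k + (2 * zeros u + 2 * (k + zeros u) + 2)
    ≡⟨ ring₂ (zeros u) (size u) (size v) k l ⟩
  4 * (zeros u + size u + size v) + suc k * suc k + l * l + suc k ∎
  where
  eq′ = suc-injective eq
  s = size (interleave u v)
  k = ones u
  l = ones v
  ring₁ : ∀ a b s k l → 2 * (suc (a + b) + s) + 2 * (suc k * l) + l ≡ 2 * s + 2 * (k * l) + l + (2 * a + 2 * (l + b) + 2)
  ring₁ = solveℕ
  ring₂ : ∀ a i j k l → 4 * (i + j) + k * k + l * l + k + (2 * a + 2 * (k + a) + 2) ≡ 4 * (a + i + j) + suc k * suc k + l * l + suc k
  ring₂ = solveℕ
size-interleave (false ∷ u) (true ∷ v) eq
  rewrite zeros-interleave u v (suc-injective eq) = begin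
  2 * (zeros u + zeros v + s) + 2 * (k * suc l) + suc l
    ≡⟨ ring₁ (zeros u) (zeros v) s k l ⟩
  2 * s + 2 * (k * l) + l + (2 * zeros v + 2 * (k + zeros u) + 1)
    ≡⟨ cong₂ (λ a b → a + (2 * zeros v + 2 * b + 1)) (size-interleave u v eq′) (trans (ones+zeros u) (trans eq′ (sym (ones+zeros v)))) ⟩
  4 * (size u + size v) + k * k + l * l + k + (2 * zeros v + 2 * (l + zeros v) + 1)
    ≡⟨ ring₂ (zeros v) (size u) (size v) k l ⟩
  4 * (size u + (zeros v + size v)) + k * k + suc l * suc l + k ∎
  where
  eq′ = suc-injective eq
  s = size (interleave u v)
  k = ones u
  l = ones v
  ring₁ : ∀ a b s k l → 2 * (a + b + s) + 2 * (k * suc l) + suc l ≡ 2 * s + 2 * (k * l) + l + (2 * b + 2 * (k + a) + 1)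
  ring₁ = solveℕ
  ring₂ : ∀ b i j k l → 4 * (i + j) + k * k + l * l + k + (2 * b + 2 * (l + b) + 1) ≡ 4 * (i + (b + j)) + k * k + suc l * suc l + k
  ring₂ = solveℕ

-- Partitions as words

record IsPartition (n : ℕ) (ls : List ℕ) : Set where
  field
    positive   : All (1 ≤_) ls
    decreasing : Desc ls
    sums-to      : sum ls ≡ n
open IsPartition

weaklyDecr⁻ : ∀ ls → T (weaklyDecr ls) → Desc ls
weaklyDecr⁻ []           _ = []
weaklyDecr⁻ (l ∷ [])     _ = z≤n ∷ []
weaklyDecr⁻ (l ∷ m ∷ ls) t = let a , b = to T-∧ t in ≤ᵇ⇒≤ m l a ∷ weaklyDecr⁻ (m ∷ ls) b

weaklyDecr⁺ : ∀ {ls} → Desc ls → T (weaklyDecr ls)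
weaklyDecr⁺ []                = _
weaklyDecr⁺ (_ ∷ [])          = _
weaklyDecr⁺ (f≤ ∷ d@(_ ∷ _)) = from T-∧ (≤⇒≤ᵇ f≤ , weaklyDecr⁺ d)

isPartitionOf⁻ : ∀ {n} ls → T (isPartitionOf n ls) → IsPartition n ls
isPartitionOf⁻ ls t = let a , bc = to T-∧ t ; b , c = to T-∧ bc in record
  { positive = All.map (≤ᵇ⇒≤ 1 _) (T-all⁻ ls a) ; decreasing = weaklyDecr⁻ ls b ; sums-to = ≡ᵇ⇒≡ _ _ c }

isPartitionOf⁺ : ∀ {n ls} → IsPartition n ls → T (isPartitionOf n ls)
isPartitionOf⁺ p = from T-∧ (T-all⁺ (All.map ≤⇒≤ᵇ (positive p)) ,
  from T-∧ (weaklyDecr⁺ (decreasing p) , ≡⇒≡ᵇ _ _ (sums-to p)))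

≤-sum : ∀ ls → All (_≤ sum ls) ls
≤-sum []       = []
≤-sum (l ∷ ls) = m≤m+n l (sum ls) ∷ All.map (λ le → ≤-trans le (m≤n+m (sum ls) l)) (≤-sum ls)

length-≤-sum : ∀ {ls} → All (1 ≤_) ls → length ls ≤ sum ls
length-≤-sum []       = z≤n
length-≤-sum (p ∷ ps) = +-mono-≤ p (length-≤-sum ps)

keep : ℕ → List ℕ → List (List ℕ)
keep n ls = if isPartitionOf n ls then ls ∷ [] else []

∈-keep⁻ : ∀ {n ls ms} → ms ∈ keep n ls → ms ≡ ls × IsPartition n ms
∈-keep⁻ {n} {ls} ms∈ with isPartitionOf n ls in eq
∈-keep⁻ {n} {ls} (here refl) | true = refl , isPartitionOf⁻ ls (from T-≡ eq)

∈-keep⁺ : ∀ {n ls} → IsPartition n ls → ls ∈ keep n ls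
∈-keep⁺ {n} {ls} p with isPartitionOf n ls | isPartitionOf⁺ p
... | true | _ = here refl

keep-unique : ∀ n ls → Unique (keep n ls)
keep-unique n ls with isPartitionOf n ls
... | true  = [] ∷ []
... | false = []

partitionsOfLength : ℕ → ℕ → List (List ℕ)
partitionsOfLength n k = concatMap (keep n) (listsOfLength k (oneTo n))

Partitions-unique : ∀ n → Unique (Partitions n)
Partitions-unique n = concatMap-unique (λ ls k → length ls ≡ k) (λ p q → trans (sym p) q) (Unique.upTo⁺ (suc n))
  (λ {k} _ → concatMap-unique (λ ls ms → ls ≡ ms) (λ p q → trans (sym p) q) (listsOfLength-unique k (oneTo-unique n))
    (λ {ls} _ → keep-unique n ls) (λ _ ls∈ → proj₁ (∈-keep⁻ {n} ls∈)))
  (λ {k} _ ls∈ → length-ok k ls∈)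
  where
  length-ok : ∀ k {ls} → ls ∈ partitionsOfLength n k → length ls ≡ k
  length-ok k ls∈ with find (∈-concatMap⁻ (keep n) {xs = listsOfLength k (oneTo n)} ls∈)
  ... | ms , ms∈ , ls∈′ rewrite proj₁ (∈-keep⁻ {n} ls∈′) = proj₁ (∈-listsOfLength⁻ k ms∈)

∈-Partitions⁻ : ∀ {n ls} → ls ∈ Partitions n → IsPartition n ls
∈-Partitions⁻ {n} ls∈ with find (∈-concatMap⁻ (partitionsOfLength n) {xs = upTo (suc n)} ls∈)
... | k , _ , ls∈′ with find (∈-concatMap⁻ (keep n) {xs = listsOfLength k (oneTo n)} ls∈′)
...   | _ , _ , ls∈″ = proj₂ (∈-keep⁻ {n} ls∈″)

∈-Partitions⁺ : ∀ {n ls} → IsPartition n ls → ls ∈ Partitions n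
∈-Partitions⁺ {n} {ls} p = ∈-concatMap⁺ (partitionsOfLength n)
  (lose (∈-upTo⁺ (s≤s (subst (length ls ≤_) (sums-to p) (length-≤-sum (positive p)))))
    (∈-concatMap⁺ (keep n) (lose (∈-listsOfLength⁺ (All.zipWith (∈-oneTo⁺) (positive p , subst (λ m → All (_≤ m) ls) (sums-to p) (≤-sum ls))))
      (∈-keep⁺ p))))

-- A word with k trues gives a partition padded by zeros to k rows. In a weakly decreasing list
-- everything after the first zero is padding, so cutting there recovers the partition.
strip : List ℕ → List ℕ
strip []           = []
strip (zero  ∷ ls) = []
strip (suc l ∷ ls) = suc l ∷ strip ls

strip-positive : ∀ ls → All (1 ≤_) (strip ls)
strip-positive []           = []
strip-positive (zero  ∷ ls) = []
strip-positive (suc l ∷ ls) = s≤s z≤n ∷ strip-positive ls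

strip-first : ∀ ls → first (strip ls) ≤ first ls
strip-first []           = z≤n
strip-first (zero  ∷ ls) = z≤n
strip-first (suc l ∷ ls) = ≤-refl

strip-Desc : ∀ {ls} → Desc ls → Desc (strip ls)
strip-Desc []                        = []
strip-Desc {zero  ∷ ls} (f≤ ∷ d) = []
strip-Desc {suc l ∷ ls} (f≤ ∷ d) = ≤-trans (strip-first ls) f≤ ∷ strip-Desc d

zeros-Desc : ∀ {ls} → first ls ≤ 0 → Desc ls → ls ≡ replicate (length ls) 0
zeros-Desc {[]}     _   d        = refl
zeros-Desc {_ ∷ ls} z≤n (f≤ ∷ d) = cong (0 ∷_) (zeros-Desc f≤ d)

strip-pad : ∀ {ls} → Desc ls → ls ≡ strip ls ++ replicate (length ls ∸ length (strip ls)) 0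
strip-pad []                           = refl
strip-pad {zero  ∷ ls} d            = zeros-Desc z≤n d
strip-pad {suc l ∷ ls} (_ ∷ d)      = cong (suc l ∷_) (strip-pad d)

strip-++ : ∀ {ls} m → All (1 ≤_) ls → strip (ls ++ replicate m 0) ≡ ls
strip-++ zero    []           = refl
strip-++ (suc m) []           = refl
strip-++ m       (s≤s _ ∷ ps) = cong (_ ∷_) (strip-++ m ps)

sum-replicate-0 : ∀ m → sum (replicate m 0) ≡ 0
sum-replicate-0 zero    = refl
sum-replicate-0 (suc m) = sum-replicate-0 m

sum-pad : ∀ ls m → sum (ls ++ replicate m 0) ≡ sum ls
sum-pad ls m = trans (sum-++ ls (replicate m 0)) (trans (cong (λ k → sum ls + k) (sum-replicate-0 m)) (+-identityʳ _))

Desc-pad : ∀ {ls} m → Desc ls → Desc (ls ++ replicate m 0)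
Desc-pad zero    []       = []
Desc-pad (suc m) []       = first-0 m ∷ Desc-pad m []
  where
  first-0 : ∀ m → first (replicate m 0) ≤ 0
  first-0 zero    = z≤n
  first-0 (suc m) = z≤n
Desc-pad {l ∷ []}     zero    (f≤ ∷ d) = z≤n ∷ []
Desc-pad {l ∷ []}     (suc m) (f≤ ∷ d) = z≤n ∷ Desc-pad (suc m) []
Desc-pad {l ∷ _ ∷ ls} m       (f≤ ∷ d) = f≤ ∷ Desc-pad m d

addEmptyRows : ℕ → Tableau → Tableau
addEmptyRows m t = t ++ replicate m []

fillings-pad : ∀ n ls m → fillings n (ls ++ replicate m 0) ≡ map (addEmptyRows m) (fillings n ls)
fillings-pad n []       zero    = refl
fillings-pad n []       (suc m) = cong (λ ts → concatMap (λ r → map (r ∷_) ts) ([] ∷ [])) (fillings-pad n [] m)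
fillings-pad n (l ∷ ls) m rewrite fillings-pad n ls m = go (listsOfLength l (oneTo n))
  where
  go : ∀ rs → concatMap (λ r → map (r ∷_) (map (addEmptyRows m) (fillings n ls))) rs
            ≡ map (addEmptyRows m) (concatMap (λ r → map (r ∷_) (fillings n ls)) rs)
  go []       = refl
  go (r ∷ rs) = begin
    map (r ∷_) (map (addEmptyRows m) (fillings n ls)) ++ concatMap (λ r → map (r ∷_) (map (addEmptyRows m) (fillings n ls))) rs
      ≡⟨ cong₂ _++_ (trans (sym (map-∘ (fillings n ls))) (map-∘ (fillings n ls))) (go rs) ⟩
    map (addEmptyRows m) (map (r ∷_) (fillings n ls)) ++ map (addEmptyRows m) (concatMap (λ r → map (r ∷_) (fillings n ls)) rs)
      ≡⟨ map-++ (addEmptyRows m) (map (r ∷_) (fillings n ls)) _ ⟨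
    map (addEmptyRows m) (map (r ∷_) (fillings n ls) ++ concatMap (λ r → map (r ∷_) (fillings n ls)) rs) ∎

countB-map : (p : B → Bool) (f : A → B) (xs : List A) → countB p (map f xs) ≡ countB (p ∘ f) xs
countB-map p f []       = refl
countB-map p f (x ∷ xs) rewrite countB-map p f xs = refl

countB-cong : {p q : A → Bool} (xs : List A) → (∀ x → p x ≡ q x) → countB p xs ≡ countB q xs
countB-cong []       eq = refl
countB-cong (x ∷ xs) eq rewrite eq x | countB-cong xs eq = refl

rows-pad : ∀ m t → all strictlyIncr (addEmptyRows m t) ≡ all strictlyIncr t
rows-pad zero    []      = refl
rows-pad (suc m) []      = rows-pad m []
rows-pad m       (r ∷ t) = cong (strictlyIncr r ∧_) (rows-pad m t)

columns-pad : ∀ m t → colsIncr (addEmptyRows m t) ≡ colsIncr t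
columns-pad zero          []          = refl
columns-pad (suc zero)    []          = refl
columns-pad (suc (suc m)) []          = columns-pad (suc m) []
columns-pad zero          (r ∷ [])    = refl
columns-pad (suc m)       ([] ∷ [])   = columns-pad (suc m) []
columns-pad (suc m)       ((_ ∷ _) ∷ []) = columns-pad (suc m) []
columns-pad m             (r ∷ s ∷ t) = cong (all id (zipWith _<ᵇ_ r s) ∧_) (columns-pad m (s ∷ t))

concat-pad : ∀ m t → concat (addEmptyRows m t) ≡ concat t
concat-pad zero    []      = refl
concat-pad (suc m) []      = concat-pad m []
concat-pad m       (r ∷ t) = cong (r ++_) (concat-pad m t)

isSYT-pad : ∀ n m t → isSYT n (addEmptyRows m t) ≡ isSYT n t
isSYT-pad n m t rewrite concat-pad m t = cong₂ _∧_ (rows-pad m t) (cong (_∧ all (λ k → countB (λ x → x ≡ᵇ k) (concat t) ≡ᵇ 1) (oneTo n)) (columns-pad m t))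

dim-pad : ∀ ls m → dim (ls ++ replicate m 0) ≡ dim ls
dim-pad ls m rewrite sum-pad ls m | fillings-pad (sum ls) ls m =
  trans (countB-map (isSYT (sum ls)) (addEmptyRows m) (fillings (sum ls) ls)) (countB-cong (fillings (sum ls) ls) (isSYT-pad (sum ls) m))

-- A row has as many later falses as its length, so `l ∸ m` of the `l` remaining falses precede it.
toWord : ℕ → List ℕ → Word
toWord l []       = replicate l false
toWord l (m ∷ ls) = replicate (l ∸ m) false ++ true ∷ toWord m ls

zeros-replicate : ∀ d w → zeros (replicate d false ++ w) ≡ d + zeros w
zeros-replicate zero    w = refl
zeros-replicate (suc d) w = cong suc (zeros-replicate d w)

parts-replicate : ∀ d w → parts (replicate d false ++ w) ≡ parts w
parts-replicate zero    w = refl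
parts-replicate (suc d) w = parts-replicate d w

zeros-toWord : ∀ l {ls} → first ls ≤ l → Desc ls → zeros (toWord l ls) ≡ l
zeros-toWord l {[]} _ [] = trans (cong zeros (sym (++-identityʳ (replicate l false)))) (trans (zeros-replicate l []) (+-identityʳ l))
zeros-toWord l {m ∷ ls} m≤l (f≤ ∷ d)
  rewrite zeros-replicate (l ∸ m) (true ∷ toWord m ls) | zeros-toWord m f≤ d = m∸n+n≡m m≤l

parts-toWord : ∀ l {ls} → first ls ≤ l → Desc ls → parts (toWord l ls) ≡ ls
parts-toWord l {[]} _ [] = trans (cong parts (sym (++-identityʳ (replicate l false)))) (parts-replicate l [])
parts-toWord l {m ∷ ls} m≤l (f≤ ∷ d)
  rewrite parts-replicate (l ∸ m) (true ∷ toWord m ls) | zeros-toWord m f≤ d = cong (m ∷_) (parts-toWord m f≤ d)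

parts-injective : ∀ u v → length u ≡ length v → parts u ≡ parts v → u ≡ v
parts-injective []          []          _  _   = refl
parts-injective (true ∷ u)  (true ∷ v)  eq eq′ = cong (true ∷_) (parts-injective u v (suc-injective eq) (∷-injectiveʳ eq′))
parts-injective (false ∷ u) (false ∷ v) eq eq′ = cong (false ∷_) (parts-injective u v (suc-injective eq) eq′)
parts-injective (true ∷ u)  (false ∷ v) eq eq′ = ⊥-elim (parts-distinct u v (suc-injective eq) eq′)
  where
  -- With these parts `v` would have one `true` more than `u` and at least as many falses, so it
  -- would be longer.
  parts-distinct : ∀ u v → length u ≡ length v → zeros u ∷ parts u ≢ parts v
  parts-distinct u v eq eq′ = <⇒≢ (subst₂ _<_ (zeros+parts u)
    (trans (cong (λ ls → zeros v + length ls) eq′) (zeros+parts v))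
    (+-mono-≤-< (subst (_≤ zeros v) (cong first (sym eq′)) (first-parts v)) (n<1+n (length (parts u))))) eq
parts-injective (false ∷ u) (true ∷ v)  eq eq′ = sym (parts-injective (true ∷ v) (false ∷ u) (sym eq) (sym eq′))

words : ℕ → List Word
words zero    = [] ∷ []
words (suc n) = map (true ∷_) (words n) ++ map (false ∷_) (words n)

words-unique : ∀ n → Unique (words n)
words-unique zero    = [] ∷ []
words-unique (suc n) = Unique.++⁺ (Unique.map⁺ ∷-injectiveʳ (words-unique n)) (Unique.map⁺ ∷-injectiveʳ (words-unique n)) disjoint
  where
  disjoint : ∀ {w} → ¬ (w ∈ map (true ∷_) (words n) × w ∈ map (false ∷_) (words n))
  disjoint (p , q) with ∈-map⁻ (true ∷_) p | ∈-map⁻ (false ∷_) q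
  ... | _ , _ , refl | _ , _ , ()

∈-words⁺ : ∀ w → w ∈ words (length w)
∈-words⁺ []          = here refl
∈-words⁺ (true  ∷ w) = ∈-++⁺ˡ (∈-map⁺ (true ∷_) (∈-words⁺ w))
∈-words⁺ (false ∷ w) = ∈-++⁺ʳ (map (true ∷_) (words (length w))) (∈-map⁺ (false ∷_) (∈-words⁺ w))

∈-words⁻ : ∀ n {w} → w ∈ words n → length w ≡ n
∈-words⁻ zero    (here refl) = refl
∈-words⁻ (suc n) w∈ with ∈-++⁻ (map (true ∷_) (words n)) w∈
... | inj₁ p with ∈-map⁻ (true ∷_) p
...   | _ , u∈ , refl = cong suc (∈-words⁻ n u∈)
∈-words⁻ (suc n) w∈ | inj₂ p with ∈-map⁻ (false ∷_) p
...   | _ , u∈ , refl = cong suc (∈-words⁻ n u∈)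

inBox : (ℕ → Bool) → ℕ → ℕ → Word → Bool
inBox q n k w = (ones w ≡ᵇ k) ∧ ((size w ≡ᵇ n) ∧ q (dim (parts w)))

-- A box with at least n rows and n columns holds every partition of n, each through exactly one
-- word. The sides are independent because a nonempty core makes the boxes of the quotient m by m +
-- 2.
count-Partitions : ∀ q {n k l} → n ≤ k → n ≤ l → countB (q ∘ dim) (Partitions n) ≡ countB (inBox q n k) (words (k + l))
count-Partitions q {n} {k} {l} n≤k n≤l = begin
  countB (q ∘ dim) (Partitions n)        ≡⟨ countB≡length-filter (q ∘ dim) (Partitions n) ⟩
  length (filter P? (Partitions n))      ≡⟨ length-bijection (strip ∘ parts) (Unique.filter⁺ W? (words-unique (k + l)))
                                              (Unique.filter⁺ P? (Partitions-unique n)) into injective onto ⟨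
  length (filter W? (words (k + l)))     ≡⟨ countB≡length-filter (inBox q n k) (words (k + l)) ⟨
  countB (inBox q n k) (words (k + l))   ∎
  where
  P? = λ ls → T? (q (dim ls))
  W? = λ w → T? (inBox q n k w)
  spec : ∀ {w} → w ∈ filter W? (words (k + l)) → length w ≡ k + l × ones w ≡ k × size w ≡ n × T (q (dim (parts w)))
  spec {w} w∈ = let w∈′ , t = ∈-filter⁻ W? {xs = words (k + l)} w∈ ; a , bc = to T-∧ t ; b , c = to T-∧ bc in
    ∈-words⁻ (k + l) w∈′ , ≡ᵇ⇒≡ _ _ a , ≡ᵇ⇒≡ _ _ b , c
  pad : ∀ w → parts w ≡ strip (parts w) ++ replicate (ones w ∸ length (strip (parts w))) 0
  pad w = trans (strip-pad (parts-Desc w)) (cong (λ k → strip (parts w) ++ replicate (k ∸ length (strip (parts w))) 0) (length-parts w))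
  into : ∀ {w} → w ∈ filter W? (words (k + l)) → strip (parts w) ∈ filter P? (Partitions n)
  into {w} w∈ = let _ , _ , b , c = spec w∈ in ∈-filter⁺ P?
    (∈-Partitions⁺ record
      { positive = strip-positive (parts w) ; decreasing = strip-Desc (parts-Desc w)
      ; sums-to = trans (sym (trans (cong sum (pad w)) (sum-pad (strip (parts w)) _))) b })
    (subst (T ∘ q) (trans (cong dim (pad w)) (dim-pad (strip (parts w)) _)) c)
  injective : ∀ {u v} → u ∈ filter W? (words (k + l)) → v ∈ filter W? (words (k + l)) → strip (parts u) ≡ strip (parts v) → u ≡ v
  injective {u} {v} u∈ v∈ eq = let lu , ku , _ = spec u∈ ; lv , kv , _ = spec v∈ in
    parts-injective u v (trans lu (sym lv)) (trans (pad u)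
      (trans (cong₂ (λ ls m → ls ++ replicate (m ∸ length ls) 0) eq (trans ku (sym kv))) (sym (pad v))))
  onto : ∀ {ls} → ls ∈ filter P? (Partitions n) → ∃ λ w → w ∈ filter W? (words (k + l)) × ls ≡ strip (parts w)
  onto {ls} ls∈ with ∈-filter⁻ P? {xs = Partitions n} ls∈
  ... | ls∈′ , t = w , ∈-filter⁺ W? (subst (λ m → w ∈ words m) length-w (∈-words⁺ w))
          (from T-∧ (≡⇒≡ᵇ _ _ ones-w , from T-∧ (≡⇒≡ᵇ _ _ size-w , subst (T ∘ q) (sym (trans (cong dim parts-w) (dim-pad ls _))) t)))
        , trans (sym (strip-++ (k ∸ length ls) (positive p))) (cong strip (sym parts-w))
    where
    p = ∈-Partitions⁻ {n} ls∈′
    μ = ls ++ replicate (k ∸ length ls) 0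
    w = toWord l μ
    μ-Desc : Desc μ
    μ-Desc = Desc-pad (k ∸ length ls) (decreasing p)
    μ-first : first μ ≤ l
    μ-first = ≤-trans (first≤sum μ) (≤-trans (≤-reflexive (trans (sum-pad ls (k ∸ length ls)) (sums-to p))) n≤l)
      where
      first≤sum : ∀ ls → first ls ≤ sum ls
      first≤sum []       = z≤n
      first≤sum (l ∷ ls) = m≤m+n l (sum ls)
    parts-w : parts w ≡ μ
    parts-w = parts-toWord l μ-first μ-Desc
    ones-w : ones w ≡ k
    ones-w = begin
      ones w                        ≡⟨ length-parts w ⟨
      length (parts w)              ≡⟨ cong length parts-w ⟩
      length μ                      ≡⟨ length-++ ls ⟩
      length ls + length (replicate (k ∸ length ls) 0) ≡⟨ cong (λ m → length ls + m) (length-replicate (k ∸ length ls)) ⟩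
      length ls + (k ∸ length ls)   ≡⟨ m+[n∸m]≡n (≤-trans (subst (length ls ≤_) (sums-to p) (length-≤-sum (positive p))) n≤k) ⟩
      k                             ∎
    length-w : length w ≡ k + l
    length-w = trans (sym (ones+zeros w)) (cong₂ _+_ ones-w (zeros-toWord l μ-first μ-Desc))
    size-w : size w ≡ n
    size-w = trans (cong sum parts-w) (trans (sum-pad ls (k ∸ length ls)) (sums-to p))

-- Counting words

δ : ℕ → ℕ → ℕ
δ zero    zero    = 1
δ zero    (suc n) = 0
δ (suc m) zero    = 0
δ (suc m) (suc n) = δ m n

δ-refl : ∀ n → δ n n ≡ 1
δ-refl zero    = refl
δ-refl (suc n) = δ-refl n

δ-≢ : ∀ {m n} → m ≢ n → δ m n ≡ 0
δ-≢ {zero}  {zero}  m≢n = ⊥-elim (m≢n refl)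
δ-≢ {zero}  {suc n} m≢n = refl
δ-≢ {suc m} {zero}  m≢n = refl
δ-≢ {suc m} {suc n} m≢n = δ-≢ (m≢n ∘ cong suc)

𝟙 : Bool → ℕ
𝟙 b = if b then 1 else 0

𝟙-≡ᵇ : ∀ m n → 𝟙 (m ≡ᵇ n) ≡ δ n m
𝟙-≡ᵇ zero    zero    = refl
𝟙-≡ᵇ zero    (suc n) = refl
𝟙-≡ᵇ (suc m) zero    = refl
𝟙-≡ᵇ (suc m) (suc n) = 𝟙-≡ᵇ m n

𝟙-∧ : ∀ a b → 𝟙 (a ∧ b) ≡ 𝟙 a * 𝟙 b
𝟙-∧ true  b = sym (+-identityʳ _)
𝟙-∧ false b = refl

Σ< : ℕ → (ℕ → ℕ) → ℕ
Σ< zero    f = 0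
Σ< (suc n) f = f 0 + Σ< n (f ∘ suc)

Σ<-cong : ∀ n {f g : ℕ → ℕ} → (∀ i → i < n → f i ≡ g i) → Σ< n f ≡ Σ< n g
Σ<-cong zero    eq = refl
Σ<-cong (suc n) eq = cong₂ _+_ (eq 0 z<s) (Σ<-cong n (λ i i<n → eq (suc i) (s≤s i<n)))

Σ<-zero : ∀ n → Σ< n (λ _ → 0) ≡ 0
Σ<-zero zero    = refl
Σ<-zero (suc n) = Σ<-zero n

ΣWord : ℕ → (Word → ℕ) → ℕ
ΣWord zero    f = f []
ΣWord (suc n) f = ΣWord n (f ∘ (true ∷_)) + ΣWord n (f ∘ (false ∷_))

ΣWord-cong : ∀ n {f g : Word → ℕ} → (∀ w → length w ≡ n → f w ≡ g w) → ΣWord n f ≡ ΣWord n g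
ΣWord-cong zero    eq = eq [] refl
ΣWord-cong (suc n) eq = cong₂ _+_ (ΣWord-cong n (λ w l → eq (true ∷ w) (cong suc l))) (ΣWord-cong n (λ w l → eq (false ∷ w) (cong suc l)))

interchange : ∀ a b c d → (a + b) + (c + d) ≡ (a + c) + (b + d)
interchange = solveℕ

ΣWord-+ : ∀ n (f g : Word → ℕ) → ΣWord n (λ w → f w + g w) ≡ ΣWord n f + ΣWord n g
ΣWord-+ zero    f g = refl
ΣWord-+ (suc n) f g = trans (cong₂ _+_ (ΣWord-+ n (f ∘ (true ∷_)) (g ∘ (true ∷_))) (ΣWord-+ n (f ∘ (false ∷_)) (g ∘ (false ∷_))))
  (interchange (ΣWord n (f ∘ (true ∷_))) _ _ _)

ΣWord-zero : ∀ n → ΣWord n (λ _ → 0) ≡ 0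
ΣWord-zero zero    = refl
ΣWord-zero (suc n) = cong₂ _+_ (ΣWord-zero n) (ΣWord-zero n)

ΣWord-*ˡ : ∀ n c (f : Word → ℕ) → ΣWord n (λ w → c * f w) ≡ c * ΣWord n f
ΣWord-*ˡ zero    c f = refl
ΣWord-*ˡ (suc n) c f = trans (cong₂ _+_ (ΣWord-*ˡ n c _) (ΣWord-*ˡ n c _)) (sym (*-distribˡ-+ c _ _))

ΣWord-*ʳ : ∀ n c (f : Word → ℕ) → ΣWord n (λ w → f w * c) ≡ ΣWord n f * c
ΣWord-*ʳ n c f = trans (ΣWord-cong n (λ w _ → *-comm (f w) c)) (trans (ΣWord-*ˡ n c f) (*-comm c _))

ΣWord-Σ< : ∀ n m (f : ℕ → Word → ℕ) → ΣWord n (λ w → Σ< m (λ i → f i w)) ≡ Σ< m (λ i → ΣWord n (f i))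
ΣWord-Σ< n zero    f = ΣWord-zero n
ΣWord-Σ< n (suc m) f = trans (ΣWord-+ n (f 0) _) (cong (λ k → ΣWord n (f 0) + k) (ΣWord-Σ< n m (f ∘ suc)))

ΣWord-interleave : ∀ n (f : Word → ℕ) → ΣWord (n * 2) f ≡ ΣWord n (λ u → ΣWord n (λ v → f (interleave u v)))
ΣWord-interleave zero    f = refl
ΣWord-interleave (suc n) f = cong₂ _+_ (half true) (half false)
  where
  half : ∀ a → ΣWord (n * 2) (λ w → f (a ∷ true ∷ w)) + ΣWord (n * 2) (λ w → f (a ∷ false ∷ w))
    ≡ ΣWord n (λ u → ΣWord n (λ v → f (a ∷ true ∷ interleave u v)) + ΣWord n (λ v → f (a ∷ false ∷ interleave u v)))
  half a = trans (cong₂ _+_ (ΣWord-interleave n _) (ΣWord-interleave n _)) (sym (ΣWord-+ n _ _))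

countB-words : ∀ n (p : Word → Bool) → countB p (words n) ≡ ΣWord n (𝟙 ∘ p)
countB-words zero    p with p []
... | true  = refl
... | false = refl
countB-words (suc n) p = trans (countB-++ p (map (true ∷_) (words n)) (map (false ∷_) (words n)))
  (cong₂ _+_ (trans (countB-map p (true ∷_) (words n)) (countB-words n _)) (trans (countB-map p (false ∷_) (words n)) (countB-words n _)))

censusTerm : ℕ → ℕ → ℕ → Word → ℕ
censusTerm j k n w = δ k (ones w) * (δ n (size w) * δ j (dimValuation w))

-- Here `n` is the length of the words and `s` their size, whereas the third argument of
-- `censusTerm` is the size.
census : ℕ → ℕ → ℕ → ℕ → ℕ
census j k n s = ΣWord n (censusTerm j k s)

count-Partitions′ : ∀ q {n k l} → n ≤ k → n ≤ l →
  countB (q ∘ dim) (Partitions n) ≡ ΣWord (k + l) (λ w → δ k (ones w) * (δ n (size w) * 𝟙 (q (dim (parts w)))))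
count-Partitions′ q {n} {k} {l} n≤k n≤l = trans (count-Partitions q n≤k n≤l) (trans (countB-words (k + l) (inBox q n k))
  (ΣWord-cong (k + l) (λ w _ → trans (𝟙-∧ (ones w ≡ᵇ k) _) (cong₂ _*_ (𝟙-≡ᵇ (ones w) k)
    (trans (𝟙-∧ (size w ≡ᵇ n) _) (cong (_* 𝟙 (q (dim (parts w)))) (𝟙-≡ᵇ (size w) n)))))))

mod4 : ∀ c r → (c + r * 2 * 2) % 4 ≡ c % 4
mod4 c r = trans (cong (λ k → (c + k) % 4) (*-assoc r 2 2)) ([m+kn]%n≡m%n c r 4)

v₂-even-pos : ∀ {m} → 0 < m * 2 → v₂ (m * 2) ≡ suc (v₂ m)
v₂-even-pos {suc m} _ = v₂-double {suc m} z<s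

half-pos : ∀ {m} → 0 < m * 2 → 0 < m
half-pos {suc m} _ = z<s

𝟙-mod4≡2 : ∀ {x} → 0 < x → 𝟙 (x % 4 ≡ᵇ 2) ≡ δ 1 (v₂ x)
𝟙-mod4≡2 {x} x>0 with evenOrOdd x
𝟙-mod4≡2 x>0 | odd m rewrite v₂-odd m with evenOrOdd m
... | even r = cong (λ k → 𝟙 (k ≡ᵇ 2)) (mod4 1 r)
... | odd  r = cong (λ k → 𝟙 (k ≡ᵇ 2)) (mod4 3 r)
𝟙-mod4≡2 x>0 | even m rewrite v₂-even-pos {m} x>0 with evenOrOdd m
... | odd  r = trans (cong (λ k → 𝟙 (k ≡ᵇ 2)) (mod4 2 r)) (cong (δ 0) (sym (v₂-odd r)))
... | even r = trans (cong (λ k → 𝟙 (k ≡ᵇ 2)) (mod4 0 r)) (cong (δ 0) (sym (v₂-even-pos {r} (half-pos x>0))))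

𝟙-mod4-odd : ∀ {x} → 0 < x → 𝟙 (x % 4 ≡ᵇ 1) + 𝟙 (x % 4 ≡ᵇ 3) ≡ δ 0 (v₂ x)
𝟙-mod4-odd {x} x>0 with evenOrOdd x
𝟙-mod4-odd x>0 | odd m rewrite v₂-odd m with evenOrOdd m
... | even r = cong (λ k → 𝟙 (k ≡ᵇ 1) + 𝟙 (k ≡ᵇ 3)) (mod4 1 r)
... | odd  r = cong (λ k → 𝟙 (k ≡ᵇ 1) + 𝟙 (k ≡ᵇ 3)) (mod4 3 r)
𝟙-mod4-odd x>0 | even m rewrite v₂-even-pos {m} x>0 with evenOrOdd m
... | odd  r = cong (λ k → 𝟙 (k ≡ᵇ 1) + 𝟙 (k ≡ᵇ 3)) (mod4 2 r)
... | even r = cong (λ k → 𝟙 (k ≡ᵇ 1) + 𝟙 (k ≡ᵇ 3)) (mod4 0 r)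

aMod4-2≡census : ∀ {n k l} → n ≤ k → n ≤ l → aMod4 2 n ≡ census 1 k (k + l) n
aMod4-2≡census {n} {k} {l} n≤k n≤l = trans (count-Partitions′ (λ x → x % 4 ≡ᵇ 2) n≤k n≤l)
  (ΣWord-cong (k + l) (λ w _ → cong (λ x → δ k (ones w) * (δ n (size w) * x)) (trans (𝟙-mod4≡2 (dim-pos w)) (cong (δ 1) (sym (dimValuation-def w))))))

aOdd≡census : ∀ {n k l} → n ≤ k → n ≤ l → aOdd n ≡ census 0 k (k + l) n
aOdd≡census {n} {k} {l} n≤k n≤l =
  trans (cong₂ _+_ (count-Partitions′ (λ x → x % 4 ≡ᵇ 1) n≤k n≤l) (count-Partitions′ (λ x → x % 4 ≡ᵇ 3) n≤k n≤l))
  (trans (sym (ΣWord-+ (k + l) _ _)) (ΣWord-cong (k + l) (λ w _ →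
    trans (ring (δ k (ones w)) (δ n (size w)) _ _) (cong (λ x → δ k (ones w) * (δ n (size w) * x)) (trans (𝟙-mod4-odd (dim-pos w)) (cong (δ 0) (sym (dimValuation-def w))))))))
  where
  ring : ∀ a b c d → a * (b * c) + a * (b * d) ≡ a * (b * (c + d))
  ring = solveℕ

-- The 2-core of a word, read off from the numbers of ones in its two halves; only cores of size 0, 1, 3 matter.
data Core (u v : Word) (k : ℕ) : Set where
  core₀ : ones u ≡ k → ones v ≡ k → size (interleave u v) ≡ (size u + size v) * 2 → Core u v k
  core₁ : suc (ones u) ≡ k → ones v ≡ suc k → size (interleave u v) ≡ suc ((size u + size v) * 2) → Core u v k
  core₃ : ones u ≡ suc k → suc (ones v) ≡ k → size (interleave u v) ≡ suc (suc (size u + size v) * 2) → Core u v k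
  core₆ : ones u ≢ k → suc (ones u) ≢ k → ones u ≢ suc k → (x : ℕ) →
          size (interleave u v) ≡ (3 + (size u + size v)) * 2 + x → Core u v k

-- With t the distance of `ones u` from `k`, the core has size 2t² - t if `ones u` is smaller and
-- 2t² + t if it is larger: the triangular numbers 0; 1, 6, 15, ... and 3, 10, ....
core : ∀ u v k → length u ≡ length v → ones u + ones v ≡ k * 2 → Core u v k
core u v k eq sum≡ with ≤-total (ones u) k
... | inj₁ p≤k with m≤n⇒∃[o]m+o≡n p≤k
...   | t , refl = rightward t q≡ size≡
  where
  p = ones u
  q≡ : ones v ≡ p + t + t
  q≡ = +-cancelˡ-≡ p _ _ (trans sum≡ (ring p t))
    where
    ring : ∀ p t → (p + t) * 2 ≡ p + (p + t + t)
    ring = solveℕ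
  size≡ : size (interleave u v) + t ≡ (size u + size v) * 2 + 2 * (t * t)
  size≡ = *-cancelˡ-≡ _ _ 2 (+-cancelʳ-≡ (2 * (p * p) + 4 * (p * t) + p) _ _
    (trans (trans (ring₁ (size (interleave u v)) p t) (cong (λ q → 2 * size (interleave u v) + 2 * (p * q) + q) (sym q≡)))
      (trans (size-interleave u v eq) (trans (cong (λ q → 4 * (size u + size v) + p * p + q * q + p) q≡) (ring₂ (size u + size v) p t)))))
    where
    ring₁ : ∀ s p t → 2 * (s + t) + (2 * (p * p) + 4 * (p * t) + p) ≡ 2 * s + 2 * (p * (p + t + t)) + (p + t + t)
    ring₁ = solveℕ
    ring₂ : ∀ i p t → 4 * i + p * p + (p + t + t) * (p + t + t) + p ≡ 2 * (i * 2 + 2 * (t * t)) + (2 * (p * p) + 4 * (p * t) + p)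
    ring₂ = solveℕ
  rightward : ∀ t → ones v ≡ p + t + t → size (interleave u v) + t ≡ (size u + size v) * 2 + 2 * (t * t) → Core u v (p + t)
  rightward 0 q≡ s≡ = core₀ (sym (+-identityʳ p)) (trans q≡ (+-identityʳ (p + 0))) (trans (sym (+-identityʳ _)) (trans s≡ (+-identityʳ _)))
  rightward 1 q≡ s≡ = core₁ (+-comm 1 p) (trans q≡ (+-comm (p + 1) 1)) (+-cancelʳ-≡ 1 _ _ (trans s≡ (ring (size u + size v))))
    where
    ring : ∀ i → i * 2 + 2 ≡ suc (i * 2) + 1
    ring = solveℕ
  -- The witness is the excess of 2(t + 2)² - (t + 2) over 6.
  rightward (suc (suc t)) q≡ s≡ = core₆ (m≢1+m+n p ∘ flip₁) (m≢1+m+n (suc p) ∘ flip₂) (m≢1+m+n p)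
    (7 * t + 2 * (t * t)) (+-cancelʳ-≡ (suc (suc t)) _ _ (trans s≡ (ring (size u + size v) t)))
    where
    flip₁ : p ≡ p + suc (suc t) → p ≡ suc (p + suc t)
    flip₁ e = trans e (+-suc p (suc t))
    flip₂ : suc p ≡ p + suc (suc t) → suc p ≡ suc (suc p + t)
    flip₂ e = trans e (trans (+-suc p (suc t)) (cong suc (+-suc p t)))
    ring : ∀ i t → i * 2 + 2 * (suc (suc t) * suc (suc t)) ≡ (3 + i) * 2 + (7 * t + 2 * (t * t)) + suc (suc t)
    ring = solveℕ
core u v k eq sum≡ | inj₂ k≤p with m≤n⇒∃[o]m+o≡n k≤p
... | t , k+t≡p = leftward t q+t≡k k+t≡p (trans size≡ (+-assoc ((size u + size v) * 2) (2 * (t * t)) t))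
  where
  q = ones v
  q+t≡k : q + t ≡ k
  q+t≡k = +-cancelˡ-≡ k (q + t) k (trans (ring₁ k q t) (trans (cong (_+ q) k+t≡p) (trans sum≡ (ring₂ k))))
    where
    ring₁ : ∀ k q t → k + (q + t) ≡ k + t + q
    ring₁ = solveℕ
    ring₂ : ∀ k → k * 2 ≡ k + k
    ring₂ = solveℕ
  p≡ : q + t + t ≡ ones u
  p≡ = trans (cong (_+ t) q+t≡k) k+t≡p
  size≡ : size (interleave u v) ≡ (size u + size v) * 2 + 2 * (t * t) + t
  size≡ = *-cancelˡ-≡ _ _ 2 (+-cancelʳ-≡ (2 * (q * q) + 4 * (q * t) + q) _ _
    (trans (trans (ring₁ (size (interleave u v)) q t) (cong (λ p → 2 * size (interleave u v) + 2 * (p * q) + q) p≡))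
      (trans (size-interleave u v eq) (trans (cong (λ p → 4 * (size u + size v) + p * p + q * q + p) (sym p≡)) (ring₂ (size u + size v) q t)))))
    where
    ring₁ : ∀ s q t → 2 * s + (2 * (q * q) + 4 * (q * t) + q) ≡ 2 * s + 2 * ((q + t + t) * q) + q
    ring₁ = solveℕ
    ring₂ : ∀ i q t → 4 * i + (q + t + t) * (q + t + t) + q * q + (q + t + t) ≡ 2 * (i * 2 + 2 * (t * t) + t) + (2 * (q * q) + 4 * (q * t) + q)
    ring₂ = solveℕ
  leftward : ∀ t → q + t ≡ k → k + t ≡ ones u → size (interleave u v) ≡ (size u + size v) * 2 + (2 * (t * t) + t) → Core u v k
  leftward 0 e f s≡ = core₀ (trans (sym f) (+-identityʳ k)) (trans (sym (+-identityʳ q)) e) (trans s≡ (+-identityʳ _))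
  leftward 1 e f s≡ = core₃ (trans (sym f) (+-comm k 1)) (trans (+-comm 1 q) e) (trans s≡ (ring (size u + size v)))
    where
    ring : ∀ i → i * 2 + 3 ≡ suc (suc i * 2)
    ring = solveℕ
  -- The witness is the excess of 2(t + 2)² + (t + 2) over 6.
  leftward (suc (suc t)) e f s≡ = core₆
    (λ g → m+1+n≢m k (trans f g))
    (λ g → m+1+n≢m k {suc (suc t)} (trans (+-suc k (suc (suc t))) (trans (cong suc f) g)))
    (λ g → m+1+n≢m k {t} (suc-injective (trans (sym (+-suc k (suc t))) (trans f g))))
    (4 + 9 * t + 2 * (t * t)) (trans s≡ (ring (size u + size v) t))
    where
    ring : ∀ i t → i * 2 + (2 * (suc (suc t) * suc (suc t)) + suc (suc t)) ≡ (3 + i) * 2 + (4 + 9 * t + 2 * (t * t))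
    ring = solveℕ

-- The valuation of (s + a + b)! / (a! b!); for s = 0 this is the number of carries in the binary
-- addition of a and b, by Kummer. The subtraction never truncates, by `carry+`.
carry : ℕ → ℕ → ℕ → ℕ
carry s a b = v₂! (s + (a + b)) ∸ (v₂! a + v₂! b)

carry+ : ∀ s a b → carry s a b + (v₂! a + v₂! b) ≡ v₂! (s + (a + b))
carry+ s a b = m∸n+n≡m (≤-trans (v₂!-superadditive a b) (v₂!-mono (m≤n+m (a + b) s)))

-- `s` stands for ⌊|core|/2⌋. With M = s + |μ| + |ν| the partition has size 2M or 2M + 1, and either
-- way its factorial has valuation M + v₂(M!). Subtracting the hooks cancels |μ| + |ν| out of M and
-- leaves `s`.
dimValuation-interleave : ∀ s u v → length u ≡ length v →
  v₂! (size (interleave u v)) ≡ (s + (size u + size v)) + v₂! (s + (size u + size v)) →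
  dimValuation (interleave u v) ≡ s + (carry s (size u) (size v) + (dimValuation u + dimValuation v))
dimValuation-interleave s u v eq val = +-cancelʳ-≡ (hookValuation (interleave u v)) _ _ (begin
  dimValuation (interleave u v) + hookValuation (interleave u v)
    ≡⟨ dimValuation+hookValuation (interleave u v) ⟩
  v₂! (size (interleave u v))
    ≡⟨ val ⟩
  (s + (i + j)) + v₂! (s + (i + j))
    ≡⟨ cong (λ k → s + (i + j) + k) (carry+ s i j) ⟨
  (s + (i + j)) + (c + (v₂! i + v₂! j))
    ≡⟨ cong₂ (λ a b → (s + (i + j)) + (c + (a + b))) (dimValuation+hookValuation u) (dimValuation+hookValuation v) ⟨
  (s + (i + j)) + (c + ((d + h) + (e + k)))
    ≡⟨ ring s i j c d h e k ⟩
  s + (c + (d + e)) + ((i + h) + (j + k))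
    ≡⟨ cong (λ z → s + (c + (d + e)) + z) (hookValuation-interleave u v eq) ⟨
  s + (c + (d + e)) + hookValuation (interleave u v) ∎)
  where
  i = size u
  j = size v
  c = carry s i j
  d = dimValuation u
  e = dimValuation v
  h = hookValuation u
  k = hookValuation v
  ring : ∀ s i j c d h e k → (s + (i + j)) + (c + ((d + h) + (e + k))) ≡ s + (c + (d + e)) + ((i + h) + (j + k))
  ring = solveℕ

hookValuation≤ : ∀ w → hookValuation w ≤ v₂! (size w)
hookValuation≤ w = subst (hookValuation w ≤_) (dimValuation+hookValuation w) (m≤n+m _ (dimValuation w))

-- A core of size at least 6 puts at least 3 + |μ| + |ν| doubled factors into n!, while the even
-- hooks use up only |μ| + |ν| of them; what is left of the hooks is bounded by |μ|! |ν|!. A lower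
-- bound is enough to exclude valuations 0 and 1.
dimValuation-far : ∀ u v x → length u ≡ length v →
  size (interleave u v) ≡ (3 + (size u + size v)) * 2 + x → 3 ≤ dimValuation (interleave u v)
dimValuation-far u v x eq s≡ = +-cancelʳ-≤ (hookValuation (interleave u v)) 3 _ (subst₂ _≤_ left right
  (≤-trans (+-monoʳ-≤ (3 + (i + j)) (≤-trans (+-mono-≤ (hookValuation≤ u) (hookValuation≤ v))
    (≤-trans (v₂!-superadditive i j) (v₂!-mono (m≤n+m (i + j) 3)))))
  (≤-trans (≤-reflexive (sym (v₂!-even (3 + (i + j))))) (v₂!-mono (m≤m+n _ x)))))
  where
  i = size u
  j = size v
  ring : ∀ i j h k → 3 + (i + j) + (h + k) ≡ 3 + ((i + h) + (j + k))
  ring = solveℕ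
  left : 3 + (i + j) + (hookValuation u + hookValuation v) ≡ 3 + hookValuation (interleave u v)
  left = trans (ring i j (hookValuation u) (hookValuation v)) (cong (λ k → 3 + k) (sym (hookValuation-interleave u v eq)))
  right : v₂! ((3 + (i + j)) * 2 + x) ≡ dimValuation (interleave u v) + hookValuation (interleave u v)
  right = trans (cong v₂! (sym s≡)) (sym (dimValuation+hookValuation (interleave u v)))

-- The contribution of the quotient (u, v) when ⌊|core|/2⌋ = s: `k` and `l` fix the core, `m` is
-- half the size of the partition, rounded down, and `j` is the prescribed valuation.
pairTerm : ℕ → ℕ → ℕ → ℕ → ℕ → Word → Word → ℕ
pairTerm s k l m j u v = δ k (ones u) * (δ l (ones v) * (δ m (s + (size u + size v)) *
  δ j (s + (carry s (size u) (size v) + (dimValuation u + dimValuation v)))))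

pairTerm-zero : ∀ s k l m j u v → ¬ (ones u ≡ k × ones v ≡ l) → pairTerm s k l m j u v ≡ 0
pairTerm-zero s k l m j u v h with ones u ≟ k | ones v ≟ l
... | yes p | yes q = ⊥-elim (h (p , q))
... | no p  | _     = cong (_* _) (δ-≢ (p ∘ sym))
... | yes _ | no q  = trans (cong (λ x → δ k (ones u) * (x * _)) (δ-≢ (q ∘ sym))) (*-zeroʳ (δ k (ones u)))

δ-*2 : ∀ m n → δ (m * 2) (n * 2) ≡ δ m n
δ-*2 zero    zero    = refl
δ-*2 zero    (suc n) = refl
δ-*2 (suc m) zero    = refl
δ-*2 (suc m) (suc n) = δ-*2 m n

δ-far : ∀ {j x} → j ≤ 1 → 3 ≤ x → δ j x ≡ 0
δ-far z≤n       (s≤s _)       = refl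
δ-far (s≤s z≤n) (s≤s (s≤s _)) = refl

censusTerm-no : ∀ j k n u v → length u ≡ length v → ones u + ones v ≢ k → censusTerm j k n (interleave u v) ≡ 0
censusTerm-no j k n u v eq h = cong (_* _) (δ-≢ (λ e → h (sym (trans e (ones-interleave u v eq)))))

censusTerm-far : ∀ {j} k n u v → j ≤ 1 → 3 ≤ dimValuation (interleave u v) → censusTerm j k n (interleave u v) ≡ 0
censusTerm-far {j} k n u v j≤1 far = trans (cong (λ x → δ k _ * (δ n _ * x)) (δ-far j≤1 far))
  (trans (cong (δ k (ones (interleave u v)) *_) (*-zeroʳ (δ n (size (interleave u v))))) (*-zeroʳ (δ k _)))

censusTerm-size : ∀ j k n u v → n ≢ size (interleave u v) → censusTerm j k n (interleave u v) ≡ 0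
censusTerm-size j k n u v h = trans (cong (λ x → δ k _ * (x * _)) (δ-≢ h)) (*-zeroʳ (δ k _))

censusTerm-pair : ∀ s {j k p q n m} u v → length u ≡ length v → ones u ≡ p → ones v ≡ q → p + q ≡ k →
  δ n (size (interleave u v)) ≡ δ m (s + (size u + size v)) →
  v₂! (size (interleave u v)) ≡ (s + (size u + size v)) + v₂! (s + (size u + size v)) →
  censusTerm j k n (interleave u v) ≡ pairTerm s p q m j u v
censusTerm-pair s {j} {k} {p} {q} {n} {m} u v eq p≡ q≡ k≡ δ≡ val = begin
  δ k (ones w) * (δ n (size w) * δ j (dimValuation w))
    ≡⟨ cong₂ _*_ (δ-≡ (trans (ones-interleave u v eq) (trans (cong₂ _+_ p≡ q≡) k≡)))
                 (cong₂ _*_ δ≡ (cong (δ j) (dimValuation-interleave s u v eq val))) ⟩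
  1 * x
    ≡⟨ cong (1 *_) (*-identityˡ x) ⟨
  1 * (1 * x)
    ≡⟨ cong₂ (λ a b → a * (b * x)) (δ-≡ p≡) (δ-≡ q≡) ⟨
  δ p (ones u) * (δ q (ones v) * x) ∎
  where
  w = interleave u v
  x = δ m (s + (size u + size v)) * δ j (s + (carry s (size u) (size v) + (dimValuation u + dimValuation v)))
  δ-≡ : ∀ {a b} → b ≡ a → δ a b ≡ 1
  δ-≡ {a} refl = δ-refl a

-- Parity of the size rules out the cores of size 1 and 3, and the valuation rules out all larger
-- ones, so only the empty core remains.
censusTerm-even : ∀ {j} k m u v → j ≤ 1 → length u ≡ length v →
  censusTerm j (k * 2) (m * 2) (interleave u v) ≡ pairTerm 0 k k m j u v
censusTerm-even {j} k m u v j≤1 eq with ones u + ones v ≟ k * 2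
... | no h = trans (censusTerm-no j (k * 2) (m * 2) u v eq h)
  (sym (pairTerm-zero 0 k k m j u v λ (p , q) → h (trans (cong₂ _+_ p q) (ring k))))
  where
  ring : ∀ k → k + k ≡ k * 2
  ring = solveℕ
... | yes h with core u v k eq h
...   | core₀ p q s≡ = censusTerm-pair 0 {j} {n = m * 2} {m} u v eq p q (ring k) (trans (cong (δ (m * 2)) s≡) (δ-*2 m (size u + size v))) (trans (cong v₂! s≡) (v₂!-even (size u + size v)))
  where
  ring : ∀ k → k + k ≡ k * 2
  ring = solveℕ
...   | core₁ p _ s≡ = trans (censusTerm-size j (k * 2) (m * 2) u v (λ e → double≢odd m (size u + size v) (trans e s≡)))
  (sym (pairTerm-zero 0 k k m j u v λ (p′ , _) → 1+n≢n (trans p (sym p′))))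
...   | core₃ p _ s≡ = trans (censusTerm-size j (k * 2) (m * 2) u v (λ e → double≢odd m (suc (size u + size v)) (trans e s≡)))
  (sym (pairTerm-zero 0 k k m j u v λ (p′ , _) → 1+n≢n (trans (sym p) p′)))
...   | core₆ p _ _ x s≡ = trans (censusTerm-far (k * 2) (m * 2) u v j≤1 (dimValuation-far u v x eq s≡))
  (sym (pairTerm-zero 0 k k m j u v λ (p′ , _) → p p′))

-- Parity rules out the empty core. The two terms belong to the cores of size 1 and 3, which shift
-- the numbers of trues from k + 1 in opposite directions.
censusTerm-odd : ∀ {j} k m u v → j ≤ 1 → length u ≡ length v →
  censusTerm j (suc k * 2) (suc (m * 2)) (interleave u v) ≡ pairTerm 0 k (2 + k) m j u v + pairTerm 1 (2 + k) k m j u v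
censusTerm-odd {j} k m u v j≤1 eq with ones u + ones v ≟ suc k * 2
... | no h = trans (censusTerm-no j (suc k * 2) (suc (m * 2)) u v eq h)
  (sym (cong₂ _+_ (pairTerm-zero 0 k (2 + k) m j u v λ (p , q) → h (trans (cong₂ _+_ p q) (ring₀ k)))
    (pairTerm-zero 1 (2 + k) k m j u v λ (p , q) → h (trans (cong₂ _+_ p q) (ring₁ k)))))
  where
  ring₀ : ∀ k → k + (2 + k) ≡ suc k * 2
  ring₀ = solveℕ
  ring₁ : ∀ k → 2 + k + k ≡ suc k * 2
  ring₁ = solveℕ
... | yes h with core u v (suc k) eq h
...   | core₁ p q s≡ = trans
  (censusTerm-pair 0 {j} {n = suc (m * 2)} {m} u v eq (suc-injective p) q (ring k) (trans (cong (δ (suc (m * 2))) s≡) (δ-*2 m (size u + size v)))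
    (trans (cong v₂! s≡) (trans (v₂!-odd (size u + size v)) (v₂!-even (size u + size v)))))
  (sym (trans (cong (λ x → pairTerm 0 k (2 + k) m j u v + x)
    (pairTerm-zero 1 (2 + k) k m j u v λ (p′ , _) → m≢1+n+m k {1} (trans (sym (suc-injective p)) p′))) (+-identityʳ _)))
  where
  ring : ∀ k → k + (2 + k) ≡ suc k * 2
  ring = solveℕ
...   | core₃ p q s≡ = trans
  (censusTerm-pair 1 {j} {n = suc (m * 2)} {m} u v eq p (suc-injective q) (ring k) (trans (cong (δ (suc (m * 2))) s≡) (δ-*2 m (suc (size u + size v))))
    (trans (cong v₂! s≡) (trans (v₂!-odd (suc (size u + size v))) (v₂!-even (suc (size u + size v))))))
  (sym (cong (_+ pairTerm 1 (2 + k) k m j u v)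
    (pairTerm-zero 0 k (2 + k) m j u v λ (p′ , _) → m≢1+n+m k {1} (trans (sym p′) p))))
  where
  ring : ∀ k → 2 + k + k ≡ suc k * 2
  ring = solveℕ
...   | core₀ p _ s≡ = trans (censusTerm-size j (suc k * 2) (suc (m * 2)) u v (λ e → double≢odd (size u + size v) m (trans (sym s≡) (sym e))))
  (sym (cong₂ _+_ (pairTerm-zero 0 k (2 + k) m j u v λ (p′ , _) → 1+n≢n (trans (sym p) p′))
    (pairTerm-zero 1 (2 + k) k m j u v λ (p′ , _) → 1+n≢n (trans (sym p′) p))))
...   | core₆ _ p p′ x s≡ = trans (censusTerm-far (suc k * 2) (suc (m * 2)) u v j≤1 (dimValuation-far u v x eq s≡))
  (sym (cong₂ _+_ (pairTerm-zero 0 k (2 + k) m j u v λ (e , _) → p (cong suc e))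
    (pairTerm-zero 1 (2 + k) k m j u v λ (e , _) → p′ e)))

-- Convolutions over the sizes of the two quotient partitions

conv : ℕ → (ℕ → ℕ → ℕ) → ℕ
conv m φ = Σ< (suc m) (λ a → φ a (m ∸ a))

conv-cong : ∀ m {φ ψ : ℕ → ℕ → ℕ} → (∀ a b → a + b ≡ m → φ a b ≡ ψ a b) → conv m φ ≡ conv m ψ
conv-cong m eq = Σ<-cong (suc m) (λ { a (s≤s a≤m) → eq a (m ∸ a) (m+[n∸m]≡n a≤m) })

δ-subst : ∀ m y (h : ℕ → ℕ) → δ m y * h m ≡ δ m y * h y
δ-subst m y h with m ≟ y
... | yes refl = refl
... | no m≢y rewrite δ-≢ m≢y = refl

δ-conv : ∀ m x y (g : ℕ → ℕ → ℕ) → conv m (λ a b → δ a x * (δ b y * g a b)) ≡ δ m (x + y) * g x y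
δ-conv zero    zero    y g = trans (+-identityʳ _) (trans (+-identityʳ _) (δ-subst 0 y (g 0)))
δ-conv zero    (suc x) y g = refl
δ-conv (suc m) zero    y g = trans (cong₂ _+_ (+-identityʳ _) (Σ<-zero (suc m))) (trans (+-identityʳ _) (δ-subst (suc m) y (g 0)))
δ-conv (suc m) (suc x) y g = δ-conv m x y (g ∘ suc)

ΣPair : ℕ → (Word → Word → ℕ) → ℕ
ΣPair n f = ΣWord n (λ u → ΣWord n (f u))

ΣPair-cong : ∀ n {f g : Word → Word → ℕ} → (∀ u v → length u ≡ length v → f u v ≡ g u v) → ΣPair n f ≡ ΣPair n g
ΣPair-cong n eq = ΣWord-cong n (λ u p → ΣWord-cong n (λ v q → eq u v (trans p (sym q))))

ΣPair-+ : ∀ n (f g : Word → Word → ℕ) → ΣPair n (λ u v → f u v + g u v) ≡ ΣPair n f + ΣPair n g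
ΣPair-+ n f g = trans (ΣWord-cong n (λ u _ → ΣWord-+ n (f u) (g u))) (ΣWord-+ n _ _)

ΣPair-zero : ∀ n → ΣPair n (λ _ _ → 0) ≡ 0
ΣPair-zero n = trans (ΣWord-cong n (λ _ _ → ΣWord-zero n)) (ΣWord-zero n)

convTerm : ℕ → ℕ → ℕ → (ℕ → ℕ → ℕ) → ℕ → ℕ → Word → Word → ℕ
convTerm k l m γ i j u v = δ k (ones u) * (δ l (ones v) * (δ m (size u + size v) *
  (γ (size u) (size v) * (δ i (dimValuation u) * δ j (dimValuation v)))))

-- The weight `γ` sees only the sizes, so for fixed sizes the double sum factors into a product of
-- two censuses.
ΣPair-convTerm : ∀ n k l m γ i j →
  ΣPair n (convTerm k l m γ i j) ≡ conv m (λ a b → γ a b * (census i k n a * census j l n b))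
ΣPair-convTerm n k l m γ i j = begin
  ΣPair n (convTerm k l m γ i j)
    ≡⟨ ΣPair-cong n (λ u v _ → pointwise u v) ⟩
  ΣWord n (λ u → ΣWord n (λ v → Σ< (suc m) (λ a → f a u v)))
    ≡⟨ ΣWord-cong n (λ u _ → ΣWord-Σ< n (suc m) (λ a → f a u)) ⟩
  ΣWord n (λ u → Σ< (suc m) (λ a → ΣWord n (f a u)))
    ≡⟨ ΣWord-Σ< n (suc m) (λ a u → ΣWord n (f a u)) ⟩
  Σ< (suc m) (λ a → ΣPair n (f a))
    ≡⟨ Σ<-cong (suc m) (λ a _ → product-sum a) ⟩
  conv m (λ a b → γ a b * (census i k n a * census j l n b)) ∎
  where
  f : ℕ → Word → Word → ℕ
  f a u v = γ a (m ∸ a) * (censusTerm i k a u * censusTerm j l (m ∸ a) v)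
  ring₁ : ∀ a b c d p q → a * (b * (c * (d * (p * q)))) ≡ c * (d * (a * b * (p * q)))
  ring₁ = solveℕ
  ring₂ : ∀ x y d a b p q → x * (y * (d * (a * b * (p * q)))) ≡ d * ((a * (x * p)) * (b * (y * q)))
  ring₂ = solveℕ
  pointwise : ∀ u v → convTerm k l m γ i j u v ≡ Σ< (suc m) (λ a → f a u v)
  pointwise u v = trans (ring₁ (δ k (ones u)) (δ l (ones v)) (δ m (size u + size v)) (γ (size u) (size v)) (δ i (dimValuation u)) (δ j (dimValuation v)))
    (trans (sym (δ-conv m (size u) (size v) (λ a b → γ a b * (δ k (ones u) * δ l (ones v) * (δ i (dimValuation u) * δ j (dimValuation v))))))
      (conv-cong m (λ a b _ → ring₂ (δ a (size u)) (δ b (size v)) (γ a b) (δ k (ones u)) (δ l (ones v)) (δ i (dimValuation u)) (δ j (dimValuation v)))))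
  product-sum : ∀ a → ΣPair n (f a) ≡ γ a (m ∸ a) * (census i k n a * census j l n (m ∸ a))
  product-sum a = begin
    ΣWord n (λ u → ΣWord n (λ v → γ a (m ∸ a) * (censusTerm i k a u * censusTerm j l (m ∸ a) v)))
      ≡⟨ ΣWord-cong n (λ u _ → trans (ΣWord-*ˡ n (γ a (m ∸ a)) _) (cong (γ a (m ∸ a) *_) (ΣWord-*ˡ n (censusTerm i k a u) _))) ⟩
    ΣWord n (λ u → γ a (m ∸ a) * (censusTerm i k a u * census j l n (m ∸ a)))
      ≡⟨ trans (ΣWord-*ˡ n (γ a (m ∸ a)) _) (cong (γ a (m ∸ a) *_) (ΣWord-*ʳ n (census j l n (m ∸ a)) _)) ⟩
    γ a (m ∸ a) * (census i k n a * census j l n (m ∸ a)) ∎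

count : ℕ → ℕ → ℕ
count zero    = aOdd
count (suc _) = aMod4 2

count≡census : ∀ {i n k l} → i ≤ 1 → n ≤ k → n ≤ l → count i n ≡ census i k (k + l) n
count≡census z≤n       n≤k n≤l = aOdd≡census n≤k n≤l
count≡census (s≤s z≤n) n≤k n≤l = aMod4-2≡census n≤k n≤l

-- `u` ranges over a k by l box and `v` over an l by k box; both hold every partition of size at
-- most m.
ΣPair-count : ∀ {k l m i j} γ → i ≤ 1 → j ≤ 1 → m ≤ k → m ≤ l →
  ΣPair (k + l) (convTerm k l m γ i j) ≡ conv m (λ a b → γ a b * (count i a * count j b))
ΣPair-count {k} {l} {m} {i} {j} γ i≤1 j≤1 m≤k m≤l = trans (ΣPair-convTerm (k + l) k l m γ i j)
  (conv-cong m (λ a b a+b≡m → cong (γ a b *_) (sym (cong₂ _*_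
    (count≡census {n = a} i≤1 (≤-trans (a≤ a b a+b≡m) m≤k) (≤-trans (a≤ a b a+b≡m) m≤l))
    (trans (count≡census {n = b} j≤1 (≤-trans (b≤ a b a+b≡m) m≤l) (≤-trans (b≤ a b a+b≡m) m≤k)) (cong (λ n → census j l n b) (+-comm l k)))))))
  where
  a≤ : ∀ a b → a + b ≡ m → a ≤ m
  a≤ a b refl = m≤m+n a b
  b≤ : ∀ a b → a + b ≡ m → b ≤ m
  b≤ a b refl = m≤n+m b a

noCarry oneCarry noCarry₁ : ℕ → ℕ → ℕ
noCarry a b = δ 0 (carry 0 a b)
oneCarry a b = δ 1 (carry 0 a b)
noCarry₁ a b = δ 0 (carry 1 a b)

δ₀-+ : ∀ c d e → δ 0 (c + (d + e)) ≡ δ 0 c * (δ 0 d * δ 0 e)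
δ₀-+ zero    zero    zero    = refl
δ₀-+ zero    zero    (suc e) = refl
δ₀-+ zero    (suc d) e       = refl
δ₀-+ (suc c) d       e       = refl

δ₁-+ : ∀ c d e → δ 1 (c + (d + e)) ≡ δ 0 c * (δ 1 d * δ 0 e) + δ 0 c * (δ 0 d * δ 1 e) + δ 1 c * (δ 0 d * δ 0 e)
δ₁-+ zero          zero          zero          = refl
δ₁-+ zero          zero          (suc zero)    = refl
δ₁-+ zero          zero          (suc (suc e)) = refl
δ₁-+ zero          (suc zero)    zero          = refl
δ₁-+ zero          (suc zero)    (suc e)       = refl
δ₁-+ zero          (suc (suc d)) e             = sym (trans (+-identityʳ _) (+-identityʳ _))
δ₁-+ (suc zero)    zero          zero          = refl
δ₁-+ (suc zero)    zero          (suc e)       = refl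
δ₁-+ (suc zero)    (suc d)       e             = refl
δ₁-+ (suc (suc c)) d             e             = refl

pairTerm-δ₀ : ∀ k l m u v → pairTerm 0 k l m 0 u v ≡ convTerm k l m noCarry 0 0 u v
pairTerm-δ₀ k l m u v = cong (λ x → δ k (ones u) * (δ l (ones v) * (δ m (size u + size v) * x)))
  (δ₀-+ (carry 0 (size u) (size v)) (dimValuation u) (dimValuation v))

pairTerm-δ₁ : ∀ k l m u v → pairTerm 0 k l m 1 u v ≡
  convTerm k l m noCarry 1 0 u v + convTerm k l m noCarry 0 1 u v + convTerm k l m oneCarry 0 0 u v
pairTerm-δ₁ k l m u v = trans (cong (λ x → δ k (ones u) * (δ l (ones v) * (δ m (size u + size v) * x)))
  (δ₁-+ (carry 0 (size u) (size v)) (dimValuation u) (dimValuation v)))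
  (ring (δ k (ones u)) (δ l (ones v)) (δ m (size u + size v)) _ _ _)
  where
  ring : ∀ a b c x y z → a * (b * (c * (x + y + z))) ≡ a * (b * (c * x)) + a * (b * (c * y)) + a * (b * (c * z))
  ring = solveℕ

-- A core of size 3 already contributes a factor 2 to the dimension. For valuation 1, in
-- `pairTerm₁-δ₁`, everything else must therefore be odd.
pairTerm₁-δ₀ : ∀ k l m u v → pairTerm 1 k l m 0 u v ≡ 0
pairTerm₁-δ₀ k l m u v = ring (δ k (ones u)) (δ l (ones v)) (δ m (suc (size u + size v)))
  where
  ring : ∀ a b c → a * (b * (c * 0)) ≡ 0
  ring = solveℕ

pairTerm₁-zero : ∀ k l u v → pairTerm 1 k l 0 1 u v ≡ 0
pairTerm₁-zero k l u v = ring (δ k (ones u)) (δ l (ones v))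
  where
  ring : ∀ a b → a * (b * 0) ≡ 0
  ring = solveℕ

pairTerm₁-δ₁ : ∀ k l m u v → pairTerm 1 k l (suc m) 1 u v ≡ convTerm k l m noCarry₁ 0 0 u v
pairTerm₁-δ₁ k l m u v = cong (λ x → δ k (ones u) * (δ l (ones v) * (δ m (size u + size v) * x)))
  (δ₀-+ (carry 1 (size u) (size v)) (dimValuation u) (dimValuation v))

even-sum : ∀ {j} m → j ≤ 1 → count j (m * 2) ≡ ΣPair (m + m) (pairTerm 0 m m m j)
even-sum {j} m j≤1 = begin
  count j (m * 2)                               ≡⟨ count≡census j≤1 ≤-refl ≤-refl ⟩
  census j (m * 2) (m * 2 + m * 2) (m * 2)      ≡⟨ cong (λ n → census j (m * 2) n (m * 2)) (*-distribʳ-+ 2 m m) ⟨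
  census j (m * 2) ((m + m) * 2) (m * 2)        ≡⟨ ΣWord-interleave (m + m) (censusTerm j (m * 2) (m * 2)) ⟩
  ΣPair (m + m) (λ u v → censusTerm j (m * 2) (m * 2) (interleave u v))
                                                ≡⟨ ΣPair-cong (m + m) (λ u v → censusTerm-even m m u v j≤1) ⟩
  ΣPair (m + m) (pairTerm 0 m m m j)            ∎

-- In a box of side 2m + 2 the trues split evenly as m + 1 and m + 1; the cores of size 1 and 3 turn
-- this into m and m + 2, so the quotient boxes still have sides at least m.
odd-sum : ∀ {j} m → j ≤ 1 → count j (suc (m * 2)) ≡
  ΣPair (m + (2 + m)) (pairTerm 0 m (2 + m) m j) + ΣPair (2 + m + m) (pairTerm 1 (2 + m) m m j)
odd-sum {j} m j≤1 = begin
  count j (suc (m * 2))                         ≡⟨ count≡census j≤1 (n≤1+n _) (n≤1+n _) ⟩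
  census j (suc m * 2) (suc m * 2 + suc m * 2) (suc (m * 2))
                                                ≡⟨ cong (λ n → census j (suc m * 2) n (suc (m * 2))) (ring₁ m) ⟩
  census j (suc m * 2) ((m + (2 + m)) * 2) (suc (m * 2))
                                                ≡⟨ ΣWord-interleave (m + (2 + m)) (censusTerm j (suc m * 2) (suc (m * 2))) ⟩
  ΣPair (m + (2 + m)) (λ u v → censusTerm j (suc m * 2) (suc (m * 2)) (interleave u v))
                                                ≡⟨ ΣPair-cong (m + (2 + m)) (λ u v → censusTerm-odd m m u v j≤1) ⟩
  ΣPair (m + (2 + m)) (λ u v → pairTerm 0 m (2 + m) m j u v + pairTerm 1 (2 + m) m m j u v)
                                                ≡⟨ ΣPair-+ (m + (2 + m)) (pairTerm 0 m (2 + m) m j) (pairTerm 1 (2 + m) m m j) ⟩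
  ΣPair (m + (2 + m)) (pairTerm 0 m (2 + m) m j) + ΣPair (m + (2 + m)) (pairTerm 1 (2 + m) m m j)
                                                ≡⟨ cong (λ n → ΣPair (m + (2 + m)) (pairTerm 0 m (2 + m) m j) + ΣPair n (pairTerm 1 (2 + m) m m j)) (+-comm m (2 + m)) ⟩
  ΣPair (m + (2 + m)) (pairTerm 0 m (2 + m) m j) + ΣPair (2 + m + m) (pairTerm 1 (2 + m) m m j) ∎
  where
  ring₁ : ∀ m → suc m * 2 + suc m * 2 ≡ (m + (2 + m)) * 2
  ring₁ = solveℕ

-- In `twoSplit` the single factor 2 comes from μ, from ν or from a carry. `extraSplit` is the share
-- of the core of size 3, which takes one unit away from |μ| + |ν|.
oddSplit twoSplit extraSplit : ℕ → ℕ
oddSplit m = conv m (λ a b → noCarry a b * (aOdd a * aOdd b))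
twoSplit m =
  conv m (λ a b → noCarry a b * (aMod4 2 a * aOdd b)) +
  conv m (λ a b → noCarry a b * (aOdd a * aMod4 2 b)) +
  conv m (λ a b → oneCarry a b * (aOdd a * aOdd b))
extraSplit zero    = 0
extraSplit (suc m) = conv m (λ a b → noCarry₁ a b * (aOdd a * aOdd b))

ΣPair-odd : ∀ {k l m} → m ≤ k → m ≤ l → ΣPair (k + l) (pairTerm 0 k l m 0) ≡ oddSplit m
ΣPair-odd {k} {l} {m} m≤k m≤l = trans (ΣPair-cong (k + l) (λ u v _ → pairTerm-δ₀ k l m u v)) (ΣPair-count noCarry z≤n z≤n m≤k m≤l)

ΣPair-two : ∀ {k l m} → m ≤ k → m ≤ l → ΣPair (k + l) (pairTerm 0 k l m 1) ≡ twoSplit m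
ΣPair-two {k} {l} {m} m≤k m≤l = trans (ΣPair-cong (k + l) (λ u v _ → pairTerm-δ₁ k l m u v))
  (trans (ΣPair-+ (k + l) (λ u v → convTerm k l m noCarry 1 0 u v + convTerm k l m noCarry 0 1 u v) (convTerm k l m oneCarry 0 0))
    (cong₂ _+_ (trans (ΣPair-+ (k + l) (convTerm k l m noCarry 1 0) (convTerm k l m noCarry 0 1))
                 (cong₂ _+_ (ΣPair-count noCarry ≤-refl z≤n m≤k m≤l) (ΣPair-count noCarry z≤n ≤-refl m≤k m≤l)))
               (ΣPair-count oneCarry z≤n z≤n m≤k m≤l)))

ΣPair-extra : ∀ {k l} m → m ≤ k → m ≤ l → ΣPair (k + l) (pairTerm 1 k l m 1) ≡ extraSplit m
ΣPair-extra {k} {l} zero    m≤k m≤l = trans (ΣPair-cong (k + l) (λ u v _ → pairTerm₁-zero k l u v)) (ΣPair-zero (k + l))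
ΣPair-extra {k} {l} (suc m) m≤k m≤l = trans (ΣPair-cong (k + l) (λ u v _ → pairTerm₁-δ₁ k l m u v))
  (ΣPair-count noCarry₁ z≤n z≤n (≤-trans (n≤1+n m) m≤k) (≤-trans (n≤1+n m) m≤l))

aOdd-even : ∀ m → aOdd (m * 2) ≡ oddSplit m
aOdd-even m = trans (even-sum m z≤n) (ΣPair-odd ≤-refl ≤-refl)

aOdd-odd : ∀ m → aOdd (suc (m * 2)) ≡ oddSplit m
aOdd-odd m = trans (odd-sum m z≤n) (trans (cong₂ _+_ (ΣPair-odd ≤-refl (m≤n+m m 2))
  (trans (ΣPair-cong (2 + m + m) (λ u v _ → pairTerm₁-δ₀ (2 + m) m m u v)) (ΣPair-zero (2 + m + m)))) (+-identityʳ _))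

aMod4-2-even : ∀ m → aMod4 2 (m * 2) ≡ twoSplit m
aMod4-2-even m = trans (even-sum {1} m ≤-refl) (ΣPair-two ≤-refl ≤-refl)

aMod4-2-odd : ∀ m → aMod4 2 (suc (m * 2)) ≡ twoSplit m + extraSplit m
aMod4-2-odd m = trans (odd-sum {1} m ≤-refl) (cong₂ _+_ (ΣPair-two ≤-refl (m≤n+m m 2)) (ΣPair-extra m (m≤n+m m 2) ≤-refl))

-- Binary carries

pow-halves : ∀ r → 2 ^ suc r ≡ 2 ^ r * 2
pow-halves r = *-comm 2 (2 ^ r)

pow-double : ∀ r → 2 ^ suc r ≡ 2 ^ r + 2 ^ r
pow-double r = cong (λ k → 2 ^ r + k) (+-identityʳ (2 ^ r))

*2-cancel-< : ∀ {a b} → a * 2 < b * 2 → a < b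
*2-cancel-< {a} {b} = *-cancelʳ-< 2 a b

half-<-even : ∀ {r y} → y * 2 < 2 ^ suc r → y < 2 ^ r
half-<-even {r} {y} lt = *2-cancel-< (subst (y * 2 <_) (pow-halves r) lt)

half-<-odd : ∀ {r y} → suc (y * 2) < 2 ^ suc r → y < 2 ^ r
half-<-odd {r} {y} lt = half-<-even {r} (≤-trans (n≤1+n _) lt)

pow+even : ∀ r y → 2 ^ suc r + y * 2 ≡ (2 ^ r + y) * 2
pow+even r y = trans (cong (_+ y * 2) (pow-halves r)) (sym (*-distribʳ-+ 2 (2 ^ r) y))

pow+odd : ∀ r y → 2 ^ suc r + suc (y * 2) ≡ suc ((2 ^ r + y) * 2)
pow+odd r y = trans (+-suc (2 ^ suc r) (y * 2)) (cong suc (pow+even r y))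

v₂!-pow-suc : ∀ r → v₂! (2 ^ suc r) ≡ 2 ^ r + v₂! (2 ^ r)
v₂!-pow-suc r = trans (cong v₂! (pow-halves r)) (v₂!-even (2 ^ r))

v₂!-pow : ∀ r → suc (v₂! (2 ^ r)) ≡ 2 ^ r
v₂!-pow zero    = cong suc (trans (v₂!-odd 0) v₂!-zero)
v₂!-pow (suc r) = trans (cong suc (v₂!-pow-suc r)) (trans (sym (+-suc (2 ^ r) (v₂! (2 ^ r))))
  (trans (cong (λ k → 2 ^ r + k) (v₂!-pow r)) (sym (pow-double r))))

v₂!-pow-double : ∀ r → v₂! (2 ^ suc r) ≡ suc (v₂! (2 ^ r) + v₂! (2 ^ r))
v₂!-pow-double r = trans (v₂!-pow-suc r) (cong (_+ v₂! (2 ^ r)) (sym (v₂!-pow r)))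

-- By Legendre, v₂(n!) is n minus the number of binary ones of n, and both are additive when the
-- digits do not overlap.
v₂!-top-bit : ∀ r {x} → x < 2 ^ r → v₂! (2 ^ r + x) ≡ v₂! (2 ^ r) + v₂! x
v₂!-top-bit zero    {zero} _ = sym (trans (cong (λ k → v₂! 1 + k) v₂!-zero) (+-identityʳ _))
v₂!-top-bit zero    {suc x} (s≤s ())
v₂!-top-bit (suc r) {x} x< with evenOrOdd x
... | even y = begin
  v₂! (2 ^ suc r + y * 2)                   ≡⟨ cong v₂! (pow+even r y) ⟩
  v₂! ((2 ^ r + y) * 2)                     ≡⟨ v₂!-even (2 ^ r + y) ⟩
  2 ^ r + y + v₂! (2 ^ r + y)               ≡⟨ cong (λ k → 2 ^ r + y + k) (v₂!-top-bit r (half-<-even {r} x<)) ⟩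
  2 ^ r + y + (v₂! (2 ^ r) + v₂! y)         ≡⟨ interchange (2 ^ r) y (v₂! (2 ^ r)) (v₂! y) ⟩
  2 ^ r + v₂! (2 ^ r) + (y + v₂! y)         ≡⟨ cong₂ _+_ (v₂!-pow-suc r) (v₂!-even y) ⟨
  v₂! (2 ^ suc r) + v₂! (y * 2)             ∎
... | odd y = begin
  v₂! (2 ^ suc r + suc (y * 2))             ≡⟨ cong v₂! (pow+odd r y) ⟩
  v₂! (suc ((2 ^ r + y) * 2))               ≡⟨ trans (v₂!-odd (2 ^ r + y)) (v₂!-even (2 ^ r + y)) ⟩
  2 ^ r + y + v₂! (2 ^ r + y)               ≡⟨ cong (λ k → 2 ^ r + y + k) (v₂!-top-bit r (half-<-odd {r} x<)) ⟩
  2 ^ r + y + (v₂! (2 ^ r) + v₂! y)         ≡⟨ interchange (2 ^ r) y (v₂! (2 ^ r)) (v₂! y) ⟩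
  2 ^ r + v₂! (2 ^ r) + (y + v₂! y)         ≡⟨ cong₂ _+_ (v₂!-pow-suc r) (trans (v₂!-odd y) (v₂!-even y)) ⟨
  v₂! (2 ^ suc r) + v₂! (suc (y * 2))       ∎

carry-≡ : ∀ s a b {c} → c + (v₂! a + v₂! b) ≡ v₂! (s + (a + b)) → carry s a b ≡ c
carry-≡ s a b {c} eq = +-cancelʳ-≡ (v₂! a + v₂! b) _ c (trans (carry+ s a b) (sym eq))

carry-comm : ∀ s a b → carry s a b ≡ carry s b a
carry-comm s a b = carry-≡ s a b (trans (cong (λ k → carry s b a + k) (+-comm (v₂! a) (v₂! b)))
  (trans (carry+ s b a) (cong (λ k → v₂! (s + k)) (+-comm b a))))

carry-topˡ : ∀ s r {a b} → s + (a + b) < 2 ^ r → carry s (2 ^ r + a) b ≡ carry s a b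
carry-topˡ s r {a} {b} lt = carry-≡ s (2 ^ r + a) b (begin
  carry s a b + (v₂! (2 ^ r + a) + v₂! b)
    ≡⟨ cong (λ k → carry s a b + (k + v₂! b)) (v₂!-top-bit r (≤-<-trans (≤-trans (m≤m+n a b) (m≤n+m (a + b) s)) lt)) ⟩
  carry s a b + (v₂! (2 ^ r) + v₂! a + v₂! b)
    ≡⟨ ring₁ (carry s a b) (v₂! (2 ^ r)) (v₂! a) (v₂! b) ⟩
  v₂! (2 ^ r) + (carry s a b + (v₂! a + v₂! b))
    ≡⟨ cong (λ k → v₂! (2 ^ r) + k) (carry+ s a b) ⟩
  v₂! (2 ^ r) + v₂! (s + (a + b))
    ≡⟨ v₂!-top-bit r lt ⟨
  v₂! (2 ^ r + (s + (a + b)))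
    ≡⟨ cong v₂! (ring₂ (2 ^ r) s a b) ⟩
  v₂! (s + (2 ^ r + a + b)) ∎)
  where
  ring₁ : ∀ c q a b → c + (q + a + b) ≡ q + (c + (a + b))
  ring₁ = solveℕ
  ring₂ : ∀ q s a b → q + (s + (a + b)) ≡ s + (q + a + b)
  ring₂ = solveℕ

carry-topʳ : ∀ s r {a b} → s + (a + b) < 2 ^ r → carry s a (2 ^ r + b) ≡ carry s a b
carry-topʳ s r {a} {b} lt = trans (carry-comm s a (2 ^ r + b))
  (trans (carry-topˡ s r (subst (λ k → s + k < 2 ^ r) (+-comm a b) lt)) (carry-comm s b a))

-- The two digits 2^r collide and cause one carry beyond those of the lower digits.
carry-both : ∀ r {a b} → a < 2 ^ r → b < 2 ^ r → carry 0 (2 ^ r + a) (2 ^ r + b) ≡ suc (carry 0 a b)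
carry-both r {a} {b} a< b< = carry-≡ 0 (2 ^ r + a) (2 ^ r + b) (begin
  suc (carry 0 a b) + (v₂! (2 ^ r + a) + v₂! (2 ^ r + b))
    ≡⟨ cong₂ (λ x y → suc (carry 0 a b) + (x + y)) (v₂!-top-bit r a<) (v₂!-top-bit r b<) ⟩
  suc (carry 0 a b) + (v₂! (2 ^ r) + v₂! a + (v₂! (2 ^ r) + v₂! b))
    ≡⟨ ring₁ (carry 0 a b) (v₂! (2 ^ r)) (v₂! a) (v₂! b) ⟩
  suc (v₂! (2 ^ r) + v₂! (2 ^ r)) + (carry 0 a b + (v₂! a + v₂! b))
    ≡⟨ cong₂ _+_ (v₂!-pow-double r) (sym (carry+ 0 a b)) ⟨
  v₂! (2 ^ suc r) + v₂! (a + b)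
    ≡⟨ v₂!-top-bit (suc r) (subst (a + b <_) (sym (pow-double r)) (+-mono-< a< b<)) ⟨
  v₂! (2 ^ suc r + (a + b))
    ≡⟨ cong v₂! (trans (cong (_+ (a + b)) (pow-double r)) (interchange (2 ^ r) (2 ^ r) a b)) ⟩
  v₂! (2 ^ r + a + (2 ^ r + b)) ∎)
  where
  ring₁ : ∀ c q a b → suc c + (q + a + (q + b)) ≡ suc (q + q) + (c + (a + b))
  ring₁ = solveℕ

split-≥ : ∀ {q b} → q ≤ b → ∃ λ b′ → b ≡ q + b′
split-≥ q≤b with m≤n⇒∃[o]m+o≡n q≤b
... | o , eq = o , sym eq

-- The lower digits overflow into the place of 2^r, where they meet the digit of the second summand
-- and carry once more.
carry-mixed : ∀ r {a b} → a < 2 ^ r → b < 2 ^ r → 2 ^ r ≤ a + b → carry 0 a (2 ^ r + b) ≡ suc (carry 0 a b)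
carry-mixed r {a} {b} a< b< ≤a+b with split-≥ ≤a+b
... | m , eq = carry-≡ 0 a (2 ^ r + b) (begin
  suc (carry 0 a b) + (v₂! a + v₂! (2 ^ r + b))
    ≡⟨ cong (λ k → suc (carry 0 a b) + (v₂! a + k)) (v₂!-top-bit r b<) ⟩
  suc (carry 0 a b) + (v₂! a + (v₂! (2 ^ r) + v₂! b))
    ≡⟨ ring₁ (carry 0 a b) (v₂! (2 ^ r)) (v₂! a) (v₂! b) ⟩
  suc (v₂! (2 ^ r)) + (carry 0 a b + (v₂! a + v₂! b))
    ≡⟨ cong (λ k → suc (v₂! (2 ^ r)) + k) (trans (carry+ 0 a b) (trans (cong v₂! eq) (v₂!-top-bit r m<))) ⟩
  suc (v₂! (2 ^ r)) + (v₂! (2 ^ r) + v₂! m)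
    ≡⟨ +-assoc (suc (v₂! (2 ^ r))) (v₂! (2 ^ r)) (v₂! m) ⟨
  suc (v₂! (2 ^ r) + v₂! (2 ^ r)) + v₂! m
    ≡⟨ cong (_+ v₂! m) (v₂!-pow-double r) ⟨
  v₂! (2 ^ suc r) + v₂! m
    ≡⟨ v₂!-top-bit (suc r) (<-≤-trans m< (≤-trans (m≤m+n (2 ^ r) (2 ^ r)) (≤-reflexive (sym (pow-double r))))) ⟨
  v₂! (2 ^ suc r + m)
    ≡⟨ cong v₂! (trans (cong (_+ m) (pow-double r)) (trans (+-assoc (2 ^ r) (2 ^ r) m) (trans (cong (λ k → 2 ^ r + k) (sym eq)) (ring₂ (2 ^ r) a b)))) ⟩
  v₂! (a + (2 ^ r + b)) ∎)
  where
  m< : m < 2 ^ r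
  m< = +-cancelˡ-< (2 ^ r) m (2 ^ r) (subst (_< 2 ^ r + 2 ^ r) eq (+-mono-< a< b<))
  ring₁ : ∀ c q a b → suc c + (a + (q + b)) ≡ suc q + (c + (a + b))
  ring₁ = solveℕ
  ring₂ : ∀ q a b → q + (a + b) ≡ a + (q + b)
  ring₂ = solveℕ

-- Since a < 2^r, the digit 2^r must come from `b`; the lower digits carry into it and it carries
-- on, which makes two carries. `over` is `carry-overflow` at r, passed as an argument because its
-- induction step uses this lemma.
carry-half : ∀ r → (∀ {a b} → a < 2 ^ r → b < 2 ^ r → 2 ^ r ≤ a + b → 1 ≤ carry 0 a b) →
  ∀ {a b} → a < 2 ^ r → b < 2 ^ suc r → 2 ^ suc r ≤ a + b → 2 ≤ carry 0 a b
carry-half r over {a} {b} a< b< le with <-≤-connex b (2 ^ r)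
... | inj₁ b<′ = ⊥-elim (<⇒≱ (+-mono-< a< b<′) (subst (_≤ a + b) (pow-double r) le))
... | inj₂ ≤b with split-≥ ≤b
...   | b′ , refl = subst (2 ≤_) (sym (carry-mixed r a< b′< le′)) (s≤s (over a< b′< le′))
  where
  b′< : b′ < 2 ^ r
  b′< = +-cancelˡ-< (2 ^ r) b′ (2 ^ r) (subst (2 ^ r + b′ <_) (pow-double r) b<)
  le′ : 2 ^ r ≤ a + b′
  le′ = +-cancelˡ-≤ (2 ^ r) (2 ^ r) (a + b′) (subst₂ _≤_ (pow-double r) (ring a (2 ^ r) b′) le)
    where
    ring : ∀ a q b → a + (q + b) ≡ q + (a + b)
    ring = solveℕ

carry-overflow : ∀ r {a b} → a < 2 ^ r → b < 2 ^ r → 2 ^ r ≤ a + b → 1 ≤ carry 0 a b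
carry-overflow zero    {zero} {zero} a< b< ()
carry-overflow zero    {zero} {suc b} a< (s≤s ()) le
carry-overflow zero    {suc a} (s≤s ()) b< le
carry-overflow (suc r) {a} {b} a< b< le with <-≤-connex a (2 ^ r) | <-≤-connex b (2 ^ r)
... | inj₁ a<′ | _ = ≤-trans (n≤1+n 1) (carry-half r (carry-overflow r) a<′ b< le)
... | inj₂ _   | inj₁ b<′ = subst (1 ≤_) (carry-comm 0 b a)
  (≤-trans (n≤1+n 1) (carry-half r (carry-overflow r) b<′ a< (subst (2 ^ suc r ≤_) (+-comm a b) le)))
... | inj₂ ≤a  | inj₂ ≤b with split-≥ ≤a | split-≥ ≤b
...   | a′ , refl | b′ , refl = subst (1 ≤_) (sym (carry-both r (low a<) (low b<))) (s≤s z≤n)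
  where
  low : ∀ {x} → 2 ^ r + x < 2 ^ suc r → x < 2 ^ r
  low {x} lt = +-cancelˡ-< (2 ^ r) x (2 ^ r) (subst (2 ^ r + x <_) (pow-double r) lt)

carry₀≤carry₁ : ∀ a b → carry 0 a b ≤ carry 1 a b
carry₀≤carry₁ a b = ∸-monoˡ-≤ (v₂! a + v₂! b) (v₂!-mono (n≤1+n (a + b)))

-- Splitting a convolution at a power of two

Σ<-+ : ∀ m n f → Σ< (m + n) f ≡ Σ< m f + Σ< n (λ i → f (m + i))
Σ<-+ zero    n f = refl
Σ<-+ (suc m) n f = trans (cong (λ k → f 0 + k) (Σ<-+ m n (f ∘ suc))) (sym (+-assoc (f 0) _ _))

Σ<-≡0 : ∀ n {f : ℕ → ℕ} → (∀ i → i < n → f i ≡ 0) → Σ< n f ≡ 0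
Σ<-≡0 n eq = trans (Σ<-cong n eq) (Σ<-zero n)

Σ<-*ˡ : ∀ n c f → Σ< n (λ i → c * f i) ≡ c * Σ< n f
Σ<-*ˡ zero    c f = sym (*-zeroʳ c)
Σ<-*ˡ (suc n) c f = trans (cong (λ k → c * f 0 + k) (Σ<-*ˡ n c (f ∘ suc))) (sym (*-distribˡ-+ c (f 0) _))

Σ<-distrib-+ : ∀ n f g → Σ< n (λ i → f i + g i) ≡ Σ< n f + Σ< n g
Σ<-distrib-+ zero    f g = refl
Σ<-distrib-+ (suc n) f g = trans (cong (λ k → f 0 + g 0 + k) (Σ<-distrib-+ n (f ∘ suc) (g ∘ suc))) (interchange (f 0) (g 0) _ _)

conv-*ˡ : ∀ m c φ → conv m (λ a b → c * φ a b) ≡ c * conv m φ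
conv-*ˡ m c φ = Σ<-*ˡ (suc m) c (λ a → φ a (m ∸ a))

conv-+ : ∀ m φ ψ → conv m (λ a b → φ a b + ψ a b) ≡ conv m φ + conv m ψ
conv-+ m φ ψ = Σ<-distrib-+ (suc m) (λ a → φ a (m ∸ a)) (λ a → ψ a (m ∸ a))

conv-≡0 : ∀ m {φ} → (∀ a b → a + b ≡ m → φ a b ≡ 0) → conv m φ ≡ 0
conv-≡0 m eq = trans (conv-cong m eq) (Σ<-zero (suc m))

middle : ℕ → ℕ → ℕ → (ℕ → ℕ → ℕ) → ℕ
middle p m d φ = Σ< d (λ i → φ (suc m + i) (p + m ∸ (suc m + i)))

-- For a + b = p + m with m < p there are three ranges: a ≤ m, where b ≥ p; m < a < p, where both
-- lie below p; and a ≥ p. The number of values in the middle is d.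
conv-split : ∀ p m d φ → suc m + d ≡ p →
  conv (p + m) φ ≡ conv m (λ a b → φ a (p + b)) + (middle p m d φ + conv m (λ a b → φ (p + a) b))
conv-split p m d φ eq = begin
  Σ< (suc (p + m)) f
    ≡⟨ cong (λ n → Σ< n f) (trans (sym (+-suc p m)) (trans (cong (_+ suc m) (sym eq)) (+-assoc (suc m) d (suc m)))) ⟩
  Σ< (suc m + (d + suc m)) f
    ≡⟨ trans (Σ<-+ (suc m) (d + suc m) f) (cong (λ k → Σ< (suc m) f + k) (Σ<-+ d (suc m) (λ i → f (suc m + i)))) ⟩
  Σ< (suc m) f + (middle p m d φ + Σ< (suc m) (λ i → f (suc m + (d + i))))
    ≡⟨ cong₂ (λ x y → x + (middle p m d φ + y)) (Σ<-cong (suc m) low) (Σ<-cong (suc m) high) ⟩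
  conv m (λ a b → φ a (p + b)) + (middle p m d φ + conv m (λ a b → φ (p + a) b)) ∎
  where
  f : ℕ → ℕ
  f a = φ a (p + m ∸ a)
  low : ∀ a → a < suc m → f a ≡ φ a (p + (m ∸ a))
  low a (s≤s a≤m) = cong (φ a) (+-∸-assoc p a≤m)
  high : ∀ a → a < suc m → f (suc m + (d + a)) ≡ φ (p + a) (m ∸ a)
  high a _ = trans (cong f (trans (sym (+-assoc (suc m) d a)) (cong (_+ a) eq))) (cong (φ (p + a)) ([m+n]∸[m+o]≡n∸o p m a))

middle-range : ∀ p m d i → suc m + d ≡ p → i < d →
  suc m + i < p × p + m ∸ (suc m + i) < p × (suc m + i) + (p + m ∸ (suc m + i)) ≡ p + m
middle-range p m d i eq i<d = a<p , b<p , a+b≡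
  where
  a<p : suc m + i < p
  a<p = subst (suc m + i <_) eq (+-monoʳ-< (suc m) i<d)
  a+b≡ : (suc m + i) + (p + m ∸ (suc m + i)) ≡ p + m
  a+b≡ = m+[n∸m]≡n (≤-trans (<⇒≤ a<p) (m≤m+n p m))
  b<p : p + m ∸ (suc m + i) < p
  b<p = +-cancelˡ-< m _ p (<-≤-trans (+-monoˡ-< (p + m ∸ (suc m + i)) (s≤s (m≤m+n m i))) (≤-reflexive (trans a+b≡ (+-comm p m))))

middle-≡0 : ∀ p m d {φ} → suc m + d ≡ p → (∀ a b → a < p → b < p → a + b ≡ p + m → φ a b ≡ 0) → middle p m d φ ≡ 0
middle-≡0 p m d eq zero-at = Σ<-≡0 d (λ i i<d → let a< , b< , a+b≡ = middle-range p m d i eq i<d in zero-at _ _ a< b< a+b≡)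

-- For p = 2q and m < q the middle range divides again: m < a < q and q + m < a < 2q, where one
-- summand is below q, and q ≤ a ≤ q + m, where both contain q and the remainders add to m.
middle-split : ∀ q m d φ → suc m + d ≡ q →
  (∀ a b → a < q → b < q + q → q + q ≤ a + b → φ a b ≡ 0) → (∀ a b → a < q + q → b < q → q + q ≤ a + b → φ a b ≡ 0) →
  middle (q + q) m (d + (suc m + d)) φ ≡ conv m (λ a b → φ (q + a) (q + b))
middle-split q m d φ eq zeroˡ zeroʳ = begin
  Σ< (d + (suc m + d)) g
    ≡⟨ trans (Σ<-+ d (suc m + d) g) (cong (λ k → Σ< d g + k) (Σ<-+ (suc m) d (λ i → g (d + i)))) ⟩
  Σ< d g + (Σ< (suc m) (λ i → g (d + i)) + Σ< d (λ i → g (d + (suc m + i))))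
    ≡⟨ cong₂ _+_ (Σ<-≡0 d left) (cong₂ _+_ (Σ<-cong (suc m) centre) (Σ<-≡0 d right)) ⟩
  conv m (λ a b → φ (q + a) (q + b)) + 0
    ≡⟨ +-identityʳ _ ⟩
  conv m (λ a b → φ (q + a) (q + b)) ∎
  where
  g : ℕ → ℕ
  g i = φ (suc m + i) (q + q + m ∸ (suc m + i))
  total : suc m + (d + (suc m + d)) ≡ q + q
  total = trans (sym (+-assoc (suc m) d (suc m + d))) (cong₂ _+_ eq eq)
  range : ∀ i → i < d + (suc m + d) → _
  range i = middle-range (q + q) m (d + (suc m + d)) i total
  left : ∀ i → i < d → g i ≡ 0
  left i i<d = let _ , b< , a+b≡ = range i (≤-trans i<d (m≤m+n d (suc m + d))) in
    zeroˡ (suc m + i) _ (subst (suc m + i <_) eq (+-monoʳ-< (suc m) i<d)) b< (≤-trans (m≤m+n (q + q) m) (≤-reflexive (sym a+b≡)))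
  centre : ∀ i → i < suc m → g (d + i) ≡ φ (q + i) (q + (m ∸ i))
  centre i (s≤s i≤m) = cong₂ φ a≡ (trans (cong (q + q + m ∸_) a≡) (trans (cong (_∸ (q + i)) (+-assoc q q m))
    (trans ([m+n]∸[m+o]≡n∸o q (q + m) i) (+-∸-assoc q i≤m))))
    where
    a≡ : suc m + (d + i) ≡ q + i
    a≡ = trans (sym (+-assoc (suc m) d i)) (cong (_+ i) eq)
  right : ∀ i → i < d → g (d + (suc m + i)) ≡ 0
  right i i<d = let a< , _ , a+b≡ = range (d + (suc m + i)) (+-monoʳ-< d (+-monoʳ-< (suc m) i<d)) in
    zeroʳ _ _ a< (+-cancelˡ-< (q + m) _ q (<-≤-trans (+-monoˡ-< _ (lower i)) (≤-reflexive (trans a+b≡ (ring q m)))))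
      (≤-trans (m≤m+n (q + q) m) (≤-reflexive (sym a+b≡)))
    where
    ring : ∀ q m → q + q + m ≡ q + m + q
    ring = solveℕ
    lower : ∀ i → q + m < suc m + (d + (suc m + i))
    lower i = subst (q + m <_) (trans (cong (_+ (suc m + i)) (sym eq)) (+-assoc (suc m) d (suc m + i)))
      (+-monoʳ-< q (s≤s (m≤m+n m i)))

-- Recursion on the top binary digit

conv-flip : ∀ m φ → conv m φ ≡ conv m (λ a b → φ b a)
conv-flip zero    φ = refl
conv-flip (suc m) φ = begin
  Σ< (suc (suc m)) f                                ≡⟨ Σ<-snoc (suc m) f ⟩
  Σ< (suc m) f + φ (suc m) (m ∸ m)                  ≡⟨ cong₂ _+_ (Σ<-cong (suc m) (λ { a (s≤s a≤m) → cong (φ a) (+-∸-assoc 1 a≤m) })) (cong (φ (suc m)) (n∸n≡0 m)) ⟩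
  conv m (λ a b → φ a (suc b)) + φ (suc m) 0        ≡⟨ +-comm _ (φ (suc m) 0) ⟩
  φ (suc m) 0 + conv m (λ a b → φ a (suc b))        ≡⟨ cong (λ k → φ (suc m) 0 + k) (conv-flip m (λ a b → φ a (suc b))) ⟩
  φ (suc m) 0 + conv m (λ a b → φ b (suc a))        ∎
  where
  f : ℕ → ℕ
  f a = φ a (suc m ∸ a)
  Σ<-snoc : ∀ n f → Σ< (suc n) f ≡ Σ< n f + f n
  Σ<-snoc zero    f = +-identityʳ (f 0)
  Σ<-snoc (suc n) f = trans (cong (λ k → f 0 + k) (Σ<-snoc n (f ∘ suc))) (sym (+-assoc (f 0) _ _))

conv-scale : ∀ m c {φ ψ : ℕ → ℕ → ℕ} → (∀ a b → a + b ≡ m → φ a b ≡ c * ψ a b) → conv m φ ≡ c * conv m ψ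
conv-scale m c {ψ = ψ} eq = trans (conv-cong m eq) (conv-*ˡ m c ψ)

δ₀-pos : ∀ {c} → 1 ≤ c → δ 0 c ≡ 0
δ₀-pos (s≤s _) = refl

δ₁-pos : ∀ {c} → 2 ≤ c → δ 1 c ≡ 0
δ₁-pos (s≤s (s≤s _)) = refl

summandˡ : ∀ a b {m n} → a + b ≡ m → m < n → a < n
summandˡ a b refl lt = ≤-<-trans (m≤m+n a b) lt

summandʳ : ∀ a b {m n} → a + b ≡ m → m < n → b < n
summandʳ a b refl lt = ≤-<-trans (m≤n+m b a) lt

split-top : ∀ r m {φ} → m < 2 ^ r → (∀ a b → a < 2 ^ r → b < 2 ^ r → a + b ≡ 2 ^ r + m → φ a b ≡ 0) →
  conv (2 ^ r + m) φ ≡ conv m (λ a b → φ a (2 ^ r + b)) + conv m (λ a b → φ (2 ^ r + a) b)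
split-top r m {φ} m< zero-at with m≤n⇒∃[o]m+o≡n m<
... | d , eq = trans (conv-split (2 ^ r) m d φ eq)
  (cong (λ k → conv m (λ a b → φ a (2 ^ r + b)) + (k + conv m (λ a b → φ (2 ^ r + a) b))) (middle-≡0 (2 ^ r) m d eq zero-at))

noCarry-overflow : ∀ r {m} a b (f : ℕ) → a < 2 ^ r → b < 2 ^ r → a + b ≡ 2 ^ r + m → noCarry a b * f ≡ 0
noCarry-overflow r {m} a b f a< b< eq =
  cong (_* f) (δ₀-pos (carry-overflow r a< b< (≤-trans (m≤m+n (2 ^ r) m) (≤-reflexive (sym eq)))))

noCarry-topˡ : ∀ r {m} a b → a + b ≡ m → m < 2 ^ r → noCarry (2 ^ r + a) b ≡ noCarry a b
noCarry-topˡ r a b refl lt = cong (δ 0) (carry-topˡ 0 r lt)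

noCarry-topʳ : ∀ r {m} a b → a + b ≡ m → m < 2 ^ r → noCarry a (2 ^ r + b) ≡ noCarry a b
noCarry-topʳ r a b refl lt = cong (δ 0) (carry-topʳ 0 r lt)

oneCarry-topˡ : ∀ r {m} a b → a + b ≡ m → m < 2 ^ r → oneCarry (2 ^ r + a) b ≡ oneCarry a b
oneCarry-topˡ r a b refl lt = cong (δ 1) (carry-topˡ 0 r lt)

oneCarry-topʳ : ∀ r {m} a b → a + b ≡ m → m < 2 ^ r → oneCarry a (2 ^ r + b) ≡ oneCarry a b
oneCarry-topʳ r a b refl lt = cong (δ 1) (carry-topʳ 0 r lt)

OddAt : ℕ → Set
OddAt r = ∀ m → m < 2 ^ r → aOdd (2 ^ r + m) ≡ 2 ^ r * aOdd m

x∙yz-scale : ∀ c x p y z → x ≡ c * p → y * (x * z) ≡ c * (y * (p * z))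
x∙yz-scale c x p y z refl = ring c p y z
  where
  ring : ∀ c p y z → y * (c * p * z) ≡ c * (y * (p * z))
  ring = solveℕ

x∙yz-scaleʳ : ∀ c x p y z → x ≡ c * p → y * (z * x) ≡ c * (y * (z * p))
x∙yz-scaleʳ c x p y z refl = ring c p y z
  where
  ring : ∀ c p y z → y * (z * (c * p)) ≡ c * (y * (z * p))
  ring = solveℕ

-- Without carries the digit 2^r lies in exactly one summand; each of the two choices contributes
-- 2^r times the convolution at `m`.
oddSplit-top : ∀ r → OddAt r → ∀ m → m < 2 ^ r → oddSplit (2 ^ r + m) ≡ 2 ^ suc r * oddSplit m
oddSplit-top r odd-at m m< = begin
  oddSplit (2 ^ r + m)
    ≡⟨ split-top r m m< (λ a b → noCarry-overflow r a b (aOdd a * aOdd b)) ⟩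
  conv m (λ a b → noCarry a (2 ^ r + b) * (aOdd a * aOdd (2 ^ r + b))) + conv m (λ a b → noCarry (2 ^ r + a) b * (aOdd (2 ^ r + a) * aOdd b))
    ≡⟨ cong₂ _+_
         (conv-scale m (2 ^ r) (λ a b eq → trans (cong (_* (aOdd a * aOdd (2 ^ r + b))) (noCarry-topʳ r a b eq m<))
           (x∙yz-scaleʳ (2 ^ r) _ (aOdd b) (noCarry a b) (aOdd a) (odd-at b (summandʳ a b eq m<)))))
         (conv-scale m (2 ^ r) (λ a b eq → trans (cong (_* (aOdd (2 ^ r + a) * aOdd b)) (noCarry-topˡ r a b eq m<))
           (x∙yz-scale (2 ^ r) _ (aOdd a) (noCarry a b) (aOdd b) (odd-at a (summandˡ a b eq m<))))) ⟩
  2 ^ r * oddSplit m + 2 ^ r * oddSplit m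
    ≡⟨ ring (2 ^ r) (oddSplit m) ⟩
  2 ^ suc r * oddSplit m ∎
  where
  ring : ∀ q o → q * o + q * o ≡ 2 * q * o
  ring = solveℕ

-- Iterated over the binary digits this is Macdonald's product of the powers 2^r occurring in n.
-- Halving turns the claim at r + 1 into `oddSplit-top` at r.
aOdd-top : ∀ r → OddAt r
aOdd-top zero    zero    _ = trans (trans (aOdd-odd 0) (sym (aOdd-even 0))) (sym (+-identityʳ _))
aOdd-top zero    (suc m) (s≤s ())
aOdd-top (suc r) m m< with evenOrOdd m
... | even y = begin
  aOdd (2 ^ suc r + y * 2)     ≡⟨ cong aOdd (pow+even r y) ⟩
  aOdd ((2 ^ r + y) * 2)       ≡⟨ aOdd-even (2 ^ r + y) ⟩
  oddSplit (2 ^ r + y)         ≡⟨ oddSplit-top r (aOdd-top r) y (half-<-even {r} m<) ⟩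
  2 ^ suc r * oddSplit y       ≡⟨ cong (2 ^ suc r *_) (aOdd-even y) ⟨
  2 ^ suc r * aOdd (y * 2)     ∎
... | odd y = begin
  aOdd (2 ^ suc r + suc (y * 2)) ≡⟨ cong aOdd (pow+odd r y) ⟩
  aOdd (suc ((2 ^ r + y) * 2))   ≡⟨ aOdd-odd (2 ^ r + y) ⟩
  oddSplit (2 ^ r + y)           ≡⟨ oddSplit-top r (aOdd-top r) y (half-<-odd {r} m<) ⟩
  2 ^ suc r * oddSplit y         ≡⟨ cong (2 ^ suc r *_) (aOdd-odd y) ⟨
  2 ^ suc r * aOdd (suc (y * 2)) ∎

-- Here a + b = 2^(r+1) - 1 is odd, so passing to a + b + 1 adds an even factor to the factorial.
-- The exponent must be positive, as `extraSplit 1` is 1.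
extraSplit-pow : ∀ r → extraSplit (2 ^ suc r) ≡ 0
extraSplit-pow r with 2 ^ r in eq | m^n>0 2 r
... | suc q | _ = trans (cong extraSplit (ring q)) (conv-≡0 (suc (q * 2)) (λ a b a+b≡ →
    cong (_* (aOdd a * aOdd b)) (δ₀-pos (m<n⇒0<n∸m (≤-<-trans (v₂!-superadditive a b)
      (subst₂ _<_ (trans (sym (v₂!-even q)) (trans (sym (v₂!-odd q)) (cong v₂! (sym a+b≡))))
        (trans (sym (v₂!-even (suc q))) (cong (v₂! ∘ suc) (sym a+b≡))) (s≤s (+-monoʳ-≤ q (v₂!-mono (n≤1+n q))))))))))
  where
  ring : ∀ q → suc q + (suc q + 0) ≡ suc (suc (q * 2))
  ring = solveℕ

extraSplit-top : ∀ r m → m < 2 ^ suc r → extraSplit (2 ^ suc r + m) ≡ 2 ^ suc (suc r) * extraSplit m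
-- `extraSplit 0` is 0 by definition and not a convolution, so this case rests on `extraSplit-pow`.
extraSplit-top r zero    m< = trans (cong extraSplit (+-identityʳ (2 ^ suc r))) (trans (extraSplit-pow r) (sym (*-zeroʳ (2 ^ suc (suc r)))))
extraSplit-top r (suc m) m< = begin
  extraSplit (p + suc m)
    ≡⟨ cong extraSplit (+-suc p m) ⟩
  conv (p + m) (λ a b → noCarry₁ a b * (aOdd a * aOdd b))
    ≡⟨ split-top (suc r) m m<′ (λ a b a< b< eq → cong (_* (aOdd a * aOdd b)) (δ₀-pos (≤-trans
         (carry-overflow (suc r) a< b< (≤-trans (m≤m+n p m) (≤-reflexive (sym eq)))) (carry₀≤carry₁ a b)))) ⟩
  conv m (λ a b → noCarry₁ a (p + b) * (aOdd a * aOdd (p + b))) + conv m (λ a b → noCarry₁ (p + a) b * (aOdd (p + a) * aOdd b))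
    ≡⟨ cong₂ _+_
         (conv-scale m p (λ a b eq → trans (cong (_* (aOdd a * aOdd (p + b))) (cong (δ 0) (carry-topʳ 1 (suc r) (subst (λ k → suc k < p) (sym eq) m<))))
           (x∙yz-scaleʳ p _ (aOdd b) (noCarry₁ a b) (aOdd a) (aOdd-top (suc r) b (summandʳ a b eq m<′)))))
         (conv-scale m p (λ a b eq → trans (cong (_* (aOdd (p + a) * aOdd b)) (cong (δ 0) (carry-topˡ 1 (suc r) (subst (λ k → suc k < p) (sym eq) m<))))
           (x∙yz-scale p _ (aOdd a) (noCarry₁ a b) (aOdd b) (aOdd-top (suc r) a (summandˡ a b eq m<′))))) ⟩
  p * extraSplit (suc m) + p * extraSplit (suc m)
    ≡⟨ ring p (extraSplit (suc m)) ⟩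
  2 * p * extraSplit (suc m) ∎
  where
  p = 2 ^ suc r
  m<′ : m < p
  m<′ = ≤-trans (n≤1+n (suc m)) m<
  ring : ∀ q o → q * o + q * o ≡ 2 * q * o
  ring = solveℕ

-- The recursion for dimensions congruent to 2 modulo 4

mixedSplit oneCarrySplit : ℕ → ℕ
mixedSplit m = conv m (λ a b → noCarry a b * (aMod4 2 a * aOdd b))
oneCarrySplit m = conv m (λ a b → oneCarry a b * (aOdd a * aOdd b))

twoSplit≡ : ∀ m → twoSplit m ≡ 2 * mixedSplit m + oneCarrySplit m
twoSplit≡ m = cong (_+ oneCarrySplit m) (trans (cong (λ k → mixedSplit m + k) flipped) (cong (λ k → mixedSplit m + k) (sym (+-identityʳ _))))
  where
  flipped : conv m (λ a b → noCarry a b * (aOdd a * aMod4 2 b)) ≡ mixedSplit m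
  flipped = trans (conv-flip m (λ a b → noCarry a b * (aOdd a * aMod4 2 b))) (conv-cong m (λ a b _ → cong₂ _*_ (cong (δ 0) (carry-comm 0 b a)) (*-comm (aOdd b) (aMod4 2 a))))

-- With q = 2^r these are C(q, 2) and (C(q, 3) + q)/q, in the form in which the induction yields
-- them. The initial values come from n = 2 and n = 3; the square comes from pairs in which both
-- summands contain 2^r and create the top digit by a single carry.
lowCoeff highCoeff : ℕ → ℕ
lowCoeff zero     = 0
lowCoeff (suc r)  = 2 * lowCoeff r + 2 ^ r * 2 ^ r
highCoeff zero    = 1
highCoeff (suc r) = lowCoeff r + highCoeff r

coeff : ℕ → ℕ → ℕ
coeff r m with m <? 2 ^ r
... | yes _ = lowCoeff r
... | no  _ = highCoeff r

coeff-low : ∀ r {m} → m < 2 ^ r → coeff r m ≡ lowCoeff r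
coeff-low r {m} m< with m <? 2 ^ r
... | yes _ = refl
... | no ¬m< = ⊥-elim (¬m< m<)

coeff-high : ∀ r {m} → 2 ^ r ≤ m → coeff r m ≡ highCoeff r
coeff-high r {m} ≤m with m <? 2 ^ r
... | yes m< = ⊥-elim (<⇒≱ m< ≤m)
... | no _ = refl

TwoAt : ℕ → Set
TwoAt r = ∀ m → m < 2 ^ suc r → aMod4 2 (2 ^ suc r + m) ≡ 2 ^ suc r * aMod4 2 m + coeff r m * aOdd m

weightedSplit : ℕ → ℕ → ℕ
weightedSplit r m = conv m (λ a b → noCarry a b * (coeff r a * aOdd a * aOdd b))

-- If the top digit lies in `b`, `aOdd-top` scales the term. If it lies in `a`, the assumed
-- recursion also leaves behind a multiple of `aOdd a`, collected in `weightedSplit`.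
mixedSplit-top : ∀ r → TwoAt r → ∀ m → m < 2 ^ suc r →
  mixedSplit (2 ^ suc r + m) ≡ 2 ^ suc r * mixedSplit m + (2 ^ suc r * mixedSplit m + weightedSplit r m)
mixedSplit-top r two-at m m< = begin
  mixedSplit (p + m)
    ≡⟨ split-top (suc r) m m< (λ a b → noCarry-overflow (suc r) a b (aMod4 2 a * aOdd b)) ⟩
  conv m (λ a b → noCarry a (p + b) * (aMod4 2 a * aOdd (p + b))) + conv m (λ a b → noCarry (p + a) b * (aMod4 2 (p + a) * aOdd b))
    ≡⟨ cong₂ _+_
         (conv-scale m p (λ a b eq → trans (cong (_* (aMod4 2 a * aOdd (p + b))) (noCarry-topʳ (suc r) a b eq m<))
           (x∙yz-scaleʳ p _ (aOdd b) (noCarry a b) (aMod4 2 a) (aOdd-top (suc r) b (summandʳ a b eq m<)))))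
         (trans (conv-cong m (λ a b eq → trans (cong₂ (λ x y → x * (y * aOdd b)) (noCarry-topˡ (suc r) a b eq m<) (two-at a (summandˡ a b eq m<)))
           (ring p (noCarry a b) (aMod4 2 a) (coeff r a * aOdd a) (aOdd b))))
           (trans (conv-+ m (λ a b → p * (noCarry a b * (aMod4 2 a * aOdd b))) (λ a b → noCarry a b * (coeff r a * aOdd a * aOdd b)))
             (cong (_+ weightedSplit r m) (conv-*ˡ m p (λ a b → noCarry a b * (aMod4 2 a * aOdd b)))))) ⟩
  p * mixedSplit m + (p * mixedSplit m + weightedSplit r m) ∎
  where
  p = 2 ^ suc r
  ring : ∀ p n t o b → n * ((p * t + o) * b) ≡ p * (n * (t * b)) + n * (o * b)
  ring = solveℕ

weightedSplit-low : ∀ r m → m < 2 ^ r → weightedSplit r m ≡ lowCoeff r * oddSplit m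
weightedSplit-low r m m< = conv-scale m (lowCoeff r) (λ a b eq →
  x∙yz-scale (lowCoeff r) _ (aOdd a) (noCarry a b) (aOdd b) (cong (_* aOdd a) (coeff-low r (summandˡ a b eq m<))))

-- If the digit 2^r lies in `b`, then `a` is below 2^r and has coefficient `lowCoeff r`; if it lies
-- in `a`, the coefficient is `highCoeff r`. The factor 2 is absorbed by `oddSplit-top`.
weightedSplit-high : ∀ r m → m < 2 ^ r → 2 * weightedSplit r (2 ^ r + m) ≡ highCoeff (suc r) * oddSplit (2 ^ r + m)
weightedSplit-high r m m< = begin
  2 * weightedSplit r (q + m)
    ≡⟨ cong (2 *_) (split-top r m m< (λ a b → noCarry-overflow r a b (coeff r a * aOdd a * aOdd b))) ⟩
  2 * (conv m (λ a b → noCarry a (q + b) * (coeff r a * aOdd a * aOdd (q + b))) +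
       conv m (λ a b → noCarry (q + a) b * (coeff r (q + a) * aOdd (q + a) * aOdd b)))
    ≡⟨ cong (2 *_) (cong₂ _+_
         (conv-scale m (lowCoeff r * q) (λ a b eq → trans
           (cong₂ (λ x y → x * y) (noCarry-topʳ r a b eq m<)
             (cong₂ (λ x y → x * aOdd a * y) (coeff-low r (summandˡ a b eq m<)) (aOdd-top r b (summandʳ a b eq m<))))
           (ring₁ (noCarry a b) (lowCoeff r) (aOdd a) q (aOdd b))))
         (conv-scale m (highCoeff r * q) (λ a b eq → trans
           (cong₂ (λ x y → x * y) (noCarry-topˡ r a b eq m<)
             (cong₂ (λ x y → x * y * aOdd b) (coeff-high r (m≤m+n q a)) (aOdd-top r a (summandˡ a b eq m<))))
           (ring₂ (noCarry a b) (highCoeff r) (aOdd a) q (aOdd b))))) ⟩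
  2 * (lowCoeff r * q * oddSplit m + highCoeff r * q * oddSplit m)
    ≡⟨ ring₃ (lowCoeff r) (highCoeff r) q (oddSplit m) ⟩
  (lowCoeff r + highCoeff r) * (2 * q * oddSplit m)
    ≡⟨ cong ((lowCoeff r + highCoeff r) *_) (oddSplit-top r (aOdd-top r) m m<) ⟨
  highCoeff (suc r) * oddSplit (q + m) ∎
  where
  q = 2 ^ r
  ring₁ : ∀ n c a q b → n * (c * a * (q * b)) ≡ c * q * (n * (a * b))
  ring₁ = solveℕ
  ring₂ : ∀ n c a q b → n * (c * (q * a) * b) ≡ c * q * (n * (a * b))
  ring₂ = solveℕ
  ring₃ : ∀ c d q o → 2 * (c * q * o + d * q * o) ≡ (c + d) * (2 * q * o)
  ring₃ = solveℕ

oneCarrySplit-top : ∀ r m d → suc m + d ≡ 2 ^ suc r → oneCarrySplit (2 ^ suc r + m) ≡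
  2 ^ suc r * oneCarrySplit m + (middle (2 ^ suc r) m d (λ a b → oneCarry a b * (aOdd a * aOdd b)) + 2 ^ suc r * oneCarrySplit m)
oneCarrySplit-top r m d eqd = trans (conv-split p m d f eqd) (cong₂ (λ x y → x + (middle p m d f + y))
  (conv-scale m p (λ a b eq → trans (cong (_* (aOdd a * aOdd (p + b))) (oneCarry-topʳ (suc r) a b eq m<))
    (x∙yz-scaleʳ p _ (aOdd b) (oneCarry a b) (aOdd a) (aOdd-top (suc r) b (summandʳ a b eq m<)))))
  (conv-scale m p (λ a b eq → trans (cong (_* (aOdd (p + a) * aOdd b)) (oneCarry-topˡ (suc r) a b eq m<))
    (x∙yz-scale p _ (aOdd a) (oneCarry a b) (aOdd b) (aOdd-top (suc r) a (summandˡ a b eq m<))))))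
  where
  p = 2 ^ suc r
  f : ℕ → ℕ → ℕ
  f a b = oneCarry a b * (aOdd a * aOdd b)
  m< : m < p
  m< = subst (suc m ≤_) eqd (m≤m+n (suc m) d)

oneCarry-half : ∀ r a b f → a < 2 ^ r → b < 2 ^ suc r → 2 ^ suc r ≤ a + b → oneCarry a b * f ≡ 0
oneCarry-half r a b f a< b< le = cong (_* f) (δ₁-pos (carry-half r (carry-overflow r) a< b< le))

-- In the middle range a summand below 2^r forces two carries. Otherwise both contain 2^r, their
-- collision is the one carry allowed, and the remainders add to `m` without any; `aOdd-top` applied
-- to both gives the square.
oneCarrySplit-low : ∀ r m → m < 2 ^ r → oneCarrySplit (2 ^ suc r + m) ≡
  2 ^ suc r * oneCarrySplit m + (2 ^ r * 2 ^ r * oddSplit m + 2 ^ suc r * oneCarrySplit m)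
oneCarrySplit-low r m m< with m≤n⇒∃[o]m+o≡n m<
... | d , eqd = trans (oneCarrySplit-top r m (d + (suc m + d)) total)
  (cong (λ k → 2 ^ suc r * oneCarrySplit m + (k + 2 ^ suc r * oneCarrySplit m))
    (trans (cong (λ p → middle p m (d + (suc m + d)) f) (pow-double r))
    (trans (middle-split q m d f eqd
      (λ a b a< b< le → oneCarry-half r a b (aOdd a * aOdd b) a< (subst (b <_) (sym (pow-double r)) b<) (subst (_≤ a + b) (sym (pow-double r)) le))
      (λ a b a< b< le → trans (cong (λ c → δ 1 c * (aOdd a * aOdd b)) (carry-comm 0 a b))
        (oneCarry-half r b a (aOdd a * aOdd b) b< (subst (a <_) (sym (pow-double r)) a<) (subst₂ _≤_ (sym (pow-double r)) (+-comm a b) le))))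
      (conv-scale m (q * q) (λ a b eq → trans
        (cong₂ (λ x y → δ 1 x * y) (carry-both r (summandˡ a b eq m<) (summandʳ a b eq m<))
          (cong₂ _*_ (aOdd-top r a (summandˡ a b eq m<)) (aOdd-top r b (summandʳ a b eq m<))))
        (ring (noCarry a b) q (aOdd a) (aOdd b)))))))
  where
  q = 2 ^ r
  f : ℕ → ℕ → ℕ
  f a b = oneCarry a b * (aOdd a * aOdd b)
  total : suc m + (d + (suc m + d)) ≡ 2 ^ suc r
  total = trans (sym (+-assoc (suc m) d (suc m + d))) (trans (cong₂ _+_ eqd eqd) (sym (pow-double r)))
  ring : ∀ n q a b → n * (q * a * (q * b)) ≡ q * q * (n * (a * b))
  ring = solveℕ

-- The middle range now vanishes: if both summands contain 2^r, their remainders add to m - which is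
-- at least 2^r - and so cause a second carry.
oneCarrySplit-high : ∀ r m → 2 ^ r ≤ m → m < 2 ^ suc r → oneCarrySplit (2 ^ suc r + m) ≡
  2 ^ suc r * oneCarrySplit m + (0 + 2 ^ suc r * oneCarrySplit m)
oneCarrySplit-high r m ≤m m< with m≤n⇒∃[o]m+o≡n m<
... | d , eqd = trans (oneCarrySplit-top r m d eqd)
  (cong (λ k → 2 ^ suc r * oneCarrySplit m + (k + 2 ^ suc r * oneCarrySplit m)) (middle-≡0 (2 ^ suc r) m d eqd vanish))
  where
  vanish : ∀ a b → a < 2 ^ suc r → b < 2 ^ suc r → a + b ≡ 2 ^ suc r + m → oneCarry a b * (aOdd a * aOdd b) ≡ 0
  vanish a b a< b< eq with <-≤-connex a (2 ^ r) | <-≤-connex b (2 ^ r)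
  ... | inj₁ a<′ | _ = oneCarry-half r a b (aOdd a * aOdd b) a<′ b< (≤-trans (m≤m+n (2 ^ suc r) m) (≤-reflexive (sym eq)))
  ... | inj₂ _ | inj₁ b<′ = trans (cong (λ c → δ 1 c * (aOdd a * aOdd b)) (carry-comm 0 a b))
          (oneCarry-half r b a (aOdd a * aOdd b) b<′ a< (≤-trans (m≤m+n (2 ^ suc r) m) (≤-reflexive (trans (sym eq) (+-comm a b)))))
  ... | inj₂ ≤a | inj₂ ≤b with split-≥ ≤a | split-≥ ≤b
  ...   | a′ , refl | b′ , refl = cong (_* (aOdd (2 ^ r + a′) * aOdd (2 ^ r + b′)))
          (δ₁-pos (subst (2 ≤_) (sym (carry-both r (low a<) (low b<))) (s≤s (carry-overflow r (low a<) (low b<) (subst (2 ^ r ≤_) (sym m≡) ≤m)))))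
    where
    low : ∀ {x} → 2 ^ r + x < 2 ^ suc r → x < 2 ^ r
    low {x} lt = +-cancelˡ-< (2 ^ r) x (2 ^ r) (subst (2 ^ r + x <_) (pow-double r) lt)
    m≡ : a′ + b′ ≡ m
    m≡ = +-cancelˡ-≡ (2 ^ suc r) (a′ + b′) m (trans (trans (cong (_+ (a′ + b′)) (pow-double r)) (interchange (2 ^ r) (2 ^ r) a′ b′)) eq)

twoSplit-low : ∀ r → TwoAt r → ∀ m → m < 2 ^ r →
  twoSplit (2 ^ suc r + m) ≡ 2 ^ suc (suc r) * twoSplit m + lowCoeff (suc r) * oddSplit m
twoSplit-low r two-at m m< = begin
  twoSplit (p + m)
    ≡⟨ twoSplit≡ (p + m) ⟩
  2 * mixedSplit (p + m) + oneCarrySplit (p + m)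
    ≡⟨ cong₂ (λ x y → 2 * x + y) (trans (mixedSplit-top r two-at m (<-≤-trans m< (^-monoʳ-≤ 2 (n≤1+n r))))
         (cong (λ k → p * mixedSplit m + (p * mixedSplit m + k)) (weightedSplit-low r m m<))) (oneCarrySplit-low r m m<) ⟩
  2 * (p * mixedSplit m + (p * mixedSplit m + lowCoeff r * oddSplit m)) + (p * oneCarrySplit m + (2 ^ r * 2 ^ r * oddSplit m + p * oneCarrySplit m))
    ≡⟨ ring p (mixedSplit m) (lowCoeff r) (oddSplit m) (oneCarrySplit m) (2 ^ r) ⟩
  2 * p * (2 * mixedSplit m + oneCarrySplit m) + (2 * lowCoeff r + 2 ^ r * 2 ^ r) * oddSplit m
    ≡⟨ cong (λ k → 2 * p * k + lowCoeff (suc r) * oddSplit m) (twoSplit≡ m) ⟨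
  2 * p * twoSplit m + lowCoeff (suc r) * oddSplit m ∎
  where
  p = 2 ^ suc r
  ring : ∀ p s c o t q → 2 * (p * s + (p * s + c * o)) + (p * t + (q * q * o + p * t)) ≡ 2 * p * (2 * s + t) + (2 * c + q * q) * o
  ring = solveℕ

twoSplit-high : ∀ r → TwoAt r → ∀ m → 2 ^ r ≤ m → m < 2 ^ suc r →
  twoSplit (2 ^ suc r + m) ≡ 2 ^ suc (suc r) * twoSplit m + highCoeff (suc r) * oddSplit m
twoSplit-high r two-at m ≤m m< = begin
  twoSplit (p + m)
    ≡⟨ twoSplit≡ (p + m) ⟩
  2 * mixedSplit (p + m) + oneCarrySplit (p + m)
    ≡⟨ cong₂ (λ x y → 2 * x + y) (mixedSplit-top r two-at m m<) (oneCarrySplit-high r m ≤m m<) ⟩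
  2 * (p * mixedSplit m + (p * mixedSplit m + weightedSplit r m)) + (p * oneCarrySplit m + (0 + p * oneCarrySplit m))
    ≡⟨ ring p (mixedSplit m) (weightedSplit r m) (oneCarrySplit m) ⟩
  2 * p * (2 * mixedSplit m + oneCarrySplit m) + 2 * weightedSplit r m
    ≡⟨ cong₂ (λ x y → 2 * p * x + y) (sym (twoSplit≡ m)) weighted ⟩
  2 * p * twoSplit m + highCoeff (suc r) * oddSplit m ∎
  where
  p = 2 ^ suc r
  ring : ∀ p s w t → 2 * (p * s + (p * s + w)) + (p * t + (0 + p * t)) ≡ 2 * p * (2 * s + t) + 2 * w
  ring = solveℕ
  weighted : 2 * weightedSplit r m ≡ highCoeff (suc r) * oddSplit m
  weighted with split-≥ ≤m
  ... | y , refl = weightedSplit-high r y (+-cancelˡ-< (2 ^ r) y (2 ^ r) (subst (2 ^ r + y <_) (pow-double r) m<))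

-- The threshold 2^(r+1) is even, so 2y and 2y + 1 lie on the same side of it.
coeff-even : ∀ r y → coeff (suc r) (y * 2) ≡ coeff (suc r) (suc (y * 2))
coeff-even r y with <-≤-connex y (2 ^ r)
... | inj₁ y< = trans (coeff-low (suc r) (≤-trans (n≤1+n _) odd<)) (sym (coeff-low (suc r) odd<))
  where
  odd< : suc (y * 2) < 2 ^ suc r
  odd< = subst (suc y * 2 ≤_) (sym (pow-halves r)) (*-monoˡ-≤ 2 y<)
... | inj₂ ≤y = trans (coeff-high (suc r) even≥) (sym (coeff-high (suc r) (m≤n⇒m≤1+n even≥)))
  where
  even≥ : 2 ^ suc r ≤ y * 2
  even≥ = subst (_≤ y * 2) (sym (pow-halves r)) (*-monoˡ-≤ 2 ≤y)

-- The coefficient is taken at `m * 2` because `twoSplit m` counts partitions of 2m: the threshold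
-- 2^r for `m` is the threshold 2^(r+1) for 2m.
twoSplit-top : ∀ r → TwoAt r → ∀ m → m < 2 ^ suc r →
  twoSplit (2 ^ suc r + m) ≡ 2 ^ suc (suc r) * twoSplit m + coeff (suc r) (m * 2) * oddSplit m
twoSplit-top r two-at m m< with <-≤-connex m (2 ^ r)
... | inj₁ m<′ = trans (twoSplit-low r two-at m m<′) (cong (λ c → 2 ^ suc (suc r) * twoSplit m + c * oddSplit m)
  (sym (coeff-low (suc r) (subst (m * 2 <_) (sym (pow-halves r)) (*-monoˡ-< 2 m<′)))))
... | inj₂ ≤m = trans (twoSplit-high r two-at m ≤m m<) (cong (λ c → 2 ^ suc (suc r) * twoSplit m + c * oddSplit m)
  (sym (coeff-high (suc r) (subst (_≤ m * 2) (sym (pow-halves r)) (*-monoˡ-≤ 2 ≤m)))))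

aMod4-2-top : ∀ r → TwoAt r
-- The cases n = 2 and n = 3 are evaluated; the shape (2,1), of dimension 2, accounts for
-- `highCoeff 0` being 1.
aMod4-2-top zero zero          _ = refl
aMod4-2-top zero (suc zero)    _ = refl
aMod4-2-top zero (suc (suc m)) (s≤s (s≤s ()))
aMod4-2-top (suc r) m m< with evenOrOdd m
... | even y = begin
  aMod4 2 (p + y * 2)                                   ≡⟨ cong (aMod4 2) (pow+even (suc r) y) ⟩
  aMod4 2 ((2 ^ suc r + y) * 2)                         ≡⟨ aMod4-2-even (2 ^ suc r + y) ⟩
  twoSplit (2 ^ suc r + y)                              ≡⟨ twoSplit-top r (aMod4-2-top r) y (half-<-even {suc r} m<) ⟩
  p * twoSplit y + coeff (suc r) (y * 2) * oddSplit y   ≡⟨ cong₂ (λ s t → p * s + coeff (suc r) (y * 2) * t) (aMod4-2-even y) (aOdd-even y) ⟨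
  p * aMod4 2 (y * 2) + coeff (suc r) (y * 2) * aOdd (y * 2) ∎
  where p = 2 ^ suc (suc r)
... | odd y = begin
  aMod4 2 (p + suc (y * 2))                             ≡⟨ cong (aMod4 2) (pow+odd (suc r) y) ⟩
  aMod4 2 (suc ((2 ^ suc r + y) * 2))                   ≡⟨ aMod4-2-odd (2 ^ suc r + y) ⟩
  -- `extraSplit` scales by the same power of two as `twoSplit` and adds no multiple of `oddSplit`,
  -- so the odd case has the same coefficient as the even one.
  twoSplit (2 ^ suc r + y) + extraSplit (2 ^ suc r + y) ≡⟨ cong₂ _+_ (twoSplit-top r (aMod4-2-top r) y y<) (extraSplit-top r y y<) ⟩
  p * twoSplit y + coeff (suc r) (y * 2) * oddSplit y + p * extraSplit y
                                                        ≡⟨ ring p (twoSplit y) (coeff (suc r) (y * 2) * oddSplit y) (extraSplit y) ⟩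
  p * (twoSplit y + extraSplit y) + coeff (suc r) (y * 2) * oddSplit y
                                                        ≡⟨ cong₂ (λ s t → p * s + t) (sym (aMod4-2-odd y)) (cong₂ _*_ (coeff-even r y) (sym (aOdd-odd y))) ⟩
  p * aMod4 2 (suc (y * 2)) + coeff (suc r) (suc (y * 2)) * aOdd (suc (y * 2)) ∎
  where
  p = 2 ^ suc (suc r)
  y< : y < 2 ^ suc r
  y< = half-<-odd {suc r} m<
  ring : ∀ p s c e → p * s + c + p * e ≡ p * (s + e) + c
  ring = solveℕ

-- Closed forms of the coefficients

twice-C₂ : ∀ n → 2 * (n C 2) + n ≡ n * n
twice-C₂ zero    = refl
twice-C₂ (suc n) = begin
  2 * (suc n C 2) + suc n         ≡⟨ cong (λ k → 2 * k + suc n) (trans (sym (nCk+nC[k+1]≡[n+1]C[k+1] n 1)) (cong (_+ n C 2) (nC1≡n n))) ⟩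
  2 * (n + n C 2) + suc n         ≡⟨ ring₁ n (n C 2) ⟩
  (2 * (n C 2) + n) + 2 * n + 1   ≡⟨ cong (λ k → k + 2 * n + 1) (twice-C₂ n) ⟩
  n * n + 2 * n + 1               ≡⟨ ring₂ n ⟩
  suc n * suc n                   ∎
  where
  ring₁ : ∀ n c → 2 * (n + c) + suc n ≡ (2 * c + n) + 2 * n + 1
  ring₁ = solveℕ
  ring₂ : ∀ n → n * n + 2 * n + 1 ≡ suc n * suc n
  ring₂ = solveℕ

-- This is n(n - 1)(n - 2) = n³ - 3n² + 2n with the negative term moved across.
six-C₃ : ∀ n → 6 * (n C 3) + 3 * (n * n) ≡ n * n * n + 2 * n
six-C₃ zero    = refl
six-C₃ (suc n) = begin
  6 * (suc n C 3) + 3 * (suc n * suc n)       ≡⟨ cong (λ k → 6 * k + 3 * (suc n * suc n)) (sym (nCk+nC[k+1]≡[n+1]C[k+1] n 2)) ⟩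
  6 * (n C 2 + n C 3) + 3 * (suc n * suc n)   ≡⟨ ring₁ n (n C 2) (n C 3) ⟩
  3 * (2 * (n C 2) + n) + (6 * (n C 3) + 3 * (n * n)) + 3 * n + 3
                                              ≡⟨ cong₂ (λ x y → 3 * x + y + 3 * n + 3) (twice-C₂ n) (six-C₃ n) ⟩
  3 * (n * n) + (n * n * n + 2 * n) + 3 * n + 3 ≡⟨ ring₂ n ⟩
  suc n * suc n * suc n + 2 * suc n           ∎
  where
  ring₁ : ∀ n c d → 6 * (c + d) + 3 * (suc n * suc n) ≡ 3 * (2 * c + n) + (6 * d + 3 * (n * n)) + 3 * n + 3
  ring₁ = solveℕ
  ring₂ : ∀ n → 3 * (n * n) + (n * n * n + 2 * n) + 3 * n + 3 ≡ suc n * suc n * suc n + 2 * suc n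
  ring₂ = solveℕ

twice-lowCoeff : ∀ r → 2 * lowCoeff r + 2 ^ r ≡ 2 ^ r * 2 ^ r
twice-lowCoeff zero    = refl
twice-lowCoeff (suc r) = begin
  2 * (2 * lowCoeff r + q * q) + 2 * q   ≡⟨ ring₁ (lowCoeff r) q ⟩
  2 * (2 * lowCoeff r + q) + 2 * (q * q) ≡⟨ cong (λ k → 2 * k + 2 * (q * q)) (twice-lowCoeff r) ⟩
  2 * (q * q) + 2 * (q * q)              ≡⟨ ring₂ q ⟩
  2 * q * (2 * q)                        ∎
  where
  q = 2 ^ r
  ring₁ : ∀ c q → 2 * (2 * c + q * q) + 2 * q ≡ 2 * (2 * c + q) + 2 * (q * q)
  ring₁ = solveℕ
  ring₂ : ∀ q → 2 * (q * q) + 2 * (q * q) ≡ 2 * q * (2 * q)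
  ring₂ = solveℕ

-- With q = 2^r the value is (q - 1)(q - 2)/6 + 1, that is, C(q, 3)/q + 1.
six-highCoeff : ∀ r → 6 * highCoeff r + 3 * 2 ^ r ≡ 2 ^ r * 2 ^ r + 8
six-highCoeff zero    = refl
six-highCoeff (suc r) = begin
  6 * (lowCoeff r + highCoeff r) + 3 * (2 * q)                ≡⟨ ring₁ (lowCoeff r) (highCoeff r) q ⟩
  3 * (2 * lowCoeff r + q) + (6 * highCoeff r + 3 * q)        ≡⟨ cong₂ (λ x y → 3 * x + y) (twice-lowCoeff r) (six-highCoeff r) ⟩
  3 * (q * q) + (q * q + 8)                                   ≡⟨ ring₂ q ⟩
  2 * q * (2 * q) + 8                                         ∎
  where
  q = 2 ^ r
  ring₁ : ∀ c d q → 6 * (c + d) + 3 * (2 * q) ≡ 3 * (2 * c + q) + (6 * d + 3 * q)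
  ring₁ = solveℕ
  ring₂ : ∀ q → 3 * (q * q) + (q * q + 8) ≡ 2 * q * (2 * q) + 8
  ring₂ = solveℕ

lowCoeff≡ : ∀ r → lowCoeff r ≡ (2 ^ r) C 2
lowCoeff≡ r = *-cancelˡ-≡ _ _ 2 (+-cancelʳ-≡ (2 ^ r) _ _ (trans (twice-lowCoeff r) (sym (twice-C₂ (2 ^ r)))))

highCoeff≡ : ∀ r → 2 ^ r * highCoeff r ≡ (2 ^ r) C 3 + 2 ^ r
highCoeff≡ r = *-cancelˡ-≡ _ _ 6 (+-cancelʳ-≡ (3 * (q * q)) _ _ (begin
  6 * (q * highCoeff r) + 3 * (q * q)     ≡⟨ ring₁ q (highCoeff r) ⟩
  q * (6 * highCoeff r + 3 * q)           ≡⟨ cong (q *_) (six-highCoeff r) ⟩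
  q * (q * q + 8)                         ≡⟨ ring₂ q ⟩
  (q * q * q + 2 * q) + 6 * q             ≡⟨ cong (_+ 6 * q) (six-C₃ q) ⟨
  6 * (q C 3) + 3 * (q * q) + 6 * q       ≡⟨ ring₃ (q C 3) q ⟩
  6 * (q C 3 + q) + 3 * (q * q)           ∎))
  where
  q = 2 ^ r
  ring₁ : ∀ q c → 6 * (q * c) + 3 * (q * q) ≡ q * (6 * c + 3 * q)
  ring₁ = solveℕ
  ring₂ : ∀ q → q * (q * q + 8) ≡ (q * q * q + 2 * q) + 6 * q
  ring₂ = solveℕ
  ring₃ : ∀ c q → 6 * c + 3 * (q * q) + 6 * q ≡ 6 * (c + q) + 3 * (q * q)
  ring₃ = solveℕ

theorem1p1 : (R m : ℕ) → 1 ≤ R → m < 2 ^ R →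
    (m < 2 ^ (R ∸ 1) →
    aMod4 2 (2 ^ R + m) ≡ 2 ^ R * aMod4 2 m + ((2 ^ (R ∸ 1)) C 2) * aOdd m)
    × (2 ^ (R ∸ 1) ≤ m →
    2 ^ (R ∸ 1) * aMod4 2 (2 ^ R + m)
    ≡ 2 ^ (R ∸ 1) * (2 ^ R * aMod4 2 m) + (((2 ^ (R ∸ 1)) C 3) + 2 ^ (R ∸ 1)) * aOdd m)
theorem1p1 (suc r) m _ m< = low , high
  where
  q = 2 ^ r
  low : m < q → aMod4 2 (2 ^ suc r + m) ≡ 2 ^ suc r * aMod4 2 m + (q C 2) * aOdd m
  low m<q = trans (aMod4-2-top r m m<)
    (cong (λ c → 2 ^ suc r * aMod4 2 m + c * aOdd m) (trans (coeff-low r m<q) (lowCoeff≡ r)))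
  -- The quotient a(m)/q of the formula is cleared by multiplying through by q, which turns
  -- `highCoeff r` into C(q, 3) + q.
  high : q ≤ m → q * aMod4 2 (2 ^ suc r + m) ≡ q * (2 ^ suc r * aMod4 2 m) + ((q C 3) + q) * aOdd m
  high q≤m = begin
    q * aMod4 2 (2 ^ suc r + m)
      ≡⟨ cong (q *_) (trans (aMod4-2-top r m m<) (cong (λ c → 2 ^ suc r * aMod4 2 m + c * aOdd m) (coeff-high r q≤m))) ⟩
    q * (2 ^ suc r * aMod4 2 m + highCoeff r * aOdd m)
      ≡⟨ trans (*-distribˡ-+ q _ _) (cong (λ k → q * (2 ^ suc r * aMod4 2 m) + k) (sym (*-assoc q (highCoeff r) (aOdd m)))) ⟩
    q * (2 ^ suc r * aMod4 2 m) + q * highCoeff r * aOdd m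
      ≡⟨ cong (λ c → q * (2 ^ suc r * aMod4 2 m) + c * aOdd m) (highCoeff≡ r) ⟩
    q * (2 ^ suc r * aMod4 2 m) + ((q C 3) + q) * aOdd m ∎
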